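{- The class of permutation graphs admits $\mathrm{FP{+}C}$-definable canonization.
   Context: A graph $G=(V,E)$ is a permutation graph if it has a realizer: a pair $(<_1,<_2)$ of strict linear orders on $V$ such that distinct $u,v\in V$ are adjacent iff they occur in different order in $<_1$ and $<_2$. $\mathrm{FP{+}C}$ is (inflationary) fixed-point logic with counting over two-sorted structures (number sort $N(A)=[0,|U(A)|]$). A class $\mathcal{K}$ of graphs admits $\mathrm{FP{+}C}$-definable canonization if there is an $\mathrm{FP{+}C}$-transduction (an interpretation given by $\mathrm{FP{+}C}$-formulas defining a domain condition, a universe as a definable set of tuples of elements/numbers, an equivalence relation to be factored out, and the relations $E$ and $\le$) without parameters that maps every $G\in\mathcal{K}$ to an ordered copy of $G$, i.e., a structure isomorphic to $G$ expanded with a linear order $\le$ of its universe. -}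

module Defs where

open import Level using (0ℓ)
open import Data.Bool using (Bool; true; false; _∨_; _∧_; not; if_then_else_)
open import Data.Nat using (ℕ; zero; suc; _*_; _≤ᵇ_)
open import Data.Nat.ListAction using (product)
open import Data.Fin using (Fin; zero; suc; inject₁; toℕ)
open import Data.Fin.Properties using (_≟_)
open import Data.List using (List; []; _∷_; _++_; map)
open import Data.List.Relation.Unary.All using (All; []; _∷_; lookup)
open import Data.List.Membership.Propositional using (_∈_)
open import Data.Product using (Σ; _×_; _,_; ∃)
open import Data.Sum using (_⊎_)
open import Relation.Nullary using (¬_)
open import Relation.Nullary.Decidable using (⌊_⌋)
open import Relation.Binary using (Rel; IsStrictTotalOrder; IsTotalOrder; IsEquivalence)
open import Relation.Binary.PropositionalEquality using (_≡_; _≢_)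
open import Function.Bundles using (_⇔_)

record Graph (n : ℕ) : Set where
  field
    E     : Fin n → Fin n → Bool
    sym   : ∀ u v → E u v ≡ E v u
    irref : ∀ v → E v v ≡ false

open Graph public

record Realizer {n : ℕ} (G : Graph n) : Set₁ where
  field
    _<₁_ : Rel (Fin n) 0ℓ
    _<₂_ : Rel (Fin n) 0ℓ
    lin₁ : IsStrictTotalOrder _≡_ _<₁_
    lin₂ : IsStrictTotalOrder _≡_ _<₂_
    adj  : ∀ u v → u ≢ v →
           (E G u v ≡ true) ⇔ ((u <₁ v × v <₂ u) ⊎ (v <₁ u × u <₂ v))

IsPermutationGraph : {n : ℕ} → Graph n → Set₁
IsPermutationGraph G = Realizer G

data Sort : Set where
  el num : Sort

Arity : Set
Arity = List Sort

Ctx : Set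
Ctx = List Sort

RCtx : Set
RCtx = List Arity

mutual
  data Tm (Γ : Ctx) (Δ : RCtx) : Sort → Set where
    var   : ∀ {s} → s ∈ Γ → Tm Γ Δ s
    count : Fm (el ∷ Γ) Δ → Tm Γ Δ num

  data Fm (Γ : Ctx) (Δ : RCtx) : Set where
    edge : Tm Γ Δ el → Tm Γ Δ el → Fm Γ Δ
    eq   : ∀ {s} → Tm Γ Δ s → Tm Γ Δ s → Fm Γ Δ
    leq  : Tm Γ Δ num → Tm Γ Δ num → Fm Γ Δ
    rel  : ∀ {a} → a ∈ Δ → Tms Γ Δ a → Fm Γ Δ
    neg  : Fm Γ Δ → Fm Γ Δ
    and  : Fm Γ Δ → Fm Γ Δ → Fm Γ Δ
    or   : Fm Γ Δ → Fm Γ Δ → Fm Γ Δ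
    ex   : (s : Sort) → Fm (s ∷ Γ) Δ → Fm Γ Δ
    all  : (s : Sort) → Fm (s ∷ Γ) Δ → Fm Γ Δ
    -- [ifp R x̄ . φ](t̄): φ has the new variables x̄ (of sorts a) and the
    -- new relation variable R (of arity a) free
    ifp  : (a : Arity) → Fm (a ++ Γ) (a ∷ Δ) → Tms Γ Δ a → Fm Γ Δ

  data Tms (Γ : Ctx) (Δ : RCtx) : Arity → Set where
    []  : Tms Γ Δ []
    _∷_ : ∀ {s a} → Tm Γ Δ s → Tms Γ Δ a → Tms Γ Δ (s ∷ a)

size : ℕ → Sort → ℕ
size n el  = n
size n num = suc n

Dom : ℕ → Sort → Set
Dom n s = Fin (size n s)

Tuple : ℕ → Arity → Set
Tuple n a = All (Dom n) a

RelVal : ℕ → Arity → Set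
RelVal n a = Tuple n a → Bool

anyFin : (m : ℕ) → (Fin m → Bool) → Bool
anyFin zero    f = false
anyFin (suc m) f = f zero ∨ anyFin m (λ i → f (suc i))

allFin : (m : ℕ) → (Fin m → Bool) → Bool
allFin zero    f = true
allFin (suc m) f = f zero ∧ allFin m (λ i → f (suc i))

countFin : (m : ℕ) → (Fin m → Bool) → Fin (suc m)
countFin zero    f = zero
countFin (suc m) f with f zero
... | true  = suc (countFin m (λ i → f (suc i)))
... | false = inject₁ (countFin m (λ i → f (suc i)))

append : ∀ {n a Γ} → Tuple n a → All (Dom n) Γ → All (Dom n) (a ++ Γ)
append []       ys = ys
append (x ∷ xs) ys = x ∷ append xs ys

eqDom : ∀ {n} s → Dom n s → Dom n s → Bool
eqDom s x y = ⌊ x ≟ y ⌋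

-- number of tuples of arity a: after this many stages the inflationary
-- iteration has reached its fixed point
numTuples : ℕ → Arity → ℕ
numTuples n a = product (map (size n) a)

iterate : ∀ {A : Set} → ℕ → (A → A) → A → A
iterate zero    f x = x
iterate (suc k) f x = f (iterate k f x)

mutual
  evalTm : ∀ {n Γ Δ s} → Graph n → All (Dom n) Γ → All (RelVal n) Δ →
           Tm Γ Δ s → Dom n s
  evalTm G ρ σ (var x)   = lookup ρ x
  evalTm {n} G ρ σ (count φ) = countFin n (λ i → eval G (i ∷ ρ) σ φ)

  evalTms : ∀ {n Γ Δ a} → Graph n → All (Dom n) Γ → All (RelVal n) Δ →
            Tms Γ Δ a → Tuple n a
  evalTms G ρ σ []       = []
  evalTms G ρ σ (t ∷ ts) = evalTm G ρ σ t ∷ evalTms G ρ σ ts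

  eval : ∀ {n Γ Δ} → Graph n → All (Dom n) Γ → All (RelVal n) Δ →
         Fm Γ Δ → Bool
  eval G ρ σ (edge t u)  = E G (evalTm G ρ σ t) (evalTm G ρ σ u)
  eval G ρ σ (eq {s} t u) = eqDom s (evalTm G ρ σ t) (evalTm G ρ σ u)
  eval G ρ σ (leq t u)   = toℕ (evalTm G ρ σ t) ≤ᵇ toℕ (evalTm G ρ σ u)
  eval G ρ σ (rel r ts)  = lookup σ r (evalTms G ρ σ ts)
  eval G ρ σ (neg φ)     = not (eval G ρ σ φ)
  eval G ρ σ (and φ ψ)   = eval G ρ σ φ ∧ eval G ρ σ ψ
  eval G ρ σ (or φ ψ)    = eval G ρ σ φ ∨ eval G ρ σ ψ
  eval {n} G ρ σ (ex s φ)  = anyFin (size n s) (λ x → eval G (x ∷ ρ) σ φ)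
  eval {n} G ρ σ (all s φ) = allFin (size n s) (λ x → eval G (x ∷ ρ) σ φ)
  eval {n} G ρ σ (ifp a φ ts) =
    iterate (numTuples n a)
            (λ R x̄ → R x̄ ∨ eval G (append x̄ ρ) (R ∷ σ) φ)
            (λ _ → false)
            (evalTms G ρ σ ts)

-- FP+C transductions (without parameters) from graphs to structures with
-- an edge relation E and a binary relation ≤.  The universe is a set of
-- tuples of sort pattern `sorts` (elements and numbers), factored by a
-- definable equivalence relation.

record Transduction : Set where
  field
    sorts : Arity
    φdom  : Fm [] []
    φuni  : Fm sorts []
    φeqv  : Fm (sorts ++ sorts) []
    φedge : Fm (sorts ++ sorts) []
    φleq  : Fm (sorts ++ sorts) []

module _ (T : Transduction) {n : ℕ} (G : Graph n) where
  open Transduction T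

  holds : ∀ {Γ} → Fm Γ [] → All (Dom n) Γ → Set
  holds φ ρ = eval G ρ [] φ ≡ true

  holds₂ : Fm (sorts ++ sorts) [] → Tuple n sorts → Tuple n sorts → Set
  holds₂ φ x̄ ȳ = holds φ (append x̄ ȳ)

  U : Tuple n sorts → Set
  U x̄ = holds φuni x̄

  _≈_ : Tuple n sorts → Tuple n sorts → Set
  x̄ ≈ ȳ = holds₂ φeqv x̄ ȳ

  Induced : Fm (sorts ++ sorts) [] → Tuple n sorts → Tuple n sorts → Set
  Induced φ x̄ ȳ = Σ (Tuple n sorts) λ x̄' → Σ (Tuple n sorts) λ ȳ' →
                    U x̄' × U ȳ' × x̄' ≈ x̄ × ȳ' ≈ ȳ × holds₂ φ x̄' ȳ'

  record MapsToOrderedCopy : Set where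
    field
      dom   : holds φdom []
      refl≈ : ∀ x̄ → U x̄ → x̄ ≈ x̄
      sym≈  : ∀ x̄ ȳ → U x̄ → U ȳ → x̄ ≈ ȳ → ȳ ≈ x̄
      trans≈ : ∀ x̄ ȳ z̄ → U x̄ → U ȳ → U z̄ → x̄ ≈ ȳ → ȳ ≈ z̄ → x̄ ≈ z̄
      f     : Fin n → Tuple n sorts
      f-U   : ∀ v → U (f v)
      f-inj : ∀ u v → f u ≈ f v → u ≡ v
      f-sur : ∀ x̄ → U x̄ → Σ (Fin n) λ v → x̄ ≈ f v
      f-E   : ∀ u v → (E G u v ≡ true) ⇔ Induced φedge (f u) (f v)
      f-≤   : IsTotalOrder _≡_ (λ u v → Induced φleq (f u) (f v))

AdmitsFPCCanonization : (∀ {n} → Graph n → Set₁) → Set₁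
AdmitsFPCCanonization K =
  Σ Transduction λ T → ∀ (n : ℕ) (G : Graph n) → K G → MapsToOrderedCopy T G

{-# OPTIONS --safe #-}

-- A linear order L is the first order of a realizer of G iff y never lies L-between x and z
-- when yx and yz have the same type (edge or non-edge) and xz has the other one.  So in every
-- realizer the order of (y , x) forces that of (y , z), and L can be recovered from one ordered
-- edge and one ordered non-edge as soon as all edges, and all non-edges, are linked by forcing.
--
-- Split V recursively: a disconnected class into its components, a co-disconnected one into its
-- co-components, any other class into its maximal proper modules.  In the last case the vertices
-- of a colour class (the pairs linked to a given one by forcing) form a module meeting two
-- children, hence are everything, and by the triangle lemma there is only one colour for each
-- type.  So four vertices define a linear order of the children.  In the first two cases the
-- children are sorted by their canonical copies; ties are harmless, as all pairs between
-- different children have the same type.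
--
-- Canonical copies, as graphs on an initial segment of the numbers, are built bottom-up: the
-- intervals of the children are concatenated, and the lexicographically least result over all
-- choices of the four vertices is kept.  A staged iteration inside one inflationary fixed point
-- makes both recursions definable; all other recursions are reachability.

module Submission where

open import Defs
open import Data.Bool using (Bool; true; false; _∨_; _∧_; not; if_then_else_)
import Data.Bool.Properties as Bool
open import Data.Nat using (ℕ; zero; suc; _+_; _*_; _∸_; _≤_; _<_; z≤n; s≤s; s≤s⁻¹; _≤ᵇ_)
import Data.Nat.Properties as ℕ
open import Data.Fin using (Fin; zero; suc; toℕ; inject₁; fromℕ<; punchOut)
import Data.Fin.Properties as Fin
open import Data.List using (List; []; _∷_; _++_; map; drop; length)
open import Data.List.Relation.Unary.All as All using (All; []; _∷_; lookup)
open import Data.List.Relation.Unary.Any using (here; there; any?)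
open import Data.List.Membership.Propositional using (_∈_; find; lose)
open import Data.Product using (Σ; _×_; _,_; ∃; proj₁; proj₂)
open import Data.Sum using (_⊎_; inj₁; inj₂; [_,_]′)
open import Data.Empty using (⊥; ⊥-elim)
open import Data.Unit using (⊤; tt)
open import Relation.Nullary using (¬_; Dec; yes; no)
open import Relation.Nullary.Decidable using (⌊_⌋; ¬?; _×-dec_; _⊎-dec_; _→-dec_)
import Relation.Nullary.Decidable as Dec
open import Relation.Binary using (tri<; tri≈; tri>)
import Relation.Binary.PropositionalEquality as ≡
open ≡ using (_≡_; _≢_; refl; cong; cong₂; subst; trans)
open import Relation.Binary.Construct.Closure.ReflexiveTransitive as Star using (Star; ε; _◅_; _◅◅_)
open import Function.Bundles using (_⇔_; mk⇔; Equivalence)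
open Equivalence using (to; from)
import Data.List as List
import Data.List.Properties as List
import Data.List.Membership.Propositional.Properties as ∈
open import Function using (id; _∘_; const)
open import Data.Nat.Divisibility using (_∣_; _∣?_; divides; _∣0; ∣-refl; ∣m∣n⇒∣m+n)

-- The realizer is not definable and enters an existence argument only: some four vertices order the
-- children of a prime node linearly. A formula tests whether a given quadruple does so. The test
-- asks for a linear order, not for one that stems from a realizer; every quadruple that passes
-- yields an isomorphic copy, and minimising removes the choice.
--
-- Inflation is the obstacle: splitting a class and minimising both use the previous stage
-- negatively, and a tuple once derived cannot be withdrawn. So stages carry their index and are
-- read only when complete. As stage 0 is empty, the first loop stores which vertices are separated;
-- for the second loop the empty relation already is the copy of a singleton. A class with two
-- vertices loses at least one at each level, so `n` stages suffice.
--
-- Formulas are built together with a proved meaning, and evaluation then decides this meaning;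
-- connectivity, least modules and forcing are decided in this way. The vertex set of a colour class
-- is not, whence the double negations in the prime case.

Env : ℕ → Ctx → Set
Env n Γ = All (Dom n) Γ

REnv : ℕ → RCtx → Set
REnv n Δ = All (RelVal n) Δ

-- Renamings of variables and their semantics

_⊑_ : Ctx → Ctx → Set
Γ ⊑ Γ' = All (_∈ Γ') Γ

pick : ∀ {n Γ Γ'} → Env n Γ' → Γ ⊑ Γ' → Env n Γ
pick ρ f = All.map (lookup ρ) f

wk : ∀ {s : Sort} {Γ} a → s ∈ Γ → s ∈ a ++ Γ
wk []      x = x
wk (_ ∷ a) x = there (wk a x)

lifts : ∀ {Γ Γ'} a → Γ ⊑ Γ' → (a ++ Γ) ⊑ (a ++ Γ')
lifts []      f = f
lifts (s ∷ a) f = here refl ∷ All.map there (lifts a f)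

-- A relation variable may be renamed to one with extra leading arguments,
-- which are then filled by fixed variables.
RMap : Ctx → RCtx → RCtx → Set
RMap Γ' Δ Δ' = All (λ b → Σ Ctx λ pre → pre ⊑ Γ' × (pre ++ b) ∈ Δ') Δ

wkR : ∀ {Γ' Δ Δ'} a → RMap Γ' Δ Δ' → RMap (a ++ Γ') Δ Δ'
wkR a = All.map λ { (pre , vs , r) → pre , All.map (wk a) vs , r }

bindR : ∀ {Γ' Δ Δ'} a → RMap Γ' Δ Δ' → RMap (a ++ Γ') (a ∷ Δ) (a ∷ Δ')
bindR a g = ([] , [] , here refl) ∷
            All.map (λ { (pre , vs , r) → pre , All.map (wk a) vs , there r }) g

_++ᵗ_ : ∀ {Γ Δ a b} → a ⊑ Γ → Tms Γ Δ b → Tms Γ Δ (a ++ b)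
[]       ++ᵗ ts = ts
(v ∷ vs) ++ᵗ ts = var v ∷ (vs ++ᵗ ts)

mutual
  renTm : ∀ {Γ Γ' Δ Δ' s} → Γ ⊑ Γ' → RMap Γ' Δ Δ' → Tm Γ Δ s → Tm Γ' Δ' s
  renTm f g (var x)   = var (lookup f x)
  renTm f g (count φ) = count (ren (lifts (el ∷ []) f) (wkR (el ∷ []) g) φ)

  renTms : ∀ {Γ Γ' Δ Δ' a} → Γ ⊑ Γ' → RMap Γ' Δ Δ' → Tms Γ Δ a → Tms Γ' Δ' a
  renTms f g []       = []
  renTms f g (t ∷ ts) = renTm f g t ∷ renTms f g ts

  ren : ∀ {Γ Γ' Δ Δ'} → Γ ⊑ Γ' → RMap Γ' Δ Δ' → Fm Γ Δ → Fm Γ' Δ'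
  ren f g (edge t u)  = edge (renTm f g t) (renTm f g u)
  ren f g (eq t u)    = eq (renTm f g t) (renTm f g u)
  ren f g (leq t u)   = leq (renTm f g t) (renTm f g u)
  ren f g (rel r ts)  = rel (proj₂ (proj₂ (lookup g r)))
                            (proj₁ (proj₂ (lookup g r)) ++ᵗ renTms f g ts)
  ren f g (neg φ)     = neg (ren f g φ)
  ren f g (and φ ψ)   = and (ren f g φ) (ren f g ψ)
  ren f g (or φ ψ)    = or (ren f g φ) (ren f g ψ)
  ren f g (ex s φ)    = ex s (ren (lifts (s ∷ []) f) (wkR (s ∷ []) g) φ)
  ren f g (all s φ)   = all s (ren (lifts (s ∷ []) f) (wkR (s ∷ []) g) φ)
  ren f g (ifp a φ ts) = ifp a (ren (lifts a f) (bindR a g) φ) (renTms f g ts)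

anyFin-cong : ∀ m {f g : Fin m → Bool} → (∀ i → f i ≡ g i) → anyFin m f ≡ anyFin m g
anyFin-cong zero    h = refl
anyFin-cong (suc m) h = cong₂ _∨_ (h zero) (anyFin-cong m (λ i → h (suc i)))

allFin-cong : ∀ m {f g : Fin m → Bool} → (∀ i → f i ≡ g i) → allFin m f ≡ allFin m g
allFin-cong zero    h = refl
allFin-cong (suc m) h = cong₂ _∧_ (h zero) (allFin-cong m (λ i → h (suc i)))

countFin-cong : ∀ m {f g : Fin m → Bool} → (∀ i → f i ≡ g i) → countFin m f ≡ countFin m g
countFin-cong zero    h = refl
countFin-cong (suc m) {f} {g} h with f zero | g zero | h zero
... | true  | _ | refl = cong suc (countFin-cong m (λ i → h (suc i)))
... | false | _ | refl = cong inject₁ (countFin-cong m (λ i → h (suc i)))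

iterate-cong : ∀ {X : Set} k {F F' : (X → Bool) → X → Bool} →
               (∀ {R R'} → (∀ x → R x ≡ R' x) → ∀ x → F R x ≡ F' R' x) →
               ∀ x → iterate k F (λ _ → false) x ≡ iterate k F' (λ _ → false) x
iterate-cong zero    h x = refl
iterate-cong (suc k) h x = h (iterate-cong k h) x

-- Stages of a fixed point are functions into `Bool`. Without function extensionality they can only
-- be compared pointwise, so evaluation has to be shown to respect this relation.
_≗ʳ_ : ∀ {n Δ} → REnv n Δ → REnv n Δ → Set
σ ≗ʳ σ' = ∀ {a} (r : a ∈ _) x̄ → lookup σ r x̄ ≡ lookup σ' r x̄

∷-cong : ∀ {n Δ a} {R R' : RelVal n a} {σ σ' : REnv n Δ} →
         (∀ x̄ → R x̄ ≡ R' x̄) → σ ≗ʳ σ' → (R ∷ σ) ≗ʳ (R' ∷ σ')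
∷-cong h k (here refl) x̄ = h x̄
∷-cong h k (there r)   x̄ = k r x̄

mutual
  evalTm-cong : ∀ {n Γ Δ s} {G : Graph n} {ρ} {σ σ' : REnv n Δ} → σ ≗ʳ σ' →
                (t : Tm Γ Δ s) → evalTm G ρ σ t ≡ evalTm G ρ σ' t
  evalTm-cong h (var x)       = refl
  evalTm-cong {n} h (count φ) = countFin-cong n λ i → eval-cong h φ

  evalTms-cong : ∀ {n Γ Δ a} {G : Graph n} {ρ} {σ σ' : REnv n Δ} → σ ≗ʳ σ' →
                 (ts : Tms Γ Δ a) → evalTms G ρ σ ts ≡ evalTms G ρ σ' ts
  evalTms-cong h []       = refl
  evalTms-cong h (t ∷ ts) = cong₂ _∷_ (evalTm-cong h t) (evalTms-cong h ts)

  eval-cong : ∀ {n Γ Δ} {G : Graph n} {ρ} {σ σ' : REnv n Δ} → σ ≗ʳ σ' →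
              (φ : Fm Γ Δ) → eval G ρ σ φ ≡ eval G ρ σ' φ
  eval-cong {G = G} h (edge t u) = cong₂ (E G) (evalTm-cong h t) (evalTm-cong h u)
  eval-cong h (eq {s} t u) = cong₂ (eqDom s) (evalTm-cong h t) (evalTm-cong h u)
  eval-cong h (leq t u) =
    cong₂ (λ x y → toℕ x ≤ᵇ toℕ y) (evalTm-cong h t) (evalTm-cong h u)
  eval-cong {σ = σ} h (rel r ts) = trans (cong (lookup σ r) (evalTms-cong h ts)) (h r _)
  eval-cong h (neg φ)   = cong not (eval-cong h φ)
  eval-cong h (and φ ψ) = cong₂ _∧_ (eval-cong h φ) (eval-cong h ψ)
  eval-cong h (or φ ψ)  = cong₂ _∨_ (eval-cong h φ) (eval-cong h ψ)
  eval-cong {n} h (ex s φ)  = anyFin-cong (size n s) λ x → eval-cong h φ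
  eval-cong {n} h (all s φ) = allFin-cong (size n s) λ x → eval-cong h φ
  eval-cong {n} {G = G} {ρ} {σ} {σ'} h (ifp a φ ts) =
    trans (cong (iterate (numTuples n a) _ _) (evalTms-cong h ts))
          (iterate-cong (numTuples n a)
            (λ k x̄ → cong₂ _∨_ (k x̄) (eval-cong (∷-cong k h) φ)) (evalTms G ρ σ' ts))

-- The pullback along a relation renaming: a relation variable denotes the section of its image at
-- the current values of the fixed leading arguments.
interp : ∀ {n Γ' Δ Δ'} → Env n Γ' → REnv n Δ' → RMap Γ' Δ Δ' → REnv n Δ
interp ρ' σ' g =
  All.map (λ { (pre , vs , r) x̄ → lookup σ' r (append (pick ρ' vs) x̄) }) g

lookup-map : ∀ {A : Set} {P Q : A → Set} {xs : List A} (h : ∀ {x} → P x → Q x)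
             (ps : All P xs) {x} (r : x ∈ xs) → lookup (All.map h ps) r ≡ h (lookup ps r)
lookup-map h (p ∷ ps) (here refl) = refl
lookup-map h (p ∷ ps) (there r)   = lookup-map h ps r

lookup-wk : ∀ {n a Γ s} (x̄ : Tuple n a) {ρ : Env n Γ} (v : s ∈ Γ) →
            lookup (append x̄ ρ) (wk a v) ≡ lookup ρ v
lookup-wk []      v = refl
lookup-wk (x ∷ x̄) v = lookup-wk x̄ v

pick-wk : ∀ {n a Γ b} (x̄ : Tuple n a) {ρ : Env n Γ} (vs : b ⊑ Γ) →
          pick (append x̄ ρ) (All.map (wk a) vs) ≡ pick ρ vs
pick-wk x̄ []       = refl
pick-wk x̄ (v ∷ vs) = cong₂ _∷_ (lookup-wk x̄ v) (pick-wk x̄ vs)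

pick-there : ∀ {n s Γ b} {x : Dom n s} {ρ : Env n Γ} (vs : b ⊑ Γ) →
             pick (x ∷ ρ) (All.map there vs) ≡ pick ρ vs
pick-there {x = x} = pick-wk (x ∷ [])

pick-lifts : ∀ {n a Γ Γ'} (x̄ : Tuple n a) {ρ : Env n Γ'} (f : Γ ⊑ Γ') →
             pick (append x̄ ρ) (lifts a f) ≡ append x̄ (pick ρ f)
pick-lifts []      f = refl
pick-lifts (x ∷ x̄) f = cong (x ∷_) (trans (pick-there (lifts _ f)) (pick-lifts x̄ f))

interp-wkR : ∀ {n a Γ' Δ Δ'} (x̄ : Tuple n a) {ρ : Env n Γ'} {σ : REnv n Δ'}
             (g : RMap Γ' Δ Δ') → interp (append x̄ ρ) σ (wkR a g) ≗ʳ interp ρ σ g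
interp-wkR x̄ {σ = σ} ((pre , vs , r') ∷ g) (here refl) ȳ =
  cong (λ z̄ → lookup σ r' (append z̄ ȳ)) (pick-wk x̄ vs)
interp-wkR x̄ {ρ} {σ} (_ ∷ g) (there r) ȳ = interp-wkR x̄ {ρ} {σ} g r ȳ

interp-bindR : ∀ {n a Γ' Δ Δ'} (x̄ : Tuple n a) {ρ : Env n Γ'} {σ : REnv n Δ'}
               {R R' : RelVal n a} (g : RMap Γ' Δ Δ') → (∀ ȳ → R ȳ ≡ R' ȳ) →
               interp (append x̄ ρ) (R ∷ σ) (bindR a g) ≗ʳ (R' ∷ interp ρ σ g)
interp-bindR x̄ g h (here refl) ȳ = h ȳ
interp-bindR {n} {a} {Γ'} x̄ {ρ} {σ} {R} g h (there r) ȳ = old g r ȳ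
  where
  old : ∀ {Δ b} (g : RMap Γ' Δ _) (r : b ∈ Δ) ȳ →
        lookup (interp (append x̄ ρ) (R ∷ σ)
                 (All.map (λ { (pre , vs , r) → pre , All.map (wk a) vs , there r }) g)) r ȳ
        ≡ lookup (interp ρ σ g) r ȳ
  old ((pre , vs , r') ∷ g) (here refl) ȳ =
    cong (λ z̄ → lookup σ r' (append z̄ ȳ)) (pick-wk x̄ vs)
  old (_ ∷ g) (there r) ȳ = old g r ȳ

evalTms-++ᵗ : ∀ {n Γ Δ a b} {G : Graph n} {ρ : Env n Γ} {σ : REnv n Δ} (vs : a ⊑ Γ)
              (ts : Tms Γ Δ b) →
              evalTms G ρ σ (vs ++ᵗ ts) ≡ append (pick ρ vs) (evalTms G ρ σ ts)
evalTms-++ᵗ []       ts = refl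
evalTms-++ᵗ (v ∷ vs) ts = cong (_ ∷_) (evalTms-++ᵗ vs ts)

lookup-interp : ∀ {n Γ' Δ Δ'} (ρ : Env n Γ') (σ : REnv n Δ') (g : RMap Γ' Δ Δ') {b}
                (r : b ∈ Δ) x̄ →
                lookup σ (proj₂ (proj₂ (lookup g r)))
                         (append (pick ρ (proj₁ (proj₂ (lookup g r)))) x̄)
                ≡ lookup (interp ρ σ g) r x̄
lookup-interp ρ σ (_ ∷ g) (here refl) x̄ = refl
lookup-interp ρ σ (_ ∷ g) (there r)   x̄ = lookup-interp ρ σ g r x̄

mutual
  evalTm-ren : ∀ {n Γ Γ' Δ Δ' s} (G : Graph n) {ρ : Env n Γ'} {σ : REnv n Δ'}
               (f : Γ ⊑ Γ') (g : RMap Γ' Δ Δ') (t : Tm Γ Δ s) →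
               evalTm G ρ σ (renTm f g t) ≡ evalTm G (pick ρ f) (interp ρ σ g) t
  evalTm-ren G {ρ} f g (var x) = ≡.sym (lookup-map (lookup ρ) f x)
  evalTm-ren {n} G f g (count φ) =
    countFin-cong n λ i → eval-ren₁ G (i ∷ []) f g φ

  evalTms-ren : ∀ {n Γ Γ' Δ Δ' a} (G : Graph n) {ρ : Env n Γ'} {σ : REnv n Δ'}
                (f : Γ ⊑ Γ') (g : RMap Γ' Δ Δ') (ts : Tms Γ Δ a) →
                evalTms G ρ σ (renTms f g ts) ≡ evalTms G (pick ρ f) (interp ρ σ g) ts
  evalTms-ren G f g []       = refl
  evalTms-ren G f g (t ∷ ts) = cong₂ _∷_ (evalTm-ren G f g t) (evalTms-ren G f g ts)

  eval-ren₁ : ∀ {n s Γ Γ' Δ Δ'} (G : Graph n) (x̄ : Tuple n (s ∷ [])) {ρ : Env n Γ'}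
              {σ : REnv n Δ'} (f : Γ ⊑ Γ') (g : RMap Γ' Δ Δ') (φ : Fm (s ∷ Γ) Δ) →
              eval G (append x̄ ρ) σ (ren (lifts (s ∷ []) f) (wkR (s ∷ []) g) φ)
              ≡ eval G (append x̄ (pick ρ f)) (interp ρ σ g) φ
  eval-ren₁ G x̄ {ρ} {σ} f g φ =
    trans (eval-ren G (lifts _ f) (wkR _ g) φ)
    (trans (cong (λ ρ' → eval G ρ' (interp (append x̄ ρ) σ (wkR _ g)) φ) (pick-lifts x̄ f))
           (eval-cong (interp-wkR x̄ {ρ} {σ} g) φ))

  -- The substitution lemma. In the fixed-point case the bound relation variable is renamed without
  -- extra arguments, so its arity and the number of rounds stay the same and the two iterations can
  -- be compared round by round.
  eval-ren : ∀ {n Γ Γ' Δ Δ'} (G : Graph n) {ρ : Env n Γ'} {σ : REnv n Δ'}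
             (f : Γ ⊑ Γ') (g : RMap Γ' Δ Δ') (φ : Fm Γ Δ) →
             eval G ρ σ (ren f g φ) ≡ eval G (pick ρ f) (interp ρ σ g) φ
  eval-ren G f g (edge t u) = cong₂ (E G) (evalTm-ren G f g t) (evalTm-ren G f g u)
  eval-ren G f g (eq {s} t u) = cong₂ (eqDom s) (evalTm-ren G f g t) (evalTm-ren G f g u)
  eval-ren G f g (leq t u) =
    cong₂ (λ x y → toℕ x ≤ᵇ toℕ y) (evalTm-ren G f g t) (evalTm-ren G f g u)
  eval-ren G {ρ} {σ} f g (rel r ts) =
    trans (cong (lookup σ (proj₂ (proj₂ (lookup g r))))
                (trans (evalTms-++ᵗ (proj₁ (proj₂ (lookup g r))) (renTms f g ts))
                       (cong (append _) (evalTms-ren G f g ts))))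
          (lookup-interp ρ σ g r _)
  eval-ren G f g (neg φ)   = cong not (eval-ren G f g φ)
  eval-ren G f g (and φ ψ) = cong₂ _∧_ (eval-ren G f g φ) (eval-ren G f g ψ)
  eval-ren G f g (or φ ψ)  = cong₂ _∨_ (eval-ren G f g φ) (eval-ren G f g ψ)
  eval-ren {n} G f g (ex s φ)  = anyFin-cong (size n s) λ x → eval-ren₁ G (x ∷ []) f g φ
  eval-ren {n} G f g (all s φ) = allFin-cong (size n s) λ x → eval-ren₁ G (x ∷ []) f g φ
  eval-ren {n} G {ρ} {σ} f g (ifp a φ ts) =
    trans (cong (iterate (numTuples n a) _ _) (evalTms-ren G f g ts))
          (iterate-cong (numTuples n a)
            (λ {R} {R'} h x̄ → cong₂ _∨_ (h x̄)
              (trans (eval-ren G (lifts a f) (bindR a g) φ)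
              (trans (cong (λ ρ' → eval G ρ' (interp (append x̄ ρ) (R ∷ σ) (bindR a g)) φ)
                           (pick-lifts x̄ f))
                     (eval-cong (interp-bindR x̄ {ρ} {σ} g h) φ))))
            (evalTms G (pick ρ f) (interp ρ σ g) ts))

-- Counting and inflationary fixed points

bit : Bool → ℕ
bit true  = 1
bit false = 0

weight : ∀ {A : Set} → List A → (A → Bool) → ℕ
weight []       f = 0
weight (x ∷ xs) f = bit (f x) + weight xs f

weight-mono : ∀ {A : Set} (xs : List A) {f g : A → Bool} →
              (∀ x → bit (f x) ≤ bit (g x)) → weight xs f ≤ weight xs g
weight-mono []       h = z≤n
weight-mono (x ∷ xs) h = ℕ.+-mono-≤ (h x) (weight-mono xs h)

weight-strict : ∀ {A : Set} {xs : List A} {f g : A → Bool} {x} →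
                (∀ x → bit (f x) ≤ bit (g x)) → x ∈ xs → bit (f x) < bit (g x) →
                weight xs f < weight xs g
weight-strict {xs = _ ∷ xs} h (here refl) lt = ℕ.+-mono-<-≤ lt (weight-mono xs h)
weight-strict {xs = y ∷ xs} h (there x∈xs) lt = ℕ.+-mono-≤-< (h y) (weight-strict h x∈xs lt)

weight-+ : ∀ {A : Set} (xs : List A) {f g h : A → Bool} →
           (∀ x → bit (f x) ≡ bit (g x) + bit (h x)) →
           weight xs f ≡ weight xs g + weight xs h
weight-+ []       e = refl
weight-+ (x ∷ xs) {f} {g} {h} e =
  trans (cong₂ _+_ (e x) (weight-+ xs e))
        (+-exchange (bit (g x)) (bit (h x)) (weight xs g) (weight xs h))
  where
  open import Algebra.Properties.CommutativeSemigroup ℕ.+-commutativeSemigroup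
    using () renaming (interchange to +-exchange)

bit≤1 : ∀ b → bit b ≤ 1
bit≤1 true  = s≤s z≤n
bit≤1 false = z≤n

weight≤length : ∀ {A : Set} (xs : List A) (f : A → Bool) → weight xs f ≤ length xs
weight≤length []       f = z≤n
weight≤length (x ∷ xs) f = ℕ.+-mono-≤ (bit≤1 (f x)) (weight≤length xs f)

bit-⇒ : ∀ {b c} → (b ≡ true → c ≡ true) → bit b ≤ bit c
bit-⇒ {false}         h = z≤n
bit-⇒ {true}  {true}  h = s≤s z≤n
bit-⇒ {true}  {false} h with h refl
... | ()

weight-full : ∀ {A : Set} {xs : List A} {f : A → Bool} {x} → length xs ≤ weight xs f →
              x ∈ xs → f x ≡ true
weight-full {xs = xs} {f} {x} le x∈xs with f x in eq
... | true  = refl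
... | false = ⊥-elim (ℕ.<-irrefl refl (ℕ.<-≤-trans
                (weight-strict {g = const true} (λ y → bit≤1 (f y)) x∈xs
                  (subst (λ b → bit b < 1) (≡.sym eq) (s≤s z≤n)))
                (ℕ.≤-trans (weight≤length xs (const true)) le)))

eval-cong₁ : ∀ {n Γ Δ a} (G : Graph n) ρ (σ : REnv n Δ) {R R' : RelVal n a} →
             (∀ x̄ → R x̄ ≡ R' x̄) → (φ : Fm Γ (a ∷ Δ)) →
             eval G ρ (R ∷ σ) φ ≡ eval G ρ (R' ∷ σ) φ
eval-cong₁ G ρ σ h φ = eval-cong (∷-cong h (λ _ _ → refl)) φ

tuples : ∀ n a → List (Tuple n a)
tuples n []      = [] ∷ []
tuples n (s ∷ a) = List.cartesianProductWith _∷_ (List.allFin (size n s)) (tuples n a)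

∈-tuples : ∀ {n a} (x̄ : Tuple n a) → x̄ ∈ tuples n a
∈-tuples []      = here refl
∈-tuples (x ∷ x̄) = ∈.∈-cartesianProductWith⁺ _∷_ (∈.∈-allFin x) (∈-tuples x̄)

length-tuples : ∀ n a → length (tuples n a) ≡ numTuples n a
length-tuples n []      = refl
length-tuples n (s ∷ a) =
  trans (go (List.allFin (size n s)))
        (cong₂ _*_ (List.length-tabulate {n = size n s} id) (length-tuples n a))
  where
  cons : Dom n s → Tuple n a → Tuple n (s ∷ a)
  cons = _∷_
  go : ∀ xs → length (List.cartesianProductWith cons xs (tuples n a))
              ≡ length xs * length (tuples n a)
  go []       = refl
  go (x ∷ xs) = trans (List.length-++ (map (cons x) (tuples n a)))
                      (cong₂ _+_ (List.length-map (cons x) (tuples n a)) (go xs))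

numTuples>0 : ∀ {n a} → Tuple n a → 0 < numTuples n a
numTuples>0 {n} {a} x̄ = subst (0 <_) (length-tuples n a) (nonEmpty (∈-tuples x̄))
  where
  nonEmpty : ∀ {xs : List (Tuple n a)} {x} → x ∈ xs → 0 < length xs
  nonEmpty {_ ∷ _} _ = s≤s z≤n

∨-true⁻ : ∀ {b c} → b ∨ c ≡ true → b ≡ true ⊎ c ≡ true
∨-true⁻ {true}  _ = inj₁ refl
∨-true⁻ {false} e = inj₂ e

∨-true⁺ : ∀ {b c} → b ≡ true ⊎ c ≡ true → b ∨ c ≡ true
∨-true⁺ {true}          _           = refl
∨-true⁺ {false} {true}  _           = refl
∨-true⁺ {false} {false} (inj₁ ())
∨-true⁺ {false} {false} (inj₂ ())

module Inflationary {n : ℕ} {a : Arity} (B : RelVal n a → RelVal n a)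
  (B-cong : ∀ {R R'} → (∀ x̄ → R x̄ ≡ R' x̄) → ∀ x̄ → B R x̄ ≡ B R' x̄) where

  step : RelVal n a → RelVal n a
  step R x̄ = R x̄ ∨ B R x̄

  iter : ℕ → RelVal n a
  iter k = iterate k step (λ _ → false)

  Closed : RelVal n a → Set
  Closed R = ∀ x̄ → B R x̄ ≡ true → R x̄ ≡ true

  -- A round that adds no tuple shows that the stage is closed, and closedness persists; any other
  -- round raises the weight. This works for monotone and non-monotone `B` alike.
  growth : ∀ k → Closed (iter k) ⊎ k ≤ weight (tuples n a) (iter k)
  growth zero = inj₂ z≤n
  growth (suc k) with growth k
  ... | inj₁ c = inj₁ λ x̄ e → ∨-true⁺ (inj₁ (c x̄ (trans (B-cong same x̄) e)))
    where
    same : ∀ x̄ → iter k x̄ ≡ iter (suc k) x̄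
    same x̄ with iter k x̄ in p | B (iter k) x̄ in q
    ... | true  | _     = refl
    ... | false | false = refl
    ... | false | true  = trans (≡.sym p) (c x̄ q)
  ... | inj₂ le with any? (λ x̄ → (iter k x̄ Bool.≟ false) ×-dec (B (iter k) x̄ Bool.≟ true))
      (tuples n a)
  ... | yes new = inj₂ (ℕ.≤-<-trans le (strict (find new)))
    where
    strict : (∃ λ x̄ → x̄ ∈ tuples n a × iter k x̄ ≡ false × B (iter k) x̄ ≡ true) →
             weight (tuples n a) (iter k) < weight (tuples n a) (iter (suc k))
    strict (x̄ , x̄∈ , p , q) =
      weight-strict (λ ȳ → bit-⇒ (λ e → ∨-true⁺ (inj₁ e))) x̄∈
        (ℕ.≤-reflexive (≡.sym (≡.trans (cong bit (∨-true⁺ (inj₂ q)))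
                                    (cong (suc ∘ bit) (≡.sym p)))))
  ... | no ¬new = inj₁ λ x̄ e → ∨-true⁺ (inj₁ (old x̄ (trans (B-cong same x̄) e)))
    where
    old : Closed (iter k)
    old x̄ e with iter k x̄ in p
    ... | true  = refl
    ... | false = ⊥-elim (¬new (lose (∈-tuples x̄) (p , e)))
    same : ∀ x̄ → iter k x̄ ≡ iter (suc k) x̄
    same x̄ with iter k x̄ in p | B (iter k) x̄ in q
    ... | true  | _     = refl
    ... | false | false = refl
    ... | false | true  = trans (≡.sym p) (old x̄ q)

  -- If the iteration grew in every round, its weight has reached the number of tuples, and the full
  -- relation is closed for trivial reasons.
  closed : Closed (iter (numTuples n a))
  closed with growth (numTuples n a)
  ... | inj₁ c  = c
  ... | inj₂ le = λ x̄ _ → weight-full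
      (subst (_≤ weight (tuples n a) (iter (numTuples n a))) (≡.sym (length-tuples n a)) le)
          (∈-tuples x̄)

-- Formulas bundled with a propositional semantics

record D (Γ : Ctx) (Δ : RCtx) : Set₁ where
  constructor mkD
  field
    fm  : Fm Γ Δ
    sem : ∀ {n} → Graph n → Env n Γ → REnv n Δ → Set
    ok  : ∀ {n} (G : Graph n) ρ σ → (eval G ρ σ fm ≡ true) ⇔ sem G ρ σ

open D public

-- The source of decidability for connectivity, least modules and forcing: the evaluator computes
-- their truth values, so no graph search has to be verified.
sem? : ∀ {Γ Δ n} (d : D Γ Δ) (G : Graph n) ρ σ → Dec (sem d G ρ σ)
sem? d G ρ σ = Dec.map (ok d G ρ σ) (Bool._≟_ (eval G ρ σ (fm d)) true)

≡-⇔ : ∀ {b c : Bool} {P : Set} → b ≡ c → (c ≡ true) ⇔ P → (b ≡ true) ⇔ P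
≡-⇔ refl h = h

-- Keeps the type checker from unfolding large formulas.
opaque
  hide : ∀ {Γ Δ} → Fm Γ Δ → Fm Γ Δ
  hide φ = φ

  hide-≡ : ∀ {Γ Δ} {φ : Fm Γ Δ} → hide φ ≡ φ
  hide-≡ = refl

-- Replaces the semantics accumulated by the connectives with a stated one, so that later proofs
-- mention only the mathematical meaning of a formula.
_as_by_ : ∀ {Γ Δ} (d : D Γ Δ) (Q : ∀ {n} → Graph n → Env n Γ → REnv n Δ → Set) →
          (∀ {n} (G : Graph n) ρ σ → sem d G ρ σ ⇔ Q G ρ σ) → D Γ Δ
d as Q by h = mkD (hide (fm d)) Q λ G ρ σ → ≡-⇔ (cong (eval G ρ σ) hide-≡)
  (mk⇔ (λ e → to (h G ρ σ) (to (ok d G ρ σ) e)) (λ q → from (ok d G ρ σ) (from (h G ρ σ) q)))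

seal : ∀ {Γ Δ} → D Γ Δ → D Γ Δ
seal d = d as sem d by λ G ρ σ → mk⇔ id id

raw : ∀ {Γ Δ} → Fm Γ Δ → D Γ Δ
raw φ = mkD φ (λ G ρ σ → eval G ρ σ φ ≡ true) λ G ρ σ → mk⇔ id id

edgeᴰ : ∀ {Γ Δ} → el ∈ Γ → el ∈ Γ → D Γ Δ
edgeᴰ x y = mkD (edge (var x) (var y)) (λ G ρ σ → E G (lookup ρ x) (lookup ρ y) ≡ true)
                λ G ρ σ → mk⇔ id id

⌊⌋-true : ∀ {P : Set} (p : Dec P) → (⌊ p ⌋ ≡ true) ⇔ P
⌊⌋-true (yes p) = mk⇔ (λ _ → p) (λ _ → refl)
⌊⌋-true (no ¬p) = mk⇔ (λ ()) (λ p → ⊥-elim (¬p p))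

eqᴰ : ∀ {Γ Δ s} → s ∈ Γ → s ∈ Γ → D Γ Δ
eqᴰ x y = mkD (eq (var x) (var y)) (λ G ρ σ → lookup ρ x ≡ lookup ρ y)
              λ G ρ σ → ⌊⌋-true (lookup ρ x Fin.≟ lookup ρ y)

≤ᵇ-true : ∀ k l → (k ≤ᵇ l) ≡ true ⇔ k ≤ l
≤ᵇ-true k l = mk⇔ (λ e → ℕ.≤ᵇ⇒≤ k l (from Bool.T-≡ e)) (λ le → to Bool.T-≡ (ℕ.≤⇒≤ᵇ le))

leᴰ : ∀ {Γ Δ} → num ∈ Γ → num ∈ Γ → D Γ Δ
leᴰ x y = mkD (leq (var x) (var y)) (λ G ρ σ → toℕ (lookup ρ x) ≤ toℕ (lookup ρ y))
              λ G ρ σ → ≤ᵇ-true (toℕ (lookup ρ x)) (toℕ (lookup ρ y))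

varTms : ∀ {Γ Δ a} → a ⊑ Γ → Tms Γ Δ a
varTms []       = []
varTms (v ∷ vs) = var v ∷ varTms vs

evalTms-varTms : ∀ {n Γ Δ a} (G : Graph n) (ρ : Env n Γ) (σ : REnv n Δ) (vs : a ⊑ Γ) →
                 evalTms G ρ σ (varTms vs) ≡ pick ρ vs
evalTms-varTms G ρ σ []       = refl
evalTms-varTms G ρ σ (v ∷ vs) = cong (_ ∷_) (evalTms-varTms G ρ σ vs)

relᴰ : ∀ {Γ Δ a} → a ∈ Δ → a ⊑ Γ → D Γ Δ
relᴰ r vs = mkD (rel r (varTms vs)) (λ G ρ σ → lookup σ r (pick ρ vs) ≡ true)
                λ G ρ σ → ≡-⇔ (cong (lookup σ r) (evalTms-varTms G ρ σ vs)) (mk⇔ id id)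

infix  9 ¬ᴰ_
infixr 6 _∧ᴰ_
infixr 5 _∨ᴰ_
infixr 4 _⇒ᴰ_

¬ᴰ_ : ∀ {Γ Δ} → D Γ Δ → D Γ Δ
¬ᴰ d = mkD (neg (fm d)) (λ G ρ σ → ¬ sem d G ρ σ) λ G ρ σ → go (ok d G ρ σ)
  where
  go : ∀ {b} {P : Set} → (b ≡ true) ⇔ P → (not b ≡ true) ⇔ (¬ P)
  go {true}  h = mk⇔ (λ ()) (λ ¬p → ⊥-elim (¬p (to h refl)))
  go {false} h = mk⇔ (λ _ p → case-false (from h p)) (λ _ → refl)
    where case-false : false ≡ true → ⊥
          case-false ()

_∧ᴰ_ : ∀ {Γ Δ} → D Γ Δ → D Γ Δ → D Γ Δ
d ∧ᴰ e = mkD (and (fm d) (fm e)) (λ G ρ σ → sem d G ρ σ × sem e G ρ σ)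
             λ G ρ σ → go (ok d G ρ σ) (ok e G ρ σ)
  where
  go : ∀ {b c} {P Q : Set} → (b ≡ true) ⇔ P → (c ≡ true) ⇔ Q → (b ∧ c ≡ true) ⇔ (P × Q)
  go {true}  h k = mk⇔ (λ e → to h refl , to k e) (λ { (p , q) → from k q })
  go {false} h k = mk⇔ (λ ()) (λ { (p , q) → from h p })

_∨ᴰ_ : ∀ {Γ Δ} → D Γ Δ → D Γ Δ → D Γ Δ
d ∨ᴰ e = mkD (or (fm d) (fm e)) (λ G ρ σ → sem d G ρ σ ⊎ sem e G ρ σ)
             λ G ρ σ → go (ok d G ρ σ) (ok e G ρ σ)
  where
  go : ∀ {b c} {P Q : Set} → (b ≡ true) ⇔ P → (c ≡ true) ⇔ Q → (b ∨ c ≡ true) ⇔ (P ⊎ Q)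
  go {true}  h k = mk⇔ (λ _ → inj₁ (to h refl)) (λ _ → refl)
  go {false} h k = mk⇔ (λ e → inj₂ (to k e)) λ { (inj₁ p) → from-false (from h p) ; (inj₂ q) → from k q }
    where from-false : false ≡ true → ∀ {c} → c ≡ true
          from-false ()

_⇒ᴰ_ : ∀ {Γ Δ} → D Γ Δ → D Γ Δ → D Γ Δ
d ⇒ᴰ e = (¬ᴰ d ∨ᴰ e) as (λ G ρ σ → sem d G ρ σ → sem e G ρ σ) by λ G ρ σ →
  mk⇔ (λ { (inj₁ ¬p) p → ⊥-elim (¬p p) ; (inj₂ q) _ → q })
      (λ f → caseDec (sem? d G ρ σ) (λ p → inj₂ (f p)) inj₁)
  where
  caseDec : ∀ {P C : Set} → Dec P → (P → C) → (¬ P → C) → C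
  caseDec (yes p) f g = f p
  caseDec (no ¬p) f g = g ¬p

anyFin-true : ∀ m {f : Fin m → Bool} {P : Fin m → Set} → (∀ i → (f i ≡ true) ⇔ P i) →
              (anyFin m f ≡ true) ⇔ ∃ P
anyFin-true zero    h = mk⇔ (λ ()) (λ { (() , _) })
anyFin-true (suc m) {f} {P} h = mk⇔ ⇒ ⇐
  where
  ih = anyFin-true m (λ i → h (suc i))
  ⇒ : f zero ∨ anyFin m (λ i → f (suc i)) ≡ true → ∃ P
  ⇒ e with ∨-true⁻ e
  ... | inj₁ p = zero , to (h zero) p
  ... | inj₂ q = let (i , p) = to ih q in suc i , p
  ⇐ : ∃ P → f zero ∨ anyFin m (λ i → f (suc i)) ≡ true
  ⇐ (zero  , p) = ∨-true⁺ (inj₁ (from (h zero) p))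
  ⇐ (suc i , p) = ∨-true⁺ {f zero} (inj₂ (from ih (i , p)))

allFin-true : ∀ m {f : Fin m → Bool} {P : Fin m → Set} → (∀ i → (f i ≡ true) ⇔ P i) →
              (allFin m f ≡ true) ⇔ (∀ i → P i)
allFin-true zero    h = mk⇔ (λ _ ()) (λ _ → refl)
allFin-true (suc m) {f} {P} h = mk⇔ ⇒ ⇐
  where
  ih = allFin-true m (λ i → h (suc i))
  ⇒ : f zero ∧ allFin m (λ i → f (suc i)) ≡ true → ∀ i → P i
  ⇒ e i with f zero in p
  ⇒ e zero    | true = to (h zero) p
  ⇒ e (suc i) | true = to ih e i
  ⇒ () _      | false
  ⇐ : (∀ i → P i) → f zero ∧ allFin m (λ i → f (suc i)) ≡ true
  ⇐ p with f zero in q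
  ... | true  = from ih (λ i → p (suc i))
  ... | false = trans (≡.sym q) (from (h zero) (p zero))

∃ᴰ : ∀ {Γ Δ} s → D (s ∷ Γ) Δ → D Γ Δ
∃ᴰ s d = mkD (ex s (fm d)) (λ {n} G ρ σ → Σ (Dom n s) λ x → sem d G (x ∷ ρ) σ)
             λ {n} G ρ σ → anyFin-true (size n s) λ x → ok d G (x ∷ ρ) σ

∀ᴰ : ∀ {Γ Δ} s → D (s ∷ Γ) Δ → D Γ Δ
∀ᴰ s d = mkD (all s (fm d)) (λ {n} G ρ σ → (x : Dom n s) → sem d G (x ∷ ρ) σ)
             λ {n} G ρ σ → allFin-true (size n s) λ x → ok d G (x ∷ ρ) σ

-- The predicate comes without a decision procedure, so a Boolean characteristic function is part of
-- the data; any two such functions have the same weight.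
Counts : ∀ {n} → (Fin n → Set) → ℕ → Set
Counts {n} P k = Σ (Fin n → Bool) λ f → (∀ x → (f x ≡ true) ⇔ P x) × k ≡ weight (List.allFin n) f

weight-tabulate : ∀ n {A : Set} (g : Fin n → A) (f : A → Bool) →
                  weight (List.tabulate g) f ≡ toℕ (countFin n (λ i → f (g i)))
weight-tabulate zero    g f = refl
weight-tabulate (suc n) g f with f (g zero)
... | true  = cong suc (weight-tabulate n (λ i → g (suc i)) f)
... | false = trans (weight-tabulate n (λ i → g (suc i)) f) (≡.sym (Fin.toℕ-inject₁ _))

weight-cong : ∀ {A : Set} (xs : List A) {f g : A → Bool} → (∀ x → f x ≡ g x) →
              weight xs f ≡ weight xs g
weight-cong []       h = refl
weight-cong (x ∷ xs) h = cong₂ _+_ (cong bit (h x)) (weight-cong xs h)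

true⇔-≡ : ∀ {b c : Bool} {P : Set} → (b ≡ true) ⇔ P → (c ≡ true) ⇔ P → b ≡ c
true⇔-≡ {true}  {c}     h k = ≡.sym (from k (to h refl))
true⇔-≡ {false} {false} h k = refl
true⇔-≡ {false} {true}  h k = from h (to k refl)

countᴰ : ∀ {Γ Δ} → D (el ∷ Γ) Δ → num ∈ Γ → D Γ Δ
countᴰ d k = mkD (eq (count (fm d)) (var k))
  (λ G ρ σ → Counts (λ x → sem d G (x ∷ ρ) σ) (toℕ (lookup ρ k)))
  λ {n} G ρ σ → mk⇔
    (λ e → (λ x → eval G (x ∷ ρ) σ (fm d)) , (λ x → ok d G (x ∷ ρ) σ) ,
       trans (cong toℕ (≡.sym (to (⌊⌋-true (_ Fin.≟ _)) e))) (≡.sym (weight-tabulate n id _)))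
    (λ { (f , h , e) → from (⌊⌋-true (_ Fin.≟ _)) (Fin.toℕ-injective
       (trans (≡.sym (weight-tabulate n id _))
       (trans (weight-cong (List.allFin n) (λ x → true⇔-≡ (ok d G (x ∷ ρ) σ) (h x)))
              (≡.sym e)))) })

dropE : ∀ {n Γ} k → Env n Γ → Env n (drop k Γ)
dropE zero    ρ       = ρ
dropE (suc k) []      = []
dropE (suc k) (x ∷ ρ) = dropE k ρ

idV : ∀ Γ → Γ ⊑ Γ
idV []      = []
idV (s ∷ Γ) = here refl ∷ All.map there (idV Γ)

pick-id : ∀ {n Γ} (ρ : Env n Γ) → pick ρ (idV Γ) ≡ ρ
pick-id []      = refl
pick-id (x ∷ ρ) = cong (x ∷_) (trans (pick-there {x = x} {ρ} (idV _)) (pick-id ρ))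

dropV : ∀ k Γ → drop k Γ ⊑ Γ
dropV zero    Γ       = idV Γ
dropV (suc k) []      = []
dropV (suc k) (s ∷ Γ) = All.map there (dropV k Γ)

pick-drop : ∀ {n Γ} k (ρ : Env n Γ) → pick ρ (dropV k Γ) ≡ dropE k ρ
pick-drop zero    ρ       = pick-id ρ
pick-drop (suc k) []      = refl
pick-drop (suc k) (x ∷ ρ) = trans (pick-there {x = x} {ρ} (dropV k _)) (pick-drop k ρ)

_++ⱽ_ : ∀ {a b Γ} → a ⊑ Γ → b ⊑ Γ → (a ++ b) ⊑ Γ
[]       ++ⱽ ws = ws
(v ∷ vs) ++ⱽ ws = v ∷ (vs ++ⱽ ws)

pick-++ : ∀ {n a b Γ} {ρ : Env n Γ} (vs : a ⊑ Γ) (ws : b ⊑ Γ) →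
          pick ρ (vs ++ⱽ ws) ≡ append (pick ρ vs) (pick ρ ws)
pick-++ []       ws = refl
pick-++ {ρ = ρ} (v ∷ vs) ws = cong (_ ∷_) (pick-++ {ρ = ρ} vs ws)

plain : ∀ {Γ Δ Δ'} → All (_∈ Δ') Δ → RMap Γ Δ Δ'
plain = All.map λ r → [] , [] , r

interp-plain : ∀ {n Γ Δ Δ'} (ρ : Env n Γ) (σ : REnv n Δ') (rs : All (_∈ Δ') Δ) →
               interp ρ σ (plain rs) ≡ All.map (lookup σ) rs
interp-plain ρ σ []       = refl
interp-plain ρ σ (r ∷ rs) = cong (_ ∷_) (interp-plain ρ σ rs)

-- The first k variables of the context are discarded; d sees the variables vs
-- followed by the remaining ones.
call : ∀ {Γ Δ a Δ'} k → a ⊑ Γ → All (_∈ Δ) Δ' → D (a ++ drop k Γ) Δ' → D Γ Δ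
call {Γ} k vs rs d = mkD (ren (vs ++ⱽ dropV k Γ) (plain rs) (fm d))
  (λ G ρ σ → sem d G (append (pick ρ vs) (dropE k ρ)) (All.map (lookup σ) rs))
  λ G ρ σ → ≡-⇔
    (trans (eval-ren G (vs ++ⱽ dropV k Γ) (plain rs) (fm d))
      (cong₂ (λ ρ' σ' → eval G ρ' σ' (fm d))
        (trans (pick-++ {ρ = ρ} vs (dropV k Γ)) (cong (append _) (pick-drop k ρ)))
        (interp-plain ρ σ rs)))
    (ok d G _ _)

-- Lets a formula written for a single stage be evaluated inside a fixed point whose relation
-- carries a stage index and a flag as additional leading arguments.
prefixed : ∀ {Γ Δ a b pre} → b ⊑ Γ → pre ⊑ Γ → (pre ++ a) ∈ Δ → D b (a ∷ []) → D Γ Δ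
prefixed {pre = pre} vs ps r d = mkD (ren vs ((pre , ps , r) ∷ []) (fm d))
  (λ G ρ σ → sem d G (pick ρ vs) ((λ x̄ → lookup σ r (append (pick ρ ps) x̄)) ∷ []))
  λ G ρ σ → ≡-⇔ (eval-ren G vs ((pre , ps , r) ∷ []) (fm d))
    (ok d G _ _)

∃*ᴰ : ∀ {Γ Δ} a → D (a ++ Γ) Δ → D Γ Δ
∃*ᴰ {Γ} {Δ} a d = mkD (proj₁ (go a d))
  (λ {n} G ρ σ → Σ (Tuple n a) λ x̄ → sem d G (append x̄ ρ) σ) (proj₂ (go a d))
  where
  go : ∀ a (d : D (a ++ Γ) Δ) → Σ (Fm Γ Δ) λ φ → ∀ {n} (G : Graph n) ρ σ →
       (eval G ρ σ φ ≡ true) ⇔ (Σ (Tuple n a) λ x̄ → sem d G (append x̄ ρ) σ)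
  go [] d = fm d , λ G ρ σ → mk⇔ (λ e → [] , to (ok d G ρ σ) e)
                                 (λ { ([] , p) → from (ok d G ρ σ) p })
  go (s ∷ a) d with go a (∃ᴰ s d)
  ... | φ , h = φ , λ G ρ σ → mk⇔
    (λ e → let (x̄ , x , p) = to (h G ρ σ) e in x ∷ x̄ , p)
    (λ { (x ∷ x̄ , p) → from (h G ρ σ) (x̄ , x , p) })

eqsᴰ : ∀ {Γ Δ s a} → (s ∷ a) ⊑ Γ → (s ∷ a) ⊑ Γ → D Γ Δ
eqsᴰ {Γ} {Δ} vs ws = mkD (proj₁ (go vs ws)) (λ G ρ σ → pick ρ vs ≡ pick ρ ws) (proj₂ (go vs ws))
  where
  go : ∀ {s a} (vs ws : (s ∷ a) ⊑ Γ) → Σ (Fm Γ Δ) λ φ → ∀ {n} (G : Graph n) ρ σ →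
       (eval G ρ σ φ ≡ true) ⇔ (pick {n} ρ vs ≡ pick ρ ws)
  go (v ∷ []) (w ∷ []) = fm d , λ G ρ σ → mk⇔
    (λ e → cong (_∷ []) (to (ok d G ρ σ) e)) (λ { e → from (ok d G ρ σ) (cong All.head e) })
    where d = eqᴰ {Γ} {Δ} v w
  go (v ∷ vs@(_ ∷ _)) (w ∷ ws) with go vs ws
  ... | φ , h = fm d , λ G ρ σ → mk⇔
    (λ e → let (p , q) = to (ok d G ρ σ) e in cong₂ _∷_ p (to (h G ρ σ) q))
    (λ e → from (ok d G ρ σ) (cong All.head e , from (h G ρ σ) (cong All.tail e)))
    where d = eqᴰ {Γ} {Δ} v w ∧ᴰ raw φ

firsts : ∀ {Γ} a → a ⊑ (a ++ Γ)
firsts []      = []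
firsts (s ∷ a) = here refl ∷ All.map there (firsts a)

pick-firsts : ∀ {n Γ a} (x̄ : Tuple n a) (ρ : Env n Γ) → pick (append x̄ ρ) (firsts a) ≡ x̄
pick-firsts []      ρ = refl
pick-firsts (x ∷ x̄) ρ = cong (x ∷_) (trans (pick-there {x = x} {append x̄ ρ} (firsts _))
    (pick-firsts x̄ ρ))

strengthen : ∀ {Γ Δ b} → D Γ Δ → D Γ (b ∷ Δ)
strengthen {Γ} {Δ} d = mkD (ren (idV Γ) (plain (All.tabulate there)) (fm d))
  (λ G ρ σ → sem d G ρ (All.tail σ))
  λ { G ρ (R ∷ σ) → ≡-⇔
    (trans (eval-ren G (idV Γ) (plain (All.tabulate there)) (fm d))
    (trans (cong₂ (λ ρ' σ' → eval G ρ' σ' (fm d)) (pick-id ρ)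
             (interp-plain ρ (R ∷ σ) (All.tabulate there)))
           (eval-cong (same R σ) (fm d))))
    (ok d G ρ σ) }
  where
  same : ∀ {n b Δ} (R : RelVal n b) (σ : REnv n Δ) →
         All.map (lookup (R ∷ σ)) (All.tabulate there) ≗ʳ σ
  same R σ r x̄ =
    trans (cong (λ f → f x̄) (lookup-map (lookup (R ∷ σ)) (All.tabulate there) r))
          (cong (λ r' → lookup (R ∷ σ) r' x̄) (lookup-tab there r))
    where
    lookup-tab : ∀ {Δ Δ' : RCtx} {c} (f : ∀ {c} → c ∈ Δ → c ∈ Δ') (r : c ∈ Δ) →
                 lookup (All.tabulate f) r ≡ f r
    lookup-tab f (here refl) = refl
    lookup-tab f (there r)   = lookup-tab (λ r → f (there r)) r

-- Reachability is the fixed point of a rule that also starts the search.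
module TC {Γ Δ s} (a : Arity) (step : D ((s ∷ a) ++ ((s ∷ a) ++ Γ)) Δ) (src tgt : (s ∷ a) ⊑ Γ) where

  body : D ((s ∷ a) ++ Γ) ((s ∷ a) ∷ Δ)
  body = eqsᴰ (firsts (s ∷ a)) (All.map (wk (s ∷ a)) src) ∨ᴰ
         ∃*ᴰ (s ∷ a) (relᴰ (here refl) (firsts (s ∷ a)) ∧ᴰ strengthen step)

  formula : Fm Γ Δ
  formula = ifp (s ∷ a) (fm body) (varTms tgt)

  module _ {n : ℕ} (G : Graph n) (ρ : Env n Γ) (σ : REnv n Δ) where

    Step : Tuple n (s ∷ a) → Tuple n (s ∷ a) → Set
    Step x̄ ȳ = sem step G (append x̄ (append ȳ ρ)) σ

    open Inflationary {n} {s ∷ a} (λ R x̄ → eval G (append x̄ ρ) (R ∷ σ) (fm body))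
      (λ h x̄ → eval-cong₁ G (append x̄ ρ) σ h (fm body))

    sound : ∀ k x̄ → iter k x̄ ≡ true → Star Step (pick ρ src) x̄
    sound (suc k) x̄ e with ∨-true⁻ e
    ... | inj₁ p = sound k x̄ p
    ... | inj₂ q with to (ok body G (append x̄ ρ) (iter k ∷ σ)) q
    ...   | inj₁ r = Star.reverse id
              (subst (λ z̄ → Star (λ x̄ ȳ → Step ȳ x̄) z̄ (pick ρ src))
                (≡.sym (trans (≡.sym (pick-firsts x̄ ρ)) (trans r (pick-wk x̄ src)))) ε)
    ...   | inj₂ (ȳ , r , t) =
              sound k ȳ (subst (λ z̄ → iter k z̄ ≡ true) (pick-firsts ȳ (append x̄ ρ)) r) ◅◅ (t ◅ ε)

    complete : ∀ {x̄ ȳ} → iter (numTuples n (s ∷ a)) x̄ ≡ true → Star Step x̄ ȳ →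
               iter (numTuples n (s ∷ a)) ȳ ≡ true
    complete e ε = e
    complete {x̄} e (_◅_ {j = z̄} t p) = complete
      (closed z̄ (from (ok body G (append z̄ ρ) (_ ∷ σ))
        (inj₂ (x̄ , subst (λ w̄ → iter (numTuples n (s ∷ a)) w̄ ≡ true)
                         (≡.sym (pick-firsts x̄ (append z̄ ρ))) e , t)))) p

    start : iter (numTuples n (s ∷ a)) (pick ρ src) ≡ true
    start = closed _ (from (ok body G (append (pick ρ src) ρ) (_ ∷ σ))
      (inj₁ (trans (pick-firsts (pick ρ src) ρ) (≡.sym (pick-wk (pick ρ src) src)))))

    formula-ok : (eval G ρ σ formula ≡ true) ⇔ Star Step (pick ρ src) (pick ρ tgt)
    formula-ok = ≡-⇔ (cong (iter (numTuples n (s ∷ a))) (evalTms-varTms G ρ σ tgt))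
      (mk⇔ (sound (numTuples n (s ∷ a)) _) (complete start))

tc₁ : ∀ {Γ Δ} s → D (s ∷ s ∷ Γ) Δ → s ∈ Γ → s ∈ Γ → D Γ Δ
tc₁ {Γ} {Δ} s step x y = mkD (TC.formula [] step (x ∷ []) (y ∷ []))
  (λ G ρ σ → Star (λ x y → sem step G (x ∷ y ∷ ρ) σ) (lookup ρ x) (lookup ρ y))
  λ G ρ σ → let h = TC.formula-ok [] step (x ∷ []) (y ∷ []) G ρ σ in
    mk⇔ (λ e → Star.gmap All.head (λ { {_ ∷ []} {_ ∷ []} t → t }) (to h e))
        (λ p → from h (Star.gmap (_∷ []) id p))

tc₂ : ∀ {Γ Δ} s s' → D (s ∷ s' ∷ s ∷ s' ∷ Γ) Δ → (x : s ∈ Γ) (x' : s' ∈ Γ) (y : s ∈ Γ) (y' : s' ∈ Γ) →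
    D Γ Δ
tc₂ {Γ} {Δ} s s' step x x' y y' =
  mkD (TC.formula (s' ∷ []) step (x ∷ x' ∷ []) (y ∷ y' ∷ []))
  (λ {n} G ρ σ → Star {I = Dom n s × Dom n s'}
     (λ p q → sem step G (proj₁ p ∷ proj₂ p ∷ proj₁ q ∷ proj₂ q ∷ ρ) σ)
     (lookup ρ x , lookup ρ x') (lookup ρ y , lookup ρ y'))
  λ G ρ σ → let h = TC.formula-ok (s' ∷ []) step (x ∷ x' ∷ []) (y ∷ y' ∷ []) G ρ σ in
    mk⇔ (λ e → Star.gmap (λ x̄ → All.head x̄ , All.head (All.tail x̄))
                 (λ { {_ ∷ _ ∷ []} {_ ∷ _ ∷ []} t → t }) (to h e))
        (λ p → from h (Star.gmap (λ p → proj₁ p ∷ proj₂ p ∷ []) id p))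

-- Zero and successor in the number sort, and staged iteration

v0 : ∀ {s : Sort} {Γ} → s ∈ s ∷ Γ
v0 = here refl
v1 : ∀ {s t : Sort} {Γ} → s ∈ t ∷ s ∷ Γ
v1 = there v0
v2 : ∀ {s t u : Sort} {Γ} → s ∈ t ∷ u ∷ s ∷ Γ
v2 = there v1
v3 : ∀ {s t u v : Sort} {Γ} → s ∈ t ∷ u ∷ v ∷ s ∷ Γ
v3 = there v2
v4 : ∀ {s t u v w : Sort} {Γ} → s ∈ t ∷ u ∷ v ∷ w ∷ s ∷ Γ
v4 = there v3
v5 : ∀ {s t u v w x : Sort} {Γ} → s ∈ t ∷ u ∷ v ∷ w ∷ x ∷ s ∷ Γ
v5 = there v4

zeroᴰ : ∀ {Γ Δ} → num ∈ Γ → D Γ Δ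
zeroᴰ x = ∀ᴰ num (leᴰ (there x) v0) as (λ G ρ σ → toℕ (lookup ρ x) ≡ 0) by λ G ρ σ →
  let k = toℕ (lookup ρ x) in
  mk⇔ (λ h → ℕ.n≤0⇒n≡0 {k} (h zero)) (λ e y → ℕ.≤-trans {k} (ℕ.≤-reflexive e) z≤n)

succᴰ : ∀ {Γ Δ} → num ∈ Γ → num ∈ Γ → D Γ Δ
succᴰ x y = (¬ᴰ leᴰ y x ∧ᴰ ∀ᴰ num (¬ᴰ leᴰ v0 (there x) ⇒ᴰ leᴰ (there y) v0))
  as (λ G ρ σ → toℕ (lookup ρ y) ≡ suc (toℕ (lookup ρ x))) by λ {n} G ρ σ → mk⇔
    (λ { (x<y , least) → ℕ.≤-antisym (below {n} (lookup ρ x) (lookup ρ y) (ℕ.≰⇒> x<y) least) (ℕ.≰⇒> x<y)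
        })
    (λ e → (λ y≤x → ℕ.<-irrefl {toℕ (lookup ρ x)} refl (ℕ.≤-trans (ℕ.≤-reflexive (≡.sym e)) y≤x)) ,
           (λ z z≰x → ℕ.≤-trans {toℕ (lookup ρ y)} (ℕ.≤-reflexive e)
               (ℕ.≰⇒> {toℕ z} {toℕ (lookup ρ x)} z≰x)))
  where
  below : ∀ {n} (x y : Fin (suc n)) → toℕ x < toℕ y →
          (∀ z → ¬ (toℕ z ≤ toℕ x) → toℕ y ≤ toℕ z) → toℕ y ≤ suc (toℕ x)
  below x y x<y least =
    subst (toℕ y ≤_) (Fin.toℕ-fromℕ< sx<) (least (fromℕ< sx<)
      (λ le → ℕ.<-irrefl refl (subst (_≤ toℕ x) (Fin.toℕ-fromℕ< sx<) le)))
    where sx< = ℕ.≤-<-trans x<y (Fin.toℕ<n y)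

-- Truncation at `n`. Being total, it turns a natural number into an element of the number sort
-- without a bound; the bound is asked for only where the value is read back.
clamp : ∀ n → ℕ → Fin (suc n)
clamp n       zero    = zero
clamp zero    (suc k) = zero
clamp (suc n) (suc k) = suc (clamp n k)

toℕ-clamp : ∀ {n k} → k ≤ n → toℕ (clamp n k) ≡ k
toℕ-clamp {k = zero}           z≤n     = refl
toℕ-clamp {suc n} {suc k} (s≤s le) = cong suc (toℕ-clamp le)

clamp-toℕ : ∀ {n} (i : Fin (suc n)) → clamp n (toℕ i) ≡ i
clamp-toℕ         zero    = refl
clamp-toℕ {suc n} (suc i) = cong suc (clamp-toℕ i)

-- Staged iteration: the fixed-point relation holds (τ, f, x̄) with f = 0 if x̄
-- belongs to stage τ, and the tuples with f ≠ 0 mark the completed stages.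
module Loop {a : Arity} (φ : D (num ∷ num ∷ a) (a ∷ [])) where

  -- Each stage is computed from its predecessor alone, which `φ` may use negatively, and need not
  -- contain it. The two numbers handed to `φ` are the indices of the stage read and of the stage
  -- built.
  stage : ∀ {n} → Graph n → ℕ → RelVal n a
  stage     G zero    x̄ = false
  stage {n} G (suc k) x̄ = eval G (clamp n k ∷ clamp n (suc k) ∷ x̄) (stage G k ∷ []) (fm φ)

  xs : ∀ b {Γ} → a ⊑ (b ++ (a ++ Γ))
  xs b = All.map (wk b) (firsts a)

  pick-xs : ∀ {n b Γ} (ȳ : Tuple n b) (x̄ : Tuple n a) (ρ : Env n Γ) →
            pick (append ȳ (append x̄ ρ)) (xs b) ≡ x̄
  pick-xs ȳ x̄ ρ = trans (pick-wk ȳ (firsts a)) (pick-firsts x̄ ρ)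

  -- The rule for nonzero flags advances the marks by one index per round; the rule for flag 0 waits
  -- for a mark on the predecessor. Otherwise `φ` could be evaluated on an unfinished stage, and a
  -- tuple derived there would stay for ever.
  body : ∀ {Γ} → D ((num ∷ num ∷ a) ++ Γ) ((num ∷ num ∷ a) ∷ [])
  body = seal ((¬ᴰ zeroᴰ v1 ∧ᴰ (zeroᴰ v0 ∨ᴰ
            ∃ᴰ num (succᴰ v0 v1 ∧ᴰ relᴰ (here refl) (v0 ∷ v2 ∷ xs (num ∷ num ∷ num ∷ [])))))
    ∨ᴰ (zeroᴰ v1 ∧ᴰ ∃ᴰ num (succᴰ v0 v1
         ∧ᴰ ∃ᴰ num (¬ᴰ zeroᴰ v0 ∧ᴰ relᴰ (here refl) (v1 ∷ v0 ∷ xs (num ∷ num ∷ num ∷ num ∷ [])))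
         ∧ᴰ prefixed {pre = num ∷ num ∷ []} (v0 ∷ v1 ∷ xs (num ∷ num ∷ num ∷ [])) (v0 ∷ v2 ∷ [])
             (here refl) φ)))

  module _ {n : ℕ} {Γ : Ctx} (G : Graph n) (ρ : Env n Γ) where

    open Inflationary {n} {num ∷ num ∷ a} (λ R x̄ → eval G (append x̄ ρ) (R ∷ []) (fm (body {Γ})))
      (λ h x̄ → eval-cong₁ G (append x̄ ρ) [] h (fm (body {Γ})))

    Staged : Fin (suc n) → Fin (suc n) → Tuple n a → Set
    Staged τ f x̄ = toℕ f ≢ 0 ⊎ (toℕ f ≡ 0 × stage G (toℕ τ) x̄ ≡ true)

    stage-suc : ∀ {t τ : Fin (suc n)} → toℕ τ ≡ suc (toℕ t) → ∀ {x̄} →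
                stage G (toℕ τ) x̄ ≡ eval G (t ∷ τ ∷ x̄) (stage G (toℕ t) ∷ []) (fm φ)
    stage-suc {t} {τ} e {x̄} rewrite e =
      cong₂ (λ i j → eval G (i ∷ j ∷ x̄) (stage G (toℕ t) ∷ []) (fm φ))
            (clamp-toℕ t) (trans (cong (clamp n) (≡.sym e)) (clamp-toℕ τ))

    -- Stage `τ` and its marks enter together, in round `τ` + 1, so a visible mark certifies that
    -- its stage is complete.
    iter⇔ : ∀ k τ f x̄ → (iter k (τ ∷ f ∷ x̄) ≡ true) ⇔ (toℕ τ < k × Staged τ f x̄)
    iter⇔ zero τ f x̄ = mk⇔ (λ ()) (λ { (() , _) })
    iter⇔ (suc k) τ f x̄ = mk⇔ ⇒ ⇐
      where
      below : ∀ {t z : Fin (suc n)} → toℕ z ≡ 0 → toℕ t < k → ∀ ȳ → iter k (t ∷ z ∷ ȳ) ≡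
          stage G (toℕ t) ȳ
      below {t} {z} e t<k ȳ = true⇔-≡ (iter⇔ k t z ȳ) (mk⇔
        (λ s → t<k , inj₂ (e , s))
        λ { (_ , inj₁ ne) → ⊥-elim (ne e) ; (_ , inj₂ (_ , s)) → s })
      inner : ∀ {t} → toℕ τ ≡ suc (toℕ t) → toℕ f ≡ 0 → toℕ t < k →
              sem φ G (t ∷ τ ∷ pick (t ∷ τ ∷ f ∷ append x̄ ρ) (xs (num ∷ num ∷ num ∷ [])))
                      ((λ ȳ → iter k (t ∷ f ∷ ȳ)) ∷ []) ⇔ (stage G (toℕ τ) x̄ ≡ true)
      inner {t} e fz t<k = mk⇔
        (λ p → trans eq′ (from (ok φ G _ _) p)) (λ s → to (ok φ G _ _) (trans (≡.sym eq′) s))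
        where
        eq′ : stage G (toℕ τ) x̄ ≡ eval G (t ∷ τ ∷ pick (t ∷ τ ∷ f ∷ append x̄ ρ)
            (xs (num ∷ num ∷ num ∷ [])))
                      ((λ ȳ → iter k (t ∷ f ∷ ȳ)) ∷ []) (fm φ)
        eq′ = trans (stage-suc e)
             (trans (cong (λ z̄ → eval G (t ∷ τ ∷ z̄) (stage G (toℕ t) ∷ []) (fm φ))
                          (≡.sym (pick-xs (t ∷ τ ∷ f ∷ []) x̄ ρ)))
                    (eval-cong₁ G _ [] (λ ȳ → ≡.sym (below fz t<k ȳ)) (fm φ)))
      Rule : Set
      Rule = sem (body {Γ}) G (τ ∷ f ∷ append x̄ ρ) (iter k ∷ [])
      rule : (eval G (τ ∷ f ∷ append x̄ ρ) (iter k ∷ []) (fm (body {Γ})) ≡ true) ⇔ Rule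
      rule = ok (body {Γ}) G (τ ∷ f ∷ append x̄ ρ) (iter k ∷ [])
      rule⇒ : Rule → toℕ τ < suc k × Staged τ f x̄
      rule⇒ (inj₁ (f≢0 , inj₁ τ≡0)) = subst (_< suc k) (≡.sym τ≡0) (s≤s z≤n) , inj₁ f≢0
      rule⇒ (inj₁ (f≢0 , inj₂ (t , e' , r))) =
        subst (_< suc k) (≡.sym e') (s≤s (proj₁
            (to (iter⇔ k t f (pick (t ∷ τ ∷ f ∷ append x̄ ρ) (xs (num ∷ num ∷ num ∷ [])))) r))) ,
            inj₁ f≢0
      rule⇒ (inj₂ (f≡0 , t , e' , (f' , _ , r) , p)) =
        let t<k = proj₁ (to (iter⇔ k t f' (pick (f' ∷ t ∷ τ ∷ f ∷ append x̄ ρ) (xs (num ∷ num ∷ num ∷ num ∷ [])))) r) in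
        subst (_< suc k) (≡.sym e') (s≤s t<k) , inj₂ (f≡0 , to (inner e' f≡0 t<k) p)
      ⇒ : iter (suc k) (τ ∷ f ∷ x̄) ≡ true → toℕ τ < suc k × Staged τ f x̄
      ⇒ e = [ (λ p → let (lt , s) = to (iter⇔ k τ f x̄) p in ℕ.<-trans lt ℕ.≤-refl , s)
            , (λ q → rule⇒ (to rule q)) ]′ (∨-true⁻ {iter k (τ ∷ f ∷ x̄)} e)
      mark : ∀ {t f' : Fin (suc n)} ȳ → toℕ t < k → toℕ f' ≢ 0 → iter k (t ∷ f' ∷ ȳ) ≡ true
      mark ȳ t<k ne = from (iter⇔ k _ _ ȳ) (t<k , inj₁ ne)
      pred-of : toℕ τ ≢ 0 → Σ (Fin (suc n)) λ t → toℕ τ ≡ suc (toℕ t)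
      pred-of ne with toℕ τ in e
      ... | zero  = ⊥-elim (ne refl)
      ... | suc m = clamp n m , cong suc (≡.sym (toℕ-clamp (ℕ.≤-trans (ℕ.n≤1+n m)
              (subst (_≤ n) e (Fin.toℕ≤pred[n] τ)))))
      step⁺ : Rule → iter (suc k) (τ ∷ f ∷ x̄) ≡ true
      step⁺ p = ∨-true⁺ {iter k (τ ∷ f ∷ x̄)} (inj₂ (from rule p))
      ⇐ : toℕ τ < suc k × Staged τ f x̄ → iter (suc k) (τ ∷ f ∷ x̄) ≡ true
      ⇐ (lt , st) = go (toℕ τ ℕ.≟ 0) st
        where
        stage0 : toℕ τ ≡ 0 → ¬ (stage G (toℕ τ) x̄ ≡ true)
        stage0 z rewrite z = λ ()
        go : Dec (toℕ τ ≡ 0) → Staged τ f x̄ → iter (suc k) (τ ∷ f ∷ x̄) ≡ true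
        go (yes z) (inj₁ ne)       = step⁺ (inj₁ (ne , inj₁ z))
        go (yes z) (inj₂ (_ , s))  = ⊥-elim (stage0 z s)
        go (no nz) (inj₁ ne)       = let (t , e) = pred-of nz in
          step⁺ (inj₁ (ne , inj₂ (t , e , mark _ (s≤s⁻¹ (subst (_< suc k) e lt)) ne)))
        go (no nz) (inj₂ (fz , s)) = let (t , e) = pred-of nz
                                         t<k = s≤s⁻¹ (subst (_< suc k) e lt) in
          -- Some nonzero flag has to witness the mark on `t`; `τ` itself is nonzero here.
          step⁺ (inj₂ (fz , t , e , (τ , nz , mark _ t<k nz) , from (inner e fz t<k) s))

    -- Every stage is complete once as many rounds as tuples have passed.
    ifp-ok : ∀ τ z x̄ → toℕ z ≡ 0 →
             (iter (numTuples n (num ∷ num ∷ a)) (τ ∷ z ∷ x̄) ≡ true) ⇔ (stage G (toℕ τ) x̄ ≡ true)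
    ifp-ok τ z x̄ e = mk⇔
      (λ i → [ (λ ne → ⊥-elim (ne e)) , proj₂ ]′ (proj₂ (to (iter⇔ N τ z x̄) i)))
      (λ s → from (iter⇔ N τ z x̄) (ℕ.<-≤-trans (Fin.toℕ<n τ) enough , inj₂ (e , s)))
      where
      N = numTuples n (num ∷ num ∷ a)
      enough : suc n ≤ N
      enough = subst (_≤ N) (ℕ.*-identityʳ (suc n))
        (ℕ.*-monoʳ-≤ (suc n) (ℕ.≤-trans (numTuples>0 x̄) (ℕ.m≤n*m _ (suc n))))

  loopᴰ : D (num ∷ a) []
  loopᴰ = (∃ᴰ num (zeroᴰ v0 ∧ᴰ raw (ifp (num ∷ num ∷ a) (fm body)
      (varTms (v1 ∷ v0 ∷ All.map (wk (num ∷ num ∷ [])) (idV a))))))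
    as (λ { G (t ∷ x̄) σ → stage G (toℕ t) x̄ ≡ true }) by λ { {n} G (t ∷ x̄) [] →
      let run : ∀ z → toℕ z ≡ 0 → _
          run z e = ≡-⇔ (cong (iterate (numTuples n (num ∷ num ∷ a)) _ _)
                          (trans (evalTms-varTms G (z ∷ t ∷ x̄) []
                              (v1 ∷ v0 ∷ All.map (wk (num ∷ num ∷ [])) (idV a)))
                                 (cong (λ ȳ → t ∷ z ∷ ȳ) (trans (pick-wk (z ∷ t ∷ []) (idV a))
                                     (pick-id x̄)))))
                        (ifp-ok G (z ∷ t ∷ x̄) t z x̄ e)
      in mk⇔ (λ { (z , e , p) → to (run z e) p }) (λ s → zero , refl , from (run zero refl) s) }

-- The canonical partition of a class into modules

≢-≢⇒≡ : ∀ {b c d : Bool} → c ≢ b → d ≢ b → c ≡ d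
≢-≢⇒≡ {b} {c} {d} p q = trans (Bool.¬-not p) (≡.sym (Bool.¬-not q))

star-inv : ∀ {I : Set} {T : I → I → Set} (P : I → Set) → (∀ {i j} → T i j → P i → P j) →
           ∀ {i j} → P i → Star T i j → P j
star-inv P h p ε        = p
star-inv P h p (t ◅ ts) = star-inv P h (h t p) ts

module Split {n : ℕ} (G : Graph n) (Eq : Fin n → Fin n → Set) where

  Conn : Bool → Fin n → Fin n → Set
  Conn b = Star (λ z w → Eq z w × E G z w ≡ b)

  Disc : Bool → Fin n → Set
  Disc b u = Σ (Fin n) λ x → Σ (Fin n) λ y → Eq u x × Eq u y × ¬ Conn b x y

  -- The least module containing u and v: a vertex that distinguishes two members
  -- also distinguishes one of them from u, so that plain reachability suffices.
  Mem : Fin n → Fin n → Fin n → Set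
  Mem u v x = x ≡ u ⊎ Star (λ z x → Eq u x × E G x z ≢ E G x u) v x

  Full : Fin n → Fin n → Set
  Full u v = ∀ x → Eq u x → Mem u v x

  -- The cases of the modular decomposition in the order in which they are tried: components,
  -- co-components, maximal proper modules. Two vertices share a proper module exactly when their
  -- least module is not `Full`. The disjunct `u ≡ v` serves singleton classes, whose only module is
  -- full.
  Child : Fin n → Fin n → Set
  Child u v = Eq u v
            × (Disc true u → Conn true u v)
            × (¬ Disc true u → Disc false u → Conn false u v)
            × (¬ Disc true u → ¬ Disc false u → u ≡ v ⊎ ¬ Full u v)

record Equiv {n : ℕ} (R : Fin n → Fin n → Set) : Set where
  field
    rfl : ∀ {u} → R u u
    smm : ∀ {u v} → R u v → R v u
    trn : ∀ {u v w} → R u v → R v w → R u w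
    _≟ᴱ_ : ∀ u v → Dec (R u v)

module Partition {n : ℕ} (G : Graph n) (Eq : Fin n → Fin n → Set) (eqv : Equiv Eq)
  (Conn? : ∀ b u v → Dec (Split.Conn G Eq b u v))
  (Mem? : ∀ u v x → Dec (Split.Mem G Eq u v x)) where

  open Split G Eq
  open Equiv eqv

  Disc? : ∀ b u → Dec (Disc b u)
  Disc? b u = Fin.any? λ x → Fin.any? λ y → (u ≟ᴱ x) ×-dec (u ≟ᴱ y) ×-dec ¬? (Conn? b x y)

  Full? : ∀ u v → Dec (Full u v)
  Full? u v = Fin.all? λ x → (u ≟ᴱ x) →-dec Mem? u v x

  Child? : ∀ u v → Dec (Child u v)
  Child? u v = (u ≟ᴱ v)
    ×-dec (Disc? true u →-dec Conn? true u v)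
    ×-dec (¬? (Disc? true u) →-dec (Disc? false u →-dec Conn? false u v))
    ×-dec (¬? (Disc? true u) →-dec (¬? (Disc? false u) →-dec ((u Fin.≟ v) ⊎-dec ¬? (Full? u v))))

  conn-sym : ∀ {b u v} → Conn b u v → Conn b v u
  conn-sym = Star.reverse λ { (p , q) → smm p , trans (sym G _ _) q }

  Uniform : Fin n → (Fin n → Set) → Set
  Uniform c X = ∀ {w y z} → Eq c w → ¬ X w → X y → X z → E G w y ≡ E G w z

  record Mod (c : Fin n) : Set₁ where
    field
      X   : Fin n → Set
      X?  : ∀ x → Dec (X x)
      sub : ∀ {x} → X x → Eq c x
      has : X c
      uni : Uniform c X

  open Mod

  record Proper (c : Fin n) : Set₁ where
    field
      mod : Mod c
      out : Σ (Fin n) λ w → Eq c w × ¬ X mod w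

  open Proper

  memMod : ∀ {u v} → Eq u v → Mod u
  memMod {u} {v} uv = record
    { X = Mem u v ; X? = Mem? u v ; sub = sub′ ; has = inj₁ refl
    ; uni = λ uw ¬w y z → trans (to-u uw ¬w y) (≡.sym (to-u uw ¬w z)) }
    where
    sub′ : ∀ {x} → Mem u v x → Eq u x
    sub′ (inj₁ refl) = rfl
    sub′ (inj₂ p)    = star-inv (Eq u) (λ t _ → proj₁ t) uv p
    to-u : ∀ {w y} → Eq u w → ¬ Mem u v w → Mem u v y → E G w y ≡ E G w u
    to-u uw ¬w (inj₁ refl) = refl
    to-u {w} {y} uw ¬w (inj₂ p) with E G w y Bool.≟ E G w u
    ... | yes e = e
    ... | no ne = ⊥-elim (¬w (inj₂ (p ◅◅ ((uw , ne) ◅ ε))))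

  -- `X` need not be decidable, hence the double negation. The vertex set of a colour class will be
  -- such an `X`.
  least : ∀ {u v} (X : Fin n → Set) → X u → X v → Uniform u X → ∀ {x} → Mem u v x → ¬ ¬ X x
  least X xu xv uni (inj₁ refl) ¬x = ¬x xu
  least X xu xv uni (inj₂ p) =
    star-inv (λ x → ¬ ¬ X x) (λ { (ux , ne) ¬¬z ¬x → ¬¬z λ xz → ne (uni ux ¬x xz xu) })
             (λ ¬v → ¬v xv) p

  least-mod : ∀ {c u v} (M : Mod c) → Eq c u → X M u → X M v → ∀ {x} → Mem u v x → X M x
  least-mod M cu xu xv m =
    Dec.decidable-stable (X? M _) (least (X M) xu xv (λ uw → uni M (trn cu uw)) m)

  mem-sym : ∀ {u v x} → Eq u v → Mem u v x → Mem v u x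
  mem-sym uv = least-mod (memMod (smm uv)) (smm uv) (inj₂ ε) (inj₁ refl)

  full-sym : ∀ {u v} → Eq u v → Full u v → Full v u
  full-sym uv f x vx = mem-sym uv (f x (trn uv vx))

  properMem : ∀ {u v} → Eq u v → ¬ Full u v → Proper u
  properMem {u} {v} uv ¬f = record { mod = memMod uv ; out = escape }
    where
    escape : Σ (Fin n) λ w → Eq u w × ¬ Mem u v w
    escape with Fin.any? (λ w → (u ≟ᴱ w) ×-dec ¬? (Mem? u v w))
    ... | yes p = p
    ... | no ¬p = ⊥-elim (¬f λ x ux → Dec.decidable-stable (Mem? u v x) λ ¬m → ¬p (x , ux , ¬m))

  connected : ∀ {b c x y} → ¬ Disc b c → Eq c x → Eq c y → Conn b x y
  connected {b} {c} {x} {y} nd cx cy =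
    Dec.decidable-stable (Conn? b x y) λ ¬c → nd (x , y , cx , cy , ¬c)

  -- Overlapping modules always have a module as their union. Connectedness in both types keeps the
  -- union from being the whole class, and this makes the maximal proper modules disjoint.
  union : ∀ {c} → (∀ b → ¬ Disc b c) → (P Q : Proper c) →
          Σ (Proper c) λ R → ∀ {x} → X (mod P) x ⊎ X (mod Q) x → X (mod R) x
  union {c} nd P Q = record { mod = record
      { X = Z ; X? = λ x → X? (mod P) x ⊎-dec X? (mod Q) x
      ; sub = [ sub (mod P) , sub (mod Q) ]′ ; has = inj₁ (has (mod P))
      ; uni = λ cw ¬w y z → trans (to-c cw ¬w y) (≡.sym (to-c cw ¬w z)) }
    ; out = escape } , id
    where
    Z : Fin n → Set
    Z x = X (mod P) x ⊎ X (mod Q) x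
    to-c : ∀ {w y} → Eq c w → ¬ Z w → Z y → E G w y ≡ E G w c
    to-c cw ¬w (inj₁ y) = uni (mod P) cw (λ w → ¬w (inj₁ w)) y (has (mod P))
    to-c cw ¬w (inj₂ y) = uni (mod Q) cw (λ w → ¬w (inj₂ w)) y (has (mod Q))
    -- If P ∪ Q were everything, all pairs between the complement of Q and Q
    -- would have one type, so the other type would not connect the class.
    clash : (∀ x → Eq c x → Z x) → ⊥
    clash cov with out P | out Q
    ... | p , cp , p∉P | q , cq , q∉Q = proj₂ (star-inv (λ z → Eq c z × ¬ X (mod Q) z)
        (λ { {z} {x} (zx , e) (cz , z∉Q) → trn cz zx ,
             λ x∈Q → Bool.not-¬ (all-b cz z∉Q x∈Q) e })
        (cq , q∉Q) (connected (nd (not (E G p q))) cq cp)) p∈Q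
      where
      p∈Q : X (mod Q) p
      p∈Q = [ (λ h → ⊥-elim (p∉P h)) , id ]′ (cov p cp)
      in-P : ∀ {z} → Eq c z → ¬ X (mod Q) z → X (mod P) z
      in-P cz z∉Q = [ id , (λ h → ⊥-elim (z∉Q h)) ]′ (cov _ cz)
      all-b : ∀ {z x} → Eq c z → ¬ X (mod Q) z → X (mod Q) x → E G z x ≡ E G p q
      all-b {z} cz z∉Q x∈Q = trans (uni (mod Q) cz z∉Q x∈Q p∈Q)
        (trans (sym G z p) (uni (mod P) cp p∉P (in-P cz z∉Q) (in-P cq q∉Q)))
    escape : Σ (Fin n) λ w → Eq c w × ¬ Z w
    escape with Fin.any? (λ w → (c ≟ᴱ w) ×-dec ¬? (X? (mod P) w ⊎-dec X? (mod Q) w))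
    ... | yes p = p
    ... | no ¬p = ⊥-elim (clash λ x cx →
          Dec.decidable-stable (X? (mod P) x ⊎-dec X? (mod Q) x) λ ¬z → ¬p (x , cx , ¬z))

  disc-Eq : ∀ {b u v} → Eq u v → Disc b u → Disc b v
  disc-Eq uv (x , y , ux , uy , nc) = x , y , trn (smm uv) ux , trn (smm uv) uy , nc

  nodisc-Eq : ∀ {b u v} → Eq u v → ¬ Disc b u → ¬ Disc b v
  nodisc-Eq uv nd d = nd (disc-Eq (smm uv) d)

  both : ∀ {u} → ¬ Disc true u → ¬ Disc false u → ∀ b → ¬ Disc b u
  both p q true  = p
  both p q false = q

  child-sym : ∀ {u v} → Child u v → Child v u
  child-sym (uv , t , f , p) = let vu = smm uv in vu ,
    (λ d → conn-sym (t (disc-Eq vu d))) ,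
    (λ nd d → conn-sym (f (nodisc-Eq vu nd) (disc-Eq vu d))) ,
    (λ nt nf → [ (λ e → inj₁ (≡.sym e)) , (λ ¬f → inj₂ λ full → ¬f (full-sym vu full)) ]′
               (p (nodisc-Eq vu nt) (nodisc-Eq vu nf)))

  child-trans : ∀ {u v w} → Child u v → Child v w → Child u w
  child-trans {u} {v} {w} (uv , t , f , p) (vw , t' , f' , p') = trn uv vw ,
    (λ d → t d ◅◅ t' (disc-Eq uv d)) ,
    (λ nd d → f nd d ◅◅ f' (nodisc-Eq uv nd) (disc-Eq uv d)) ,
    (λ nt nf → join (both (nodisc-Eq uv nt) (nodisc-Eq uv nf)) (p nt nf)
        (p' (nodisc-Eq uv nt) (nodisc-Eq uv nf)))
    where
    join : (∀ b → ¬ Disc b v) → u ≡ v ⊎ ¬ Full u v → v ≡ w ⊎ ¬ Full v w → u ≡ w ⊎ ¬ Full u w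
    join nd (inj₁ refl) q = q
    join nd (inj₂ ¬f) (inj₁ refl) = inj₂ ¬f
    join nd (inj₂ ¬f) (inj₂ ¬f') = inj₂ λ full →
      -- Both least modules are based at the middle vertex `v`, where `union` applies; a proper
      -- module containing `u` and `w` refutes fullness.
      let (R , inc) = union nd (properMem (smm uv) (λ h → ¬f (full-sym (smm uv) h))) (properMem vw ¬f')
          (x , vx , x∉) = out R
      in x∉ (least-mod (mod R) (smm uv) (inc (inj₁ (inj₂ ε))) (inc (inj₂ (inj₂ ε))) (full x (trn uv vx)))

  child-equiv : Equiv Child
  child-equiv = record { rfl = rfl , (λ _ → ε) , (λ _ _ → ε) , (λ _ _ → inj₁ refl)
                       ; smm = child-sym ; trn = child-trans ; _≟ᴱ_ = Child? }

  -- If the class were its own only child, it would be connected in both types, and every vertex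
  -- other than `u` would share a proper module with `u`. `collect` unites these modules, starting
  -- from the singleton of `u`, which is proper because of `v`; the result is proper and yet
  -- contains the whole class.
  progress : ∀ {u v} → Eq u v → u ≢ v → Σ (Fin n) λ w → Eq u w × ¬ Child u w
  progress {u} {v} uv u≢v with Fin.any? (λ w → (u ≟ᴱ w) ×-dec ¬? (Child? u w))
  ... | yes p = p
  ... | no ¬p = ⊥-elim (absurd (Disc? true u) (Disc? false u))
    where
    child : ∀ {w} → Eq u w → Child u w
    child {w} uw = Dec.decidable-stable (Child? u w) λ ¬c → ¬p (w , uw , ¬c)
    collect : (∀ b → ¬ Disc b u) → ∀ ws →
              Σ (Proper u) λ R → ∀ {w} → w ∈ ws → Eq u w → X (mod R) w
    collect nd [] = record { mod = record { X = _≡ u ; X? = Fin._≟ u ; sub = λ { refl → rfl }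
                                          ; has = refl ; uni = λ { _ _ refl refl → refl } }
                           ; out = v , uv , λ e → u≢v (≡.sym e) } , λ ()
    collect nd (w ∷ ws) with collect nd ws | u ≟ᴱ w
    ... | R , h | no ¬uw = R , λ { (here refl) uw → ⊥-elim (¬uw uw) ; (there i) → h i }
    ... | R , h | yes uw with proj₂ (proj₂ (proj₂ (child uw))) (nd true) (nd false)
    ...   | inj₁ refl = R , λ { (here refl) _ → has (mod R) ; (there i) → h i }
    ...   | inj₂ ¬f   = let (R' , inc) = union nd R (properMem uw ¬f) in
            R' , λ { (here refl) _ → inc (inj₂ (inj₂ ε)) ; (there i) e → inc (inj₁ (h i e)) }
    absurd : Dec (Disc true u) → Dec (Disc false u) → ⊥
    absurd (yes d@(x , y , ux , uy , nc)) _ =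
      nc (conn-sym (proj₁ (proj₂ (child ux)) d) ◅◅ proj₁ (proj₂ (child uy)) d)
    absurd (no nt) (yes d@(x , y , ux , uy , nc)) =
      nc (conn-sym (proj₁ (proj₂ (proj₂ (child ux))) nt d) ◅◅ proj₁ (proj₂ (proj₂ (child uy))) nt d)
    absurd (no nt) (no nf) =
      let (R , h) = collect (both nt nf) (List.allFin n)
          (x , ux , x∉) = out R
      in x∉ (h (∈.∈-allFin x) ux)

  -- A vertex outside a component is related to it by the opposite type only. In the prime case a
  -- vertex inside the least module of `u` and `v` has a least module with `u` that is no larger, so
  -- it belongs to the same child.
  modular : ∀ {u v w} → Child u v → Eq u w → ¬ Child u w → E G w u ≡ E G w v
  modular {u} {v} {w} (uv , t , f , p) uw ¬c = cases (Disc? true u) (Disc? false u)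
    where
    apart : ∀ {b x} → Eq u x → Conn b u x → ¬ Conn b u w → E G w x ≢ b
    apart ux c ¬cw e = ¬cw (c ◅◅ ((trn (smm ux) uw , trans (sym G _ _) e) ◅ ε))
    cases : Dec (Disc true u) → Dec (Disc false u) → E G w u ≡ E G w v
    cases (yes d) _ = ≢-≢⇒≡ (apart rfl ε ¬w) (apart uv (t d) ¬w)
      where ¬w : ¬ Conn true u w
            ¬w c = ¬c (uw , (λ _ → c) , (λ nd → ⊥-elim (nd d)) , (λ nd → ⊥-elim (nd d)))
    cases (no nt) (yes d) = ≢-≢⇒≡ (apart rfl ε ¬w) (apart uv (f nt d) ¬w)
      where ¬w : ¬ Conn false u w
            ¬w c = ¬c (uw , (λ dt → ⊥-elim (nt dt)) , (λ _ _ → c) , (λ _ nd → ⊥-elim (nd d)))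
    cases (no nt) (no nf) = go (p nt nf)
      where
      go : u ≡ v ⊎ ¬ Full u v → E G w u ≡ E G w v
      go (inj₁ refl) = refl
      go (inj₂ ¬f) with Mem? u v w
      ... | no w∉  = uni (memMod uv) uw w∉ (inj₁ refl) (inj₂ ε)
      ... | yes w∈ = ⊥-elim (¬c (uw , (λ d → ⊥-elim (nt d)) , (λ _ d → ⊥-elim (nf d)) ,
            λ _ _ → inj₂ λ full → ¬f λ x ux → least-mod (memMod uv) rfl (inj₁ refl) w∈ (full x ux)))

  -- Detects prime nodes by the types of pairs alone: between components there are only non-edges,
  -- between co-components only edges.
  Mixed : Fin n → Set
  Mixed c = (b : Bool) → Σ (Fin n) λ x → Σ (Fin n) λ y →
            Eq c x × Eq c y × ¬ Child x y × E G x y ≡ b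

  mixed-connected : ∀ {c} → Mixed c → ∀ b → ¬ Disc b c
  mixed-connected {c} m = both nt nf
    where
    nt : ¬ Disc true c
    nt d = let (x , y , cx , cy , ¬c , e) = m true
               xy = trn (smm cx) cy
               d' = disc-Eq cx d
           in ¬c (xy , (λ _ → (xy , e) ◅ ε) , (λ nd → ⊥-elim (nd d')) , (λ nd → ⊥-elim (nd d')))
    nf : ¬ Disc false c
    nf d = let (x , y , cx , cy , ¬c , e) = m false
               xy = trn (smm cx) cy
           in ¬c (xy , (λ d' → ⊥-elim (nt (disc-Eq (smm cx) d'))) , (λ _ _ → (xy , e) ◅ ε) ,
                  (λ _ nd → ⊥-elim (nd (disc-Eq cx d))))

  mixed-prime : ∀ {c} → Mixed c → ∀ {x y} → Eq c x → Eq c y → ¬ Child x y →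
                (X : Fin n → Set) → X x → X y → Uniform c X → ∀ {w} → Eq c w → ¬ ¬ X w
  mixed-prime m {x} {y} cx cy ¬c X xx xy uni {w} cw =
    least X xx xy (λ xw → uni (trn cx xw)) (full w (trn (smm cx) cw))
    where
    full : Full x y
    full = Dec.decidable-stable (Full? x y) λ ¬f → ¬c (trn (smm cx) cy ,
      (λ d → ⊥-elim (mixed-connected m true (disc-Eq (smm cx) d))) ,
      (λ _ d → ⊥-elim (mixed-connected m false (disc-Eq (smm cx) d))) ,
      (λ _ _ → inj₂ ¬f))

-- Least elements and representatives of classes

-- The search never passes `x`, so it is total and returns `x` if nothing earlier satisfies `f`.
first : ∀ {n} → (Fin n → Bool) → Fin n → Fin n
first {suc n} f x = if f zero then zero else next x
  module First where
  next : Fin (suc n) → Fin (suc n)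
  next zero    = zero
  next (suc y) = suc (first (λ i → f (suc i)) y)

first-true : ∀ {n} (f : Fin n → Bool) x → f x ≡ true → f (first f x) ≡ true
first-true {suc n} f x e with f zero in e₀
first-true f x e       | true  = e₀
first-true f zero e    | false = e
first-true f (suc x) e | false = first-true (λ i → f (suc i)) x e

first-const : ∀ {n} (f : Fin n → Bool) x y → f x ≡ true → f y ≡ true → first f x ≡ first f y
first-const {suc n} f x y p q with f zero in e₀
first-const f x y p q             | true  = refl
first-const f (suc x) (suc y) p q | false = cong suc (first-const (λ i → f (suc i)) x y p q)
first-const f zero y p q          | false = ⊥-elim (Bool.not-¬ p e₀)
first-const f (suc x) zero p q    | false = ⊥-elim (Bool.not-¬ q e₀)

first-cong : ∀ {n} {f g : Fin n → Bool} → (∀ i → f i ≡ g i) → ∀ x → first f x ≡ first g x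
first-cong {suc n} {f} {g} h x with f zero | g zero | h zero
first-cong h x       | true  | _ | refl = refl
first-cong h zero    | false | _ | refl = refl
first-cong h (suc x) | false | _ | refl = cong suc (first-cong (λ i → h (suc i)) x)

module Rep {n : ℕ} {R : Fin n → Fin n → Set} (eqv : Equiv R) where

  open Equiv eqv

  -- An arbitrary choice that depends on the numbering of the vertices. It occurs in correctness
  -- proofs only, never in a formula.
  rep : Fin n → Fin n
  rep x = first (λ y → ⌊ x ≟ᴱ y ⌋) x

  rep-rel : ∀ x → R x (rep x)
  rep-rel x = to (⌊⌋-true (x ≟ᴱ rep x)) (first-true (λ y → ⌊ x ≟ᴱ y ⌋) x (from (⌊⌋-true (x ≟ᴱ x)) rfl))

  rep-≡ : ∀ {x y} → R x y → rep x ≡ rep y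
  rep-≡ {x} {y} xy = trans
    (first-const (λ z → ⌊ x ≟ᴱ z ⌋) x y (from (⌊⌋-true (x ≟ᴱ x)) rfl) (from (⌊⌋-true (x ≟ᴱ y)) xy))
    (first-cong (λ z → true⇔-≡ (⌊⌋-true (x ≟ᴱ z))
      (mk⇔ (λ e → trn xy (to (⌊⌋-true (y ≟ᴱ z)) e)) (λ xz → from (⌊⌋-true (y ≟ᴱ z)) (trn (smm xy) xz))))
          y)

  rep-inj : ∀ {x y} → rep x ≡ rep y → R x y
  rep-inj {x} {y} e = trn (rep-rel x) (subst (λ z → R z y) (≡.sym e) (smm (rep-rel y)))

-- The order of the children of a prime node

swap : ∀ {A : Set} → A × A → A × A
swap (x , y) = y , x

module Forcing {n : ℕ} (G : Graph n) (Eq Ch : Fin n → Fin n → Set) where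

  -- Every realizer orders (y , x) like (y , z).
  Flip : Fin n → Fin n → Fin n → Set
  Flip y x z = Eq y z × (Ch x z ⊎ (E G y x ≡ E G y z × E G x z ≢ E G y x))

  FStep : Fin n × Fin n → Fin n × Fin n → Set
  FStep p q = (proj₁ p ≡ proj₁ q × Flip (proj₁ p) (proj₂ p) (proj₂ q))
            ⊎ (proj₂ p ≡ proj₂ q × Flip (proj₂ p) (proj₁ p) (proj₁ q))

  Force : Fin n × Fin n → Fin n × Fin n → Set
  Force = Star FStep

module Prime {n : ℕ} (G : Graph n) (Eq Ch : Fin n → Fin n → Set) (eqv : Equiv Eq) (chv : Equiv Ch)
  (ch-Eq : ∀ {u v} → Ch u v → Eq u v)
  (modular : ∀ {u v w} → Ch u v → Eq u w → ¬ Ch u w → E G w u ≡ E G w v)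
  (c : Fin n)
  (prime : ∀ {x y} → Eq c x → Eq c y → ¬ Ch x y → (X : Fin n → Set) → X x → X y →
           (∀ {w y z} → Eq c w → ¬ X w → X y → X z → E G w y ≡ E G w z) →
           ∀ {w} → Eq c w → ¬ ¬ X w)
  where

  open Forcing G Eq Ch
  open Equiv eqv
  open Equiv chv using () renaming (rfl to ch-refl; smm to ch-sym; trn to ch-trans; _≟ᴱ_ to _≟ᶜ_)

  Pair : Set
  Pair = Fin n × Fin n

  Cross : Pair → Set
  Cross (x , y) = Eq c x × Eq c y × ¬ Ch x y

  ty : Pair → Bool
  ty (x , y) = E G x y

  cross-swap : ∀ {p} → Cross p → Cross (swap p)
  cross-swap (cx , cy , nc) = cy , cx , λ yx → nc (ch-sym yx)

  flip-cross : ∀ {y x z} → Cross (y , x) → Flip y x z → Cross (y , z)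
  flip-cross {y} {x} {z} (cy , cx , nc) (yz , alt) = cy , trn cy yz , λ cyz → [
    (λ xz → nc (ch-trans cyz (ch-sym xz))) ,
    (λ { (e , ne) → ne (trans (≡.sym (modular cyz (trn (smm cy) cx) nc)) (sym G x y)) }) ]′ alt

  flip-type : ∀ {y x z} → Cross (y , x) → Flip y x z → E G y x ≡ E G y z
  flip-type (cy , cx , nc) (yz , inj₁ xz) =
    modular xz (trn (smm cx) cy) (λ xy → nc (ch-sym xy))
  flip-type _ (yz , inj₂ (e , _)) = e

  flip-sym : ∀ {y x z} → Cross (y , x) → Flip y x z → Flip y z x
  flip-sym (cy , cx , _) (yz , inj₁ xz) = trn (smm cy) cx , inj₁ (ch-sym xz)
  flip-sym {y} {x} {z} (cy , cx , _) (yz , inj₂ (e , ne)) = trn (smm cy) cx ,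
    inj₂ (≡.sym e , λ e' → ne (trans (sym G x z) (trans e' (≡.sym e))))

  -- Forcing up to reversal. For edges, and likewise for non-edges, its reachability classes are
  -- Gallai's colour classes, with the vertices of one child treated alike.
  CStep : Pair → Pair → Set
  CStep p q = Cross p × (FStep p q ⊎ q ≡ swap p)

  cstep-cross : ∀ {p q} → CStep p q → Cross q
  cstep-cross (cp , inj₁ (inj₁ (refl , f))) = flip-cross cp f
  cstep-cross (cp , inj₁ (inj₂ (refl , f))) = cross-swap (flip-cross (cross-swap cp) f)
  cstep-cross (cp , inj₂ refl)              = cross-swap cp

  cstep-type : ∀ {p q} → CStep p q → ty p ≡ ty q
  cstep-type (cp , inj₁ (inj₁ (refl , f))) = flip-type cp f
  cstep-type (cp , inj₁ (inj₂ (refl , f))) =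
    trans (sym G _ _) (trans (flip-type (cross-swap cp) f) (sym G _ _))
  cstep-type (cp , inj₂ refl)              = sym G _ _

  cstep-sym : ∀ {p q} → CStep p q → CStep q p
  cstep-sym t@(cp , inj₁ (inj₁ (refl , f))) = cstep-cross t , inj₁ (inj₁ (refl , flip-sym cp f))
  cstep-sym t@(cp , inj₁ (inj₂ (refl , f))) =
    cstep-cross t , inj₁ (inj₂ (refl , flip-sym (cross-swap cp) f))
  cstep-sym t@(cp , inj₂ refl)              = cstep-cross t , inj₂ refl

  Color : Pair → Pair → Set
  Color = Star CStep

  color-sym : ∀ {p q} → Color p q → Color q p
  color-sym = Star.reverse cstep-sym

  color-cross : ∀ {p q} → Cross p → Color p q → Cross q
  color-cross = star-inv Cross (λ t _ → cstep-cross t)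

  color-type : ∀ {p q} → Color p q → ty p ≡ ty q
  color-type {p} = star-inv (λ q → ty p ≡ ty q) (λ t e → trans e (cstep-type t)) refl

  module Class {p : Pair} (cp : Cross p) where

    flipped : ∀ {y x z} → Color p (y , x) → Flip y x z → Color p (y , z)
    flipped k f = k ◅◅ ((color-cross cp k , inj₁ (inj₁ (refl , f))) ◅ ε)

    swapped : ∀ {q} → Color p q → Color p (swap q)
    swapped k = k ◅◅ ((color-cross cp k , inj₂ refl) ◅ ε)

    V : Fin n → Set
    V x = Σ (Fin n) λ y → Color p (x , y)

    -- If the types of `w` to `x` and to `y` differed, one of them would agree with the type of the
    -- pair and the other would not, and a flip would bring `w` into the class.
    same-type : ∀ {w x y} → Eq c w → ¬ V w → Color p (x , y) → E G w x ≡ E G w y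
    same-type {w} {x} {y} cw ¬v k with E G w x Bool.≟ E G w y
    ... | yes e = e
    ... | no ne = ⊥-elim (¬v (out (E G w x Bool.≟ E G x y)))
      where
      cross = color-cross cp k
      xw = trn (smm (proj₁ cross)) cw
      yw = trn (smm (proj₁ (proj₂ cross))) cw
      out : Dec (E G w x ≡ E G x y) → V w
      out (yes e) = x , swapped (flipped k (xw , inj₂ (trans (≡.sym e) (sym G w x) ,
        λ e' → ne (trans e (trans (≡.sym e') (sym G y w))))))
      out (no ne') = y , swapped (flipped (swapped k)
          (yw , inj₂ (e″ , λ e' → ne' (trans (sym G w x) (trans e' (sym G y x))))))
        where
        e″ : E G y x ≡ E G y w
        e″ = trans (sym G y x) (trans (≢-≢⇒≡ (λ e → ne' (≡.sym e)) (λ e → ne (≡.sym e))) (sym G w y))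

    span : ∀ {w} → Eq c w → ¬ ¬ V w
    span = prime (proj₁ cp) (proj₁ (proj₂ cp)) (proj₂ (proj₂ cp)) V (_ , ε) (_ , swapped ε)
      λ { cw ¬w (_ , k) (_ , l) → trans (base cw ¬w k) (≡.sym (base cw ¬w l)) }
      where
      a = proj₁ p
      -- The type seen from `w` is carried along the colour path, since neighbouring pairs share a
      -- vertex.
      base : ∀ {w x y} → Eq c w → ¬ V w → Color p (x , y) → E G w x ≡ E G w a
      base {w} cw ¬w k = proj₁ (proj₂ (star-inv
        (λ q → Color p q × E G w (proj₁ q) ≡ E G w a × E G w (proj₂ q) ≡ E G w a)
        inv (ε , refl , ≡.sym (same-type cw ¬w ε)) k))
        where
        inv : ∀ {q r} → CStep q r → Color p q × E G w (proj₁ q) ≡ E G w a × E G w (proj₂ q) ≡ E G w a →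
              Color p r × E G w (proj₁ r) ≡ E G w a × E G w (proj₂ r) ≡ E G w a
        inv {q} {r} t@(_ , inj₁ (inj₁ (refl , _))) (k , e , _) =
          let k' = k ◅◅ (t ◅ ε) in k' , e , trans (≡.sym (same-type cw ¬w k')) e
        inv {q} {r} t@(_ , inj₁ (inj₂ (refl , _))) (k , _ , e) =
          let k' = k ◅◅ (t ◅ ε) in k' , trans (same-type cw ¬w k') e , e
        inv t@(_ , inj₂ refl) (k , e , e') = k ◅◅ (t ◅ ε) , e' , e

    -- If w forms a triangle with a pair of the class whose other two sides have the
    -- same type but are not in the class, then no pair of the class contains w.
    module Triangle {w : Fin n} (cw : Eq c w) where

      J : Fin n → Set
      J v = ¬ Ch w v × E G w v ≡ ty p × ¬ Color p (w , v)

      -- Each way in which `z` could fail allows one more flip, which puts the side from `w` to `y`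
      -- or to `x` into the class.
      J-flip : ∀ {y x z} → J y → J x → Color p (y , x) → Flip y x z → J z
      J-flip {y} {x} {z} (ncy , ty′ , ¬ky) (ncx , tx , ¬kx) k f = nc , e , nk
        where
        k' = flipped k f
        cross = color-cross cp k
        yw = trn (smm (proj₁ cross)) cw
        wx = trn (smm cw) (proj₁ (proj₂ cross))
        nc : ¬ Ch w z
        nc wz = ¬ky (swapped (flipped k' (yw , inj₁ (ch-sym wz))))
        e : E G w z ≡ ty p
        e with E G w z Bool.≟ ty p
        ... | yes e = e
        ... | no ne = ⊥-elim (¬ky (swapped (flipped k' (yw , inj₂
              ( trans (≡.sym (color-type k')) (trans (≡.sym ty′) (sym G w y))
              , λ e' → ne (trans (sym G w z) (trans e' (≡.sym (color-type k')))))))))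
        nk : ¬ Color p (w , z)
        nk l = ¬kx (flipped l (wx , alt (proj₂ f)))
          where
          alt : Ch x z ⊎ (E G y x ≡ E G y z × E G x z ≢ E G y x) → Ch z x ⊎
              (E G w z ≡ E G w x × E G z x ≢ E G w z)
          alt (inj₁ xz) = inj₁ (ch-sym xz)
          alt (inj₂ (_ , ne)) = inj₂ (trans e (≡.sym tx) ,
            λ e' → ne (trans (sym G x z) (trans e' (trans e (color-type k)))))

      -- Every pair of the class is linked to `q`, and `J` is kept along the link; at a pair
      -- containing `w` it would say that `w` is not in its own child.
      avoid : ∀ {q} → Color p q → J (proj₁ q) → J (proj₂ q) → ¬ V w
      avoid {q} k j₁ j₂ (r , l) = proj₁ (proj₁ (proj₂ (star-inv
        (λ q → Color p q × J (proj₁ q) × J (proj₂ q)) inv (k , j₁ , j₂) (color-sym k ◅◅ l)))) ch-refl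
        where
        inv : ∀ {q r} → CStep q r → Color p q × J (proj₁ q) × J (proj₂ q) →
              Color p r × J (proj₁ r) × J (proj₂ r)
        inv t@(_ , inj₁ (inj₁ (refl , f))) (k , j , j') = k ◅◅ (t ◅ ε) , j , J-flip j j' k f
        inv t@(_ , inj₁ (inj₂ (refl , f))) (k , j , j') = k ◅◅ (t ◅ ε) , J-flip j' j (swapped k) f , j'
        inv t@(_ , inj₂ refl) (k , j , j') = k ◅◅ (t ◅ ε) , j' , j

  -- The class of `p` covers `x`, say by a pair `(x , z)`. Unless a flip leads to `(x , y)`, the
  -- three vertices form a triangle of one type. If `(y , z)` is outside the class of `p`, then `y`
  -- avoids that class; otherwise `z` avoids the class of `q`. Either contradicts `span`.
  one-color : ∀ {p q} → Cross p → Cross q → ty p ≡ ty q → ¬ ¬ Color p q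
  one-color {p} {x , y} cp cq@(cx , cy , nc) e ¬k =
      P.span cx λ { (z , k) → go k (y ≟ᶜ z) (E G y z Bool.≟ E G x y) }
    where
    module P = Class cp
    module Q = Class cq
    go : ∀ {z} → Color p (x , z) → Dec (Ch y z) → Dec (E G y z ≡ E G x y) → ⊥
    go {z} k (yes yz) _ = ¬k (P.flipped k (trn (smm cx) cy , inj₁ (ch-sym yz)))
    go {z} k (no nyz) (no ne) = ¬k (P.flipped k (trn (smm cx) cy ,
      inj₂ (trans (≡.sym (color-type k)) e ,
            λ e' → ne (trans (sym G y z) (trans e' (trans (≡.sym (color-type k)) e))))))
    go {z} k (no nyz) (yes e') = ¬¬yz ¬yz
      where
      cz = proj₁ (proj₂ (color-cross cp k))
      ncx : ¬ Ch x z
      ncx = proj₂ (proj₂ (color-cross cp k))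
      ¬¬yz : ¬ ¬ Color p (y , z)
      ¬¬yz ¬yz = P.span cy (P.Triangle.avoid cy k
        ((λ h → nc (ch-sym h)) , trans (sym G y x) (≡.sym e) , λ l → ¬k (P.swapped l))
        (nyz , trans e' (≡.sym e) , ¬yz))
      ¬yz : ¬ Color p (y , z)
      ¬yz l = Q.span cz (Q.Triangle.avoid cz ε
        ((λ h → ncx (ch-sym h)) , trans (sym G z x) (trans (≡.sym (color-type k)) e) ,
          λ m → ¬k (k ◅◅ color-sym (Q.swapped m)))
        ((λ h → nyz (ch-sym h)) , trans (sym G z y) e' ,
          λ m → ¬k (l ◅◅ color-sym (Q.swapped m))))

  fstep-swap : ∀ {p q} → FStep p q → FStep (swap p) (swap q)
  fstep-swap (inj₁ h) = inj₂ h
  fstep-swap (inj₂ h) = inj₁ h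

  orient : ∀ {p q} → Color p q → Force p q ⊎ Force p (swap q)
  orient {p} = star-inv (λ q → Force p q ⊎ Force p (swap q)) inv (inj₁ ε)
    where
    inv : ∀ {q r} → CStep q r → Force p q ⊎ Force p (swap q) → Force p r ⊎ Force p (swap r)
    inv (_ , inj₁ t)    (inj₁ f) = inj₁ (f ◅◅ (t ◅ ε))
    inv (_ , inj₁ t)    (inj₂ f) = inj₂ (f ◅◅ (fstep-swap t ◅ ε))
    inv (_ , inj₂ refl) (inj₁ f) = inj₂ f
    inv (_ , inj₂ refl) (inj₂ f) = inj₁ f

  module Ordered (_<ᴸ_ : Fin n → Fin n → Set)
    (asym : ∀ {x y} → x <ᴸ y → ¬ (y <ᴸ x)) (ltrans : ∀ {x y z} → x <ᴸ y → y <ᴸ z → x <ᴸ z)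
    (total : ∀ x y → x <ᴸ y ⊎ x ≡ y ⊎ y <ᴸ x)
    (good : ∀ {x y z} → x <ᴸ y → y <ᴸ z → E G x y ≡ E G y z → E G x z ≡ E G x y)
    where

    open Rep chv

    -- Comparing one representative per child makes the order constant on children, without an
    -- argument that children are intervals of the given order.
    _≺_ : Fin n → Fin n → Set
    x ≺ y = rep x <ᴸ rep y

    cross-type : ∀ {x y} → Cross (x , y) → E G (rep x) (rep y) ≡ E G x y
    cross-type {x} {y} (cx , cy , nc) =
      trans (≡.sym (modular (rep-rel y) (trn (smm cy) (trn cx (ch-Eq (rep-rel x))))
              (λ h → nc (ch-trans (rep-rel x) (ch-sym h)))))
      (trans (sym G (rep x) y)
      (trans (≡.sym (modular (rep-rel x) (trn (smm cx) cy) nc)) (sym G y x)))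

    ≺-total : ∀ {x y} → ¬ Ch x y → x ≺ y ⊎ y ≺ x
    ≺-total {x} {y} nc with total (rep x) (rep y)
    ... | inj₁ lt        = inj₁ lt
    ... | inj₂ (inj₁ e)  = ⊥-elim (nc (rep-inj e))
    ... | inj₂ (inj₂ gt) = inj₂ gt

    -- If `z` lay on the other side of `y`, then `y` would be between `x` and `z` with two pairs of
    -- the same type, and `good` would give `x` and `z` that type as well.
    flip-order : ∀ {y x z} → Cross (y , x) → Flip y x z → (y ≺ x → y ≺ z) × (x ≺ y → z ≺ y)
    flip-order {y} {x} {z} cr@(cy , cx , nc) f@(yz , alt) with x ≟ᶜ z
    ... | yes xz = subst (rep y <ᴸ_) (rep-≡ xz) , subst (_<ᴸ rep y) (rep-≡ xz)
    ... | no nxz = ⇒ , ⇐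
      where
      cr' = flip-cross cr f
      cxz : Cross (x , z)
      cxz = cx , trn cy yz , nxz
      ne : E G x z ≢ E G y x
      ne = [ (λ xz → ⊥-elim (nxz xz)) , proj₂ ]′ alt
      tyx = flip-type cr f
      ⇒ : y ≺ x → y ≺ z
      ⇒ yx = [ id , (λ zy → ⊥-elim (ne (trans (sym G x z)
        (trans (trans (≡.sym (cross-type (cross-swap cxz)))
               (trans (good zy yx (trans (cross-type (cross-swap cr'))
                   (trans (sym G z y) (trans (≡.sym tyx) (≡.sym (cross-type cr))))))
                      (cross-type (cross-swap cr'))))
               (trans (sym G z y) (≡.sym tyx)))))) ]′ (≺-total (proj₂ (proj₂ cr')))
      ⇐ : x ≺ y → z ≺ y
      ⇐ xy = [ (λ yz → ⊥-elim (ne (trans (≡.sym (cross-type cxz))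
        (trans (good xy yz (trans (cross-type (cross-swap cr))
            (trans (sym G x y) (trans tyx (≡.sym (cross-type cr'))))))
               (trans (cross-type (cross-swap cr)) (sym G x y)))))) , id ]′ (≺-total (proj₂ (proj₂ cr')))

    force-order : ∀ {p q} → Cross p → proj₁ p ≺ proj₂ p → Force p q → Cross q × proj₁ q ≺ proj₂ q
    force-order cp lt = star-inv (λ q → Cross q × proj₁ q ≺ proj₂ q) inv (cp , lt)
      where
      inv : ∀ {q r} → FStep q r → Cross q × proj₁ q ≺ proj₂ q → Cross r × proj₁ r ≺ proj₂ r
      inv (inj₁ (refl , f)) (cr , lt) = flip-cross cr f , proj₁ (flip-order cr f) lt
      inv (inj₂ (refl , f)) (cr , lt) =
        cross-swap (flip-cross (cross-swap cr) f) , proj₂ (flip-order (cross-swap cr) f) lt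

    -- A colour path orients to `q` or to its reversal; the reversal is excluded because forcing
    -- respects the order.
    forced : ∀ {p q} → Cross p → proj₁ p ≺ proj₂ p → Cross q → ty p ≡ ty q →
             proj₁ q ≺ proj₂ q → ¬ ¬ Force p q
    forced cp lt cq e lt' ¬f = one-color cp cq e λ k →
      [ ¬f , (λ f → asym lt' (proj₂ (force-order cp lt f))) ]′ (orient k)

-- Betweenness in the first order of a realizer

module Realized {n : ℕ} {G : Graph n} (R : Realizer G) where

  open Realizer R
  open import Relation.Binary using (IsStrictTotalOrder)
  module O₁ = IsStrictTotalOrder lin₁
  module O₂ = IsStrictTotalOrder lin₂

  total₁ : ∀ x y → x <₁ y ⊎ x ≡ y ⊎ y <₁ x
  total₁ x y with O₁.compare x y
  ... | tri< p _ _ = inj₁ p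
  ... | tri≈ _ p _ = inj₂ (inj₁ p)
  ... | tri> _ _ p = inj₂ (inj₂ p)

  type-true : ∀ {x y} → x <₁ y → y <₂ x → E G x y ≡ true
  type-true {x} {y} p q = from (adj x y λ { refl → O₁.irrefl refl p }) (inj₁ (p , q))

  reversed : ∀ {x y} → x <₁ y → E G x y ≡ true → y <₂ x
  reversed {x} {y} p e = [ proj₂ , (λ { (q , _) → ⊥-elim (O₁.asym p q) }) ]′
    (to (adj x y λ { refl → O₁.irrefl refl p }) e)

  kept : ∀ {x y} → x <₁ y → E G x y ≡ false → x <₂ y
  kept {x} {y} p e with O₂.compare x y
  ... | tri< q _ _    = q
  ... | tri≈ _ refl _ = ⊥-elim (O₁.irrefl refl p)
  ... | tri> _ _ q    with trans (≡.sym (type-true p q)) e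
  ...   | ()

  -- Two edges reverse both pairs in `<₂` and two non-edges keep both, so transitivity of `<₂`
  -- settles the third pair.
  good : ∀ {x y z} → x <₁ y → y <₁ z → E G x y ≡ E G y z → E G x z ≡ E G x y
  good {x} {y} {z} p q e with E G x y in xy | E G x z in xz
  ... | true  | true  = refl
  ... | false | false = refl
  ... | true  | false = trans (≡.sym xz) (type-true (O₁.trans p q)
        (O₂.trans (reversed q (≡.sym e)) (reversed p xy)))
  ... | false | true  = ⊥-elim (O₂.asym (reversed (O₁.trans p q) xz)
        (O₂.trans (kept p xy) (kept q (≡.sym e))))

-- Counting and lexicographic orders

# : ∀ {n} {P : Fin n → Set} → (∀ x → Dec (P x)) → ℕ
# {n} P? = weight (List.allFin n) (λ x → ⌊ P? x ⌋)

module _ {n : ℕ} {P Q : Fin n → Set} {P? : ∀ x → Dec (P x)} {Q? : ∀ x → Dec (Q x)} where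

  #-mono : (∀ {x} → P x → Q x) → # P? ≤ # Q?
  #-mono h = weight-mono (List.allFin n) λ x → bit-⇒ λ e →
    from (⌊⌋-true (Q? x)) (h (to (⌊⌋-true (P? x)) e))

#-cong : ∀ {n} {P Q : Fin n → Set} {P? : ∀ x → Dec (P x)} {Q? : ∀ x → Dec (Q x)} →
         (∀ {x} → P x → Q x) → (∀ {x} → Q x → P x) → # P? ≡ # Q?
#-cong {P? = P?} {Q?} h k = ℕ.≤-antisym (#-mono {P? = P?} {Q?} h) (#-mono {P? = Q?} {P?} k)

#-counts : ∀ {n} {P : Fin n → Set} (P? : ∀ x → Dec (P x)) k → Counts P k ⇔ (k ≡ # P?)
#-counts {n} P? k = mk⇔
  (λ { (f , h , e) → trans e (weight-cong (List.allFin n) λ x → true⇔-≡ (h x) (⌊⌋-true (P? x))) })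
  (λ e → (λ x → ⌊ P? x ⌋) , (λ x → ⌊⌋-true (P? x)) , e)

#-+ : ∀ {n} {P Q R : Fin n → Set} (P? : ∀ x → Dec (P x)) (Q? : ∀ x → Dec (Q x)) (R? : ∀ x → Dec (R x)) →
      (∀ {x} → P x → Q x ⊎ R x) → (∀ {x} → Q x → P x) → (∀ {x} → R x → P x) →
      (∀ {x} → Q x → ¬ R x) → # P? ≡ # Q? + # R?
#-+ {n} P? Q? R? split q r dis =
  weight-+ (List.allFin n) λ x → go (P? x) (Q? x) (R? x) split q r dis
  where
  go : {A B C : Set} (p? : Dec A) (q? : Dec B) (r? : Dec C) → (A → B ⊎ C) → (B → A) → (C → A) →
       (B → ¬ C) → bit ⌊ p? ⌋ ≡ bit ⌊ q? ⌋ + bit ⌊ r? ⌋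
  go (yes p) (yes b) (yes c) s f g d = ⊥-elim (d b c)
  go (yes p) (yes b) (no ¬c) s f g d = refl
  go (yes p) (no ¬b) (yes c) s f g d = refl
  go (yes p) (no ¬b) (no ¬c) s f g d = ⊥-elim ([ ¬b , ¬c ]′ (s p))
  go (no ¬p) (yes b) _       s f g d = ⊥-elim (¬p (f b))
  go (no ¬p) (no ¬b) (yes c) s f g d = ⊥-elim (¬p (g c))
  go (no ¬p) (no ¬b) (no ¬c) s f g d = refl

#-+≤ : ∀ {n} {P Q R : Fin n → Set} (P? : ∀ x → Dec (P x)) (Q? : ∀ x → Dec (Q x)) (R? : ∀ x → Dec (R x)) →
       (∀ {x} → Q x → P x) → (∀ {x} → R x → P x) → (∀ {x} → Q x → ¬ R x) → # Q? + # R? ≤ # P?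
#-+≤ {Q = Q} {R} P? Q? R? q r dis = ℕ.≤-trans
  (ℕ.≤-reflexive (≡.sym (#-+ QR? Q? R? id inj₁ inj₂ dis))) (#-mono {P? = QR?} {P?} [ q , r ]′)
  where
  QR? : ∀ x → Dec (Q x ⊎ R x)
  QR? x = Q? x ⊎-dec R? x

#-empty : ∀ {n} {P : Fin n → Set} (P? : ∀ x → Dec (P x)) → (∀ {x} → ¬ P x) → # P? ≡ 0
#-empty P? ¬p = ≡.sym (ℕ.+-cancelˡ-≡ (# P?) 0 (# P?)
  (trans (ℕ.+-identityʳ (# P?)) (#-+ P? P? P? inj₁ id id (λ p _ → ¬p p))))

#-full : ∀ {n} {P : Fin n → Set} (P? : ∀ x → Dec (P x)) → (∀ x → P x) → # P? ≡ n
#-full {n} P? p = trans (trans (weight-cong (List.allFin n) λ x → from (⌊⌋-true (P? x)) (p x))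
  (ones (List.allFin n))) (List.length-tabulate {n = n} id)
  where
  ones : ∀ {A : Set} (xs : List A) → weight xs (const true) ≡ length xs
  ones []       = refl
  ones (x ∷ xs) = cong suc (ones xs)

#≤n : ∀ {n} {P : Fin n → Set} (P? : ∀ x → Dec (P x)) → # P? ≤ n
#≤n {n} P? = ℕ.≤-trans (weight≤length (List.allFin n) _)
    (ℕ.≤-reflexive (List.length-tabulate {n = n} id))

#-pos : ∀ {n} {P : Fin n → Set} (P? : ∀ x → Dec (P x)) {x} → P x → 0 < # P?
#-pos {n} P? {x} p = ℕ.≤-<-trans z≤n
  (weight-strict {xs = List.allFin n} {f = const false} {x = x} (λ y → z≤n) (∈.∈-allFin x)
    (ℕ.≤-reflexive (≡.sym (cong bit (from (⌊⌋-true (P? x)) p)))))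

-- An equivalence takes the place of equality, because the matrices to be compared are families of
-- propositions.
record StrictTotal {A : Set₁} (_≈_ _<ˢ_ : A → A → Set) : Set₁ where
  field
    ≈-refl  : ∀ {x} → x ≈ x
    ≈-sym   : ∀ {x y} → x ≈ y → y ≈ x
    ≈-trans : ∀ {x y z} → x ≈ y → y ≈ z → x ≈ z
    irr     : ∀ {x y} → x ≈ y → ¬ (x <ˢ y)
    <-trans : ∀ {x y z} → x <ˢ y → y <ˢ z → x <ˢ z
    tri     : ∀ x y → x <ˢ y ⊎ x ≈ y ⊎ y <ˢ x

  <-≈ : ∀ {x y z} → x <ˢ y → y ≈ z → x <ˢ z
  <-≈ {x} {y} {z} p e with tri x z
  ... | inj₁ q        = q
  ... | inj₂ (inj₁ q) = ⊥-elim (irr (≈-trans q (≈-sym e)) p)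
  ... | inj₂ (inj₂ q) = ⊥-elim (irr (≈-sym e) (<-trans q p))

  ≈-< : ∀ {x y z} → x ≈ y → y <ˢ z → x <ˢ z
  ≈-< {x} {y} {z} e p with tri x z
  ... | inj₁ q        = q
  ... | inj₂ (inj₁ q) = ⊥-elim (irr (≈-trans (≈-sym e) q) p)
  ... | inj₂ (inj₂ q) = ⊥-elim (irr (≈-sym e) (<-trans p q))

module Pointwise {A : Set₁} (_≈_ _<ˢ_ : A → A → Set) (m : ℕ) where

  EqF : (Fin m → A) → (Fin m → A) → Set
  EqF f g = ∀ i → f i ≈ g i

  -- The lexicographic order by the first place of difference. It is used twice, for rows and for
  -- matrices as sequences of rows.
  LtF : (Fin m → A) → (Fin m → A) → Set
  LtF f g = Σ (Fin m) λ i → f i <ˢ g i × (∀ j → toℕ j < toℕ i → f j ≈ g j)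

pointwise : ∀ {A : Set₁} {_≈_ _<ˢ_ : A → A → Set} → StrictTotal _≈_ _<ˢ_ → ∀ m →
            StrictTotal (Pointwise.EqF _≈_ _<ˢ_ m) (Pointwise.LtF _≈_ _<ˢ_ m)
pointwise {A} {_≈_} {_<ˢ_} st m = record
  { ≈-refl = λ i → ≈-refl ; ≈-sym = λ h i → ≈-sym (h i) ; ≈-trans = λ h k i → ≈-trans (h i) (k i)
  ; irr = λ { h (i , p , _) → irr (h i) p } ; <-trans = trans′ ; tri = tri′ m }
  where
  open StrictTotal st
  open Pointwise {A} _≈_ _<ˢ_
  trans′ : ∀ {f g h} → LtF m f g → LtF m g h → LtF m f h
  trans′ (i , p , b) (j , q , c) with ℕ.<-cmp (toℕ i) (toℕ j)
  ... | tri< lt _ _ = i , <-≈ p (c i lt) , λ k k< → ≈-trans (b k k<) (c k (ℕ.<-trans k< lt))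
  ... | tri> _ _ gt = j , ≈-< (b j gt) q , λ k k< → ≈-trans (b k (ℕ.<-trans k< gt)) (c k k<)
  ... | tri≈ _ e _ with Fin.toℕ-injective e
  ...   | refl = i , <-trans p q , λ k k< → ≈-trans (b k k<) (c k k<)
  tri′ : ∀ m (f g : Fin m → A) → LtF m f g ⊎ EqF m f g ⊎ LtF m g f
  tri′ zero    f g = inj₂ (inj₁ λ ())
  tri′ (suc m) f g with tri (f zero) (g zero) | tri′ m (λ i → f (suc i)) (λ i → g (suc i))
  ... | inj₁ p        | _ = inj₁ (zero , p , λ _ ())
  ... | inj₂ (inj₂ p) | _ = inj₂ (inj₂ (zero , p , λ _ ()))
  ... | inj₂ (inj₁ e) | inj₁ (i , p , b) =
        inj₁ (suc i , p , λ { zero _ → e ; (suc j) (s≤s lt) → b j lt })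
  ... | inj₂ (inj₁ e) | inj₂ (inj₂ (i , p , b)) =
        inj₂ (inj₂ (suc i , p , λ { zero _ → ≈-sym e ; (suc j) (s≤s lt) → b j lt }))
  ... | inj₂ (inj₁ e) | inj₂ (inj₁ h) = inj₂ (inj₁ λ { zero → e ; (suc i) → h i })

-- Propositions serve as matrix entries, false below true; the decision that comes with them makes
-- the comparison total.
DecSet : Set₁
DecSet = Σ Set Dec

_⇔ˢ_ _⊏ˢ_ : Set → Set → Set
A ⇔ˢ B = (A → B) × (B → A)
A ⊏ˢ B = ¬ A × B

decSet-order : StrictTotal {DecSet} (λ a b → proj₁ a ⇔ˢ proj₁ b) (λ a b → proj₁ a ⊏ˢ proj₁ b)
decSet-order = record
  { ≈-refl = id , id ; ≈-sym = λ { (f , g) → g , f }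
  ; ≈-trans = λ { (f , g) (h , k) → h ∘ f , g ∘ k }
  ; irr = λ { (_ , g) (¬a , b) → ¬a (g b) }
  ; <-trans = λ { (¬a , b) (¬b , c) → ⊥-elim (¬b b) } ; tri = tri′ }
  where
  tri′ : (a b : DecSet) → proj₁ a ⊏ˢ proj₁ b ⊎ proj₁ a ⇔ˢ proj₁ b ⊎ proj₁ b ⊏ˢ proj₁ a
  tri′ (A , yes a) (B , yes b) = inj₂ (inj₁ (const b , const a))
  tri′ (A , yes a) (B , no ¬b) = inj₂ (inj₂ (¬b , a))
  tri′ (A , no ¬a) (B , yes b) = inj₁ (¬a , b)
  tri′ (A , no ¬a) (B , no ¬b) = inj₂ (inj₁ ((λ a → ⊥-elim (¬a a)) , λ b → ⊥-elim (¬b b)))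

module Matrix (m : ℕ) where

  Mat : Set₁
  Mat = Fin m → Fin m → Set

  RowEq RowLt : (Fin m → Set) → (Fin m → Set) → Set
  RowEq a b = ∀ j → a j ⇔ˢ b j
  RowLt a b = Σ (Fin m) λ j → a j ⊏ˢ b j × (∀ k → toℕ k < toℕ j → a k ⇔ˢ b k)

  MatEq MatLt : Mat → Mat → Set
  MatEq A B = ∀ i → RowEq (A i) (B i)
  MatLt A B = Σ (Fin m) λ i → RowLt (A i) (B i) × (∀ k → toℕ k < toℕ i → RowEq (A k) (B k))

  DecMat : Set₁
  DecMat = Fin m → Fin m → DecSet

  ⌞_⌟ : DecMat → Mat
  ⌞ A ⌟ i j = proj₁ (A i j)

  mat-order : StrictTotal {DecMat} (λ A B → MatEq ⌞ A ⌟ ⌞ B ⌟) (λ A B → MatLt ⌞ A ⌟ ⌞ B ⌟)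
  mat-order = pointwise (pointwise decSet-order m) m

  SizedLt SizedEq : ℕ × DecMat → ℕ × DecMat → Set
  SizedLt (k , A) (l , B) = k < l ⊎ (k ≡ l × MatLt ⌞ A ⌟ ⌞ B ⌟)
  SizedEq (k , A) (l , B) = k ≡ l × MatEq ⌞ A ⌟ ⌞ B ⌟

  sized-order : StrictTotal SizedEq SizedLt
  sized-order = record
    { ≈-refl = λ {x} → refl , ≈-refl {proj₂ x}
    ; ≈-sym = λ {x} {y} h → ≡.sym (proj₁ h) , ≈-sym {proj₂ x} {proj₂ y} (proj₂ h)
    ; ≈-trans = λ {x} {y} {z} h k → trans (proj₁ h) (proj₁ k) ,
        ≈-trans {proj₂ x} {proj₂ y} {proj₂ z} (proj₂ h) (proj₂ k)
    ; irr = λ { h (inj₁ lt) → ℕ.<-irrefl (proj₁ h) lt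
              ; {x} {y} h (inj₂ (_ , lt)) → irr {proj₂ x} {proj₂ y} (proj₂ h) lt }
    ; <-trans = λ { (inj₁ p) (inj₁ q) → inj₁ (ℕ.<-trans p q)
                  ; (inj₁ p) (inj₂ (refl , _)) → inj₁ p
                  ; (inj₂ (refl , _)) (inj₁ q) → inj₁ q
                  ; {x} {y} {z} (inj₂ (refl , p)) (inj₂ (refl , q)) →
                      inj₂ (refl , <-trans {proj₂ x} {proj₂ y} {proj₂ z} p q) }
    ; tri = tri′ }
    where
    open StrictTotal mat-order
    tri′ : ∀ x y → SizedLt x y ⊎ SizedEq x y ⊎ SizedLt y x
    tri′ (k , A) (l , B) with ℕ.<-cmp k l | tri A B
    ... | tri< p _ _ | _             = inj₁ (inj₁ p)
    ... | tri> _ _ p | _             = inj₂ (inj₂ (inj₁ p))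
    ... | tri≈ _ e _ | inj₁ p        = inj₁ (inj₂ (e , p))
    ... | tri≈ _ e _ | inj₂ (inj₁ h) = inj₂ (inj₁ (e , h))
    ... | tri≈ _ e _ | inj₂ (inj₂ p) = inj₂ (inj₂ (inj₂ (≡.sym e , p)))

minimal : ∀ {A : Set} {P : A → Set} {_<ˢ_ : A → A → Set} → (∀ x → Dec (P x)) → (∀ x y → Dec (x <ˢ y)) →
          (∀ {x} → ¬ (x <ˢ x)) → (∀ {x y z} → x <ˢ y → y <ˢ z → x <ˢ z) →
          ∀ xs {x} → x ∈ xs → P x → Σ A λ m → P m × (∀ {y} → y ∈ xs → P y → ¬ (y <ˢ m))
minimal {A} {P} {_<ˢ_} P? _<?_ irr tr xs x∈ p =
  [ (λ none → ⊥-elim (none x∈ p)) , id ]′ (go xs)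
  where
  Min : List A → Set
  Min xs = Σ A λ m → P m × (∀ {y} → y ∈ xs → P y → ¬ (y <ˢ m))
  go : ∀ xs → (∀ {y} → y ∈ xs → ¬ P y) ⊎ Min xs
  go [] = inj₁ λ ()
  go (x ∷ xs) with P? x | go xs
  ... | no ¬p | inj₁ none = inj₁ λ { (here refl) → ¬p ; (there i) → none i }
  ... | no ¬p | inj₂ (m , pm , h) = inj₂ (m , pm , λ { (here refl) q → ⊥-elim (¬p q) ; (there i) → h i })
  ... | yes p | inj₁ none = inj₂ (x , p , λ { (here refl) _ → irr ; (there i) q → ⊥-elim (none i q) })
  ... | yes p | inj₂ (m , pm , h) with x <? m
  ...   | yes lt = inj₂ (x , p , λ { (here refl) _ → irr ; (there i) q y<x → h i q (tr y<x lt) })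
  ...   | no ¬lt = inj₂ (m , pm , λ { (here refl) _ → ¬lt ; (there i) → h i })

-- Assembling the copy of a class from the copies of its children

multiples-< : ∀ {s q q' r} r' → q < q' → r < s → q * s + r < q' * s + r'
multiples-< {s} {q} {q'} r' lt r< = ℕ.<-≤-trans (ℕ.+-monoʳ-< (q * s) r<)
  (ℕ.≤-trans (ℕ.≤-trans (ℕ.≤-reflexive (ℕ.+-comm (q * s) s)) (ℕ.*-monoˡ-≤ s lt))
             (ℕ.m≤m+n (q' * s) r'))

multiples-unique : ∀ {s t t' r r'} → s ∣ t → s ∣ t' → r < s → r' < s →
                   t + r ≡ t' + r' → t ≡ t' × r ≡ r'
multiples-unique {s} {r = r} {r'} (divides q refl) (divides q' refl) r< r'< e with ℕ.<-cmp q q'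
... | tri≈ _ refl _ = refl , ℕ.+-cancelˡ-≡ (q * s) r r' e
... | tri< lt _ _ = ⊥-elim (ℕ.<-irrefl e (multiples-< r' lt r<))
... | tri> _ _ gt = ⊥-elim (ℕ.<-irrefl (≡.sym e) (multiples-< r gt r'<))

module Blocks {n : ℕ} (G : Graph n) (S : Fin n → Set) (S? : ∀ x → Dec (S x))
  (Ch : Fin n → Fin n → Set) (Ch? : ∀ x y → Dec (Ch x y))
  (lt : Fin n → Fin n → Set) (lt? : ∀ x y → Dec (lt x y)) (R : Fin n → Fin (suc n) → Fin (suc n) → Set)
  where

  Tie : Fin n → Fin n → Set
  Tie x y = ¬ lt x y × ¬ lt y x

  Tie? : ∀ x y → Dec (Tie x y)
  Tie? x y = ¬? (lt? x y) ×-dec ¬? (lt? y x)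

  -- In the copy of S, tied children form a block starting at position `before`, in
  -- which each child occupies an interval starting at a multiple of its width.
  before block width : Fin n → ℕ
  before x = # (λ w → S? w ×-dec lt? w x)
  block x  = # (λ w → S? w ×-dec Tie? w x)
  width x  = # (λ w → Ch? x w)

  Pos : Fin n → ℕ → ℕ → ℕ → Set
  Pos x i t r = S x × before x + t + r ≡ i × r < width x × width x ∣ t × t + width x ≤ block x

  -- A position determines `t` and `r`, but the vertex only up to ties: which tied child occupies
  -- which interval is not definable. Positions in one interval are compared through `R`, positions
  -- in different intervals through any admissible vertices. The last conjunct forbids choosing two
  -- different children for the same interval.
  Copy : Fin (suc n) → Fin (suc n) → Set
  Copy i j = Σ (Fin n) λ x → Σ (Fin n) λ y →
    Σ (Fin (suc n)) λ t → Σ (Fin (suc n)) λ t' → Σ (Fin (suc n)) λ r → Σ (Fin (suc n)) λ r' →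
    Pos x (toℕ i) (toℕ t) (toℕ r) × Pos y (toℕ j) (toℕ t') (toℕ r') ×
    ((Ch x y × t ≡ t' × R x r r') ⊎ (¬ Ch x y × E G x y ≡ true × ¬ (Tie x y × t ≡ t')))

-- That `pos` is onto the initial segment follows by counting, since `size` is taken to be the
-- cardinality of `S` throughout.
record IsCopy {n : ℕ} (G : Graph n) (S : Fin n → Set) (size : ℕ) (C : Fin (suc n) → Fin (suc n) → Set) : Set where
  field
    pos  : Fin n → ℕ
    pos< : ∀ {x} → S x → pos x < size
    inj  : ∀ {x y} → S x → S y → pos x ≡ pos y → x ≡ y
    adj  : ∀ {x y} → S x → S y → ∀ {i j} → toℕ i ≡ pos x → toℕ j ≡ pos y → (E G x y ≡ true) ⇔ C i j

module Layout {n : ℕ} (G : Graph n) (S : Fin n → Set) (S? : ∀ x → Dec (S x))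
  (Ch : Fin n → Fin n → Set) (chv : Equiv Ch)
  (lt : Fin n → Fin n → Set) (lt? : ∀ x y → Dec (lt x y)) (R : Fin n → Fin (suc n) → Fin (suc n) → Set)
  where

  open Equiv chv renaming (_≟ᴱ_ to Ch?)
  open Blocks G S S? Ch Ch? lt lt? R

  module Assembly
    (S-Ch : ∀ {x y} → S x → Ch x y → S y)
    (lt-trans : ∀ {x y z} → S x → S y → S z → lt x y → lt y z → lt x z)
    (tie-trans : ∀ {x y z} → S x → S y → S z → Tie x y → Tie y z → Tie x z)
    (ch-tie : ∀ {x y} → S x → Ch x y → Tie x y)
    (tie-width : ∀ {x y} → S x → S y → Tie x y → width x ≡ width y)
    (tie-R : ∀ {x y} → S x → S y → Tie x y → ∀ {i j} → R x i j → R y i j)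
    (modular : ∀ {u v w} → S u → S w → Ch u v → ¬ Ch u w → E G w u ≡ E G w v)
    (types : (Σ Bool λ b → ∀ {x y} → S x → S y → ¬ Ch x y → E G x y ≡ b)
           ⊎ (∀ {x y} → S x → S y → Tie x y → Ch x y))
    (copies : ∀ x → S x → IsCopy G (Ch x) (width x) (R x))
    where

    open Rep chv

    tie-sym : ∀ {x y} → Tie x y → Tie y x
    tie-sym (p , q) = q , p

    lt-tie : ∀ {w x y} → S w → S x → S y → lt w x → Tie x y → lt w y
    lt-tie {w} {x} {y} sw sx sy p t = Dec.decidable-stable (lt? w y) λ ¬wy →
      proj₁ (tie-trans sw sy sx (¬wy , λ yw → proj₂ t (lt-trans sy sw sx yw p)) (tie-sym t)) p

    tie-lt : ∀ {w x y} → S w → S x → S y → Tie w x → lt x y → lt w y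
    tie-lt {w} {x} {y} sw sx sy t p = Dec.decidable-stable (lt? w y) λ ¬wy →
      proj₁ (tie-trans sx sw sy (tie-sym t) (¬wy , λ yw → proj₂ t (lt-trans sx sy sw p yw))) p

    Earlier : ℕ → Fin n → Fin n → Set
    Earlier k x w = (S w × Tie w x) × toℕ (rep w) < k

    Earlier? : ∀ k x w → Dec (Earlier k x w)
    Earlier? k x w = (S? w ×-dec Tie? w x) ×-dec (toℕ (rep w) ℕ.<? k)

    -- Tied children are placed in the order of their representatives. This choice is arbitrary and
    -- lives only in the proof that some embedding exists.
    shift : Fin n → ℕ
    shift x = # (Earlier? (toℕ (rep x)) x)

    -- Raising the threshold by one adds either nothing or one whole child, and a child tied with
    -- `x` has the width of `x`.
    width∣ : ∀ k {x} → S x → width x ∣ # (Earlier? k x)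
    width∣ zero {x} sx = subst (width x ∣_) (≡.sym (#-empty (Earlier? 0 x) λ { (_ , ()) })) (width x ∣0)
    width∣ (suc k) {x} sx = subst (width x ∣_)
      (≡.sym (#-+ (Earlier? (suc k) x) (Earlier? k x) Now?
        (λ { (st , le) → [ (λ l → inj₁ (st , l)) , (λ e → inj₂ (st , e)) ]′ (ℕ.m<1+n⇒m<n∨m≡n le) })
        (λ { (st , l) → st , ℕ.m<n⇒m<1+n l }) (λ { (st , e) → st , s≤s (ℕ.≤-reflexive e) })
        (λ { (_ , l) (_ , e) → ℕ.<-irrefl e l })))
      (∣m∣n⇒∣m+n (width∣ k sx) (now (Fin.any? Now?)))
      where
      Now : Fin n → Set
      Now w = (S w × Tie w x) × toℕ (rep w) ≡ k
      Now? : ∀ w → Dec (Now w)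
      Now? w = (S? w ×-dec Tie? w x) ×-dec (toℕ (rep w) ℕ.≟ k)
      now : Dec (∃ Now) → width x ∣ # Now?
      now (no ¬w) = subst (width x ∣_) (≡.sym (#-empty Now? λ {w} h → ¬w (w , h))) (width x ∣0)
      now (yes (v , (sv , tv) , e)) = subst (width x ∣_)
        (trans (≡.sym (tie-width sv sx tv)) (#-cong {P? = Ch? v} {Now?}
          (λ {w} vw → let sw = S-Ch sv vw in
            (sw , tie-trans sw sv sx (tie-sym (ch-tie sv vw)) tv) ,
                trans (cong toℕ (≡.sym (rep-≡ vw))) e)
          (λ { (_ , e') → rep-inj (Fin.toℕ-injective (trans e (≡.sym e'))) }))) ∣-refl

    shift-width : ∀ {x y} → S x → S y → Tie x y → toℕ (rep x) < toℕ (rep y) → shift x + width x ≤ shift y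
    shift-width {x} {y} sx sy t r< = #-+≤ (Earlier? (toℕ (rep y)) y) (Earlier? (toℕ (rep x)) x) (Ch? x)
      (λ { ((sw , tw) , l) → (sw , tie-trans sw sx sy tw t) , ℕ.<-trans l r< })
      (λ xw → let sw = S-Ch sx xw in
        (sw , tie-trans sw sx sy (tie-sym (ch-tie sx xw)) t) ,
            subst (λ z → toℕ z < toℕ (rep y)) (rep-≡ xw) r<)
      (λ { (_ , l) xw → ℕ.<-irrefl (cong toℕ (≡.sym (rep-≡ xw))) l })

    shift-block : ∀ {x} → S x → shift x + width x ≤ block x
    shift-block {x} sx = #-+≤ (λ w → S? w ×-dec Tie? w x) (Earlier? (toℕ (rep x)) x) (Ch? x)
      proj₁ (λ xw → S-Ch sx xw , tie-sym (ch-tie sx xw))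
      (λ { (_ , l) xw → ℕ.<-irrefl (cong toℕ (≡.sym (rep-≡ xw))) l })

    before-tie : ∀ {x y} → S x → S y → Tie x y → before x ≡ before y
    before-tie {x} {y} sx sy t = #-cong {P? = λ w → S? w ×-dec lt? w x} {λ w → S? w ×-dec lt? w y}
      (λ { (sw , p) → sw , lt-tie sw sx sy p t }) (λ { (sw , p) → sw , lt-tie sw sy sx p (tie-sym t) })

    before-block : ∀ {x y} → S x → S y → lt x y → before x + block x ≤ before y
    before-block {x} {y} sx sy p = #-+≤ (λ w → S? w ×-dec lt? w y) (λ w → S? w ×-dec lt? w x)
        (λ w → S? w ×-dec Tie? w x)
      (λ { (sw , q) → sw , lt-trans sw sx sy q p }) (λ { (sw , t) → sw , tie-lt sw sx sy t p })
      (λ { (_ , q) (_ , t) → proj₁ t q })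

    before-total : ∀ {x} → S x → before x + block x ≤ # S?
    before-total {x} sx = #-+≤ S? (λ w → S? w ×-dec lt? w x) (λ w → S? w ×-dec Tie? w x)
      proj₁ proj₁ (λ { (_ , q) (_ , t) → proj₁ t q })

    module _ (x : Fin n) (sx : S x) where
      open IsCopy (copies x sx) public

    width-Ch : ∀ {x y} → S x → Ch x y → width x ≡ width y
    width-Ch sx xy = tie-width sx (S-Ch sx xy) (ch-tie sx xy)

    -- A child has an embedding only for a given proof of `S v`. Taking the decision as an argument
    -- makes the position a function of the vertex, with the dummy value 0 outside `S`, and lets all
    -- members of a child use the embedding of their representative.
    offsetIn : ∀ v → Dec (S v) → Fin n → ℕ
    offsetIn v (yes s) x = pos v s x
    offsetIn v (no _)  x = 0

    offsetIn< : ∀ {v x} → Ch v x → S v → (d : Dec (S v)) → offsetIn v d x < width v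
    offsetIn< vx _ (yes s)  = pos< _ s vx
    offsetIn< vx s (no ¬s)  = ⊥-elim (¬s s)

    offsetIn-inj : ∀ {v x y} → Ch v x → Ch v y → S v → (d : Dec (S v)) →
                   offsetIn v d x ≡ offsetIn v d y → x ≡ y
    offsetIn-inj vx vy _ (yes s) e = inj _ s vx vy e
    offsetIn-inj vx vy s (no ¬s) e = ⊥-elim (¬s s)

    offsetIn-adj : ∀ {v x y} → Ch v x → Ch v y → S v → (d : Dec (S v)) → ∀ {i j} →
                   toℕ i ≡ offsetIn v d x → toℕ j ≡ offsetIn v d y → (E G x y ≡ true) ⇔ R v i j
    offsetIn-adj vx vy _ (yes s) p q = adj _ s vx vy p q
    offsetIn-adj vx vy s (no ¬s) p q = ⊥-elim (¬s s)

    offset : Fin n → ℕ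
    offset x = offsetIn (rep x) (S? (rep x)) x

    S-rep : ∀ {x} → S x → S (rep x)
    S-rep sx = S-Ch sx (rep-rel _)

    offset-Ch : ∀ {x y} → Ch x y → offset y ≡ offsetIn (rep x) (S? (rep x)) y
    offset-Ch {x} {y} xy = cong (λ v → offsetIn v (S? v) y) (≡.sym (rep-≡ xy))

    offset< : ∀ {x} → S x → offset x < width x
    offset< {x} sx = subst (offset x <_) (≡.sym (width-Ch sx (rep-rel x)))
      (offsetIn< (smm (rep-rel x)) (S-rep sx) (S? (rep x)))

    offset-inj : ∀ {x y} → S x → Ch x y → offset x ≡ offset y → x ≡ y
    offset-inj {x} {y} sx xy e = offsetIn-inj (smm (rep-rel x)) (trn (smm (rep-rel x)) xy)
      (S-rep sx) (S? (rep x)) (trans e (offset-Ch xy))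

    offset-adj : ∀ {x y} → S x → Ch x y → ∀ {i j} → toℕ i ≡ offset x → toℕ j ≡ offset y →
                 (E G x y ≡ true) ⇔ R x i j
    offset-adj {x} {y} sx xy p q = mk⇔
      (λ e → tie-R s sx (tie-sym (ch-tie sx xr)) (to h e)) (λ r → from h (tie-R sx s (ch-tie sx xr) r))
      where
      s = S-rep sx
      xr = rep-rel x
      h = offsetIn-adj (smm xr) (trn (smm xr) xy) s (S? (rep x)) p (trans q (offset-Ch xy))

    place : Fin n → ℕ
    place x = before x + shift x + offset x

    place-Pos : ∀ {x} → S x → Pos x (place x) (shift x) (offset x)
    place-Pos {x} sx = sx , refl , offset< sx , width∣ (toℕ (rep x)) sx , shift-block sx

    pos-below : ∀ {x i t r} → Pos x i t r → i < before x + block x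
    pos-below {x} {i} {t} {r} (sx , refl , r< , _ , fits) =
      subst (_< before x + block x) (≡.sym (ℕ.+-assoc (before x) t r))
        (ℕ.+-monoʳ-< (before x) (ℕ.<-≤-trans (ℕ.+-monoʳ-< t r<) fits))

    pos-above : ∀ {x i t r} → Pos x i t r → before x ≤ i
    pos-above {x} {i} {t} {r} (sx , refl , _) =
        ℕ.≤-trans (ℕ.m≤m+n (before x) t) (ℕ.m≤m+n (before x + t) r)

    -- Different blocks occupy disjoint ranges; inside a block, division with remainder by the
    -- common width recovers interval and offset.
    pos-unique : ∀ {x y i t t' r r'} → Pos x i t r → Pos y i t' r' → Tie x y × t ≡ t' × r ≡ r'
    pos-unique {x} {y} {i} {t} {t'} {r} {r'} p@(sx , e , r< , d , f) q@(sy , e' , r'< , d' , f') =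
      tie , multiples-unique d (subst (_∣ t') (≡.sym w≡) d') r< (subst (r' <_) (≡.sym w≡) r'<)
        (ℕ.+-cancelˡ-≡ (before x) (t + r) (t' + r') (trans (≡.sym (ℕ.+-assoc (before x) t r))
          (trans e (trans (≡.sym e') (trans (cong (λ b → b + t' + r') (≡.sym b≡))
              (ℕ.+-assoc (before x) t' r'))))))
      where
      tie : Tie x y
      tie = (λ xy → ℕ.<-irrefl refl (ℕ.<-≤-trans (pos-below p)
          (ℕ.≤-trans (before-block sx sy xy) (pos-above q))))
          , (λ yx → ℕ.<-irrefl refl (ℕ.<-≤-trans (pos-below q)
              (ℕ.≤-trans (before-block sy sx yx) (pos-above p))))
      w≡ = tie-width sx sy tie
      b≡ = before-tie sx sy tie

    shift-grows : ∀ {x y} → S x → S y → Tie x y → toℕ (rep x) < toℕ (rep y) → shift x < shift y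
    shift-grows {x} sx sy t l =
      ℕ.<-≤-trans (ℕ.m<m+n (shift x) (#-pos (Ch? x) rfl)) (shift-width sx sy t l)

    shift-Ch : ∀ {x y} → S x → S y → Tie x y → shift x ≡ shift y → Ch x y
    shift-Ch {x} {y} sx sy t e with ℕ.<-cmp (toℕ (rep x)) (toℕ (rep y))
    ... | tri≈ _ e' _ = rep-inj (Fin.toℕ-injective e')
    ... | tri< l _ _ = ⊥-elim (ℕ.<-irrefl e (shift-grows sx sy t l))
    ... | tri> _ _ l = ⊥-elim (ℕ.<-irrefl (≡.sym e) (shift-grows sy sx (tie-sym t) l))

    Ch-shift : ∀ {x y} → S x → Ch x y → shift x ≡ shift y
    Ch-shift {x} {y} sx xy = trans
      (#-cong {P? = Earlier? (toℕ (rep x)) x} {Earlier? (toℕ (rep x)) y}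
        (λ { ((sw , t) , l) → (sw , tie-trans sw sx sy t (ch-tie sx xy)) , l })
        (λ { ((sw , t) , l) → (sw , tie-trans sw sy sx t (tie-sym (ch-tie sx xy))) , l }))
      (cong (λ v → # (Earlier? (toℕ v) y)) (rep-≡ xy))
      where sy = S-Ch sx xy

    shift≤n : ∀ x → shift x ≤ n
    shift≤n x = #≤n (Earlier? (toℕ (rep x)) x)

    offset≤n : ∀ {x} → S x → offset x ≤ n
    offset≤n {x} sx = ℕ.≤-trans (ℕ.<⇒≤ (offset< sx)) (#≤n (Ch? x))

    copy : IsCopy G S (# S?) Copy
    copy = record
      { pos = place
      ; pos< = λ sx → ℕ.<-≤-trans (pos-below (place-Pos sx)) (before-total sx)
      ; inj = λ {x} {y} sx sy e →
          let (t , e₁ , e₂) = pos-unique (place-Pos sx) (subst (λ i → Pos y i (shift y) (offset y)) (≡.sym e) (place-Pos sy))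
          in offset-inj sx (shift-Ch sx sy t e₁) e₂
      ; adj = λ {x} {y} sx sy p q → mk⇔ (⇒ sx sy p q) (⇐ sx sy p q) }
      where
      at : ∀ {x} (sx : S x) {i : Fin (suc n)} → toℕ i ≡ place x →
           Pos x (toℕ i) (toℕ (clamp n (shift x))) (toℕ (clamp n (offset x)))
      at {x} sx e = subst₃ (≡.sym e) (≡.sym (toℕ-clamp (shift≤n x))) (≡.sym (toℕ-clamp (offset≤n sx)))
          (place-Pos sx)
        where
        subst₃ : ∀ {i i' t t' r r'} → i ≡ i' → t ≡ t' → r ≡ r' → Pos x i t r → Pos x i' t' r'
        subst₃ refl refl refl p = p
      ⇒ : ∀ {x y} → S x → S y → ∀ {i j} → toℕ i ≡ place x → toℕ j ≡ place y → E G x y ≡ true → Copy i j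
      ⇒ {x} {y} sx sy p q e = x , y , clamp n (shift x) , clamp n (shift y) , clamp n (offset x) ,
          clamp n (offset y) ,
        at sx p , at sy q , alt (Ch? x y)
        where
        alt : Dec (Ch x y) → _
        alt (yes xy) = inj₁ (xy , cong (clamp n) (Ch-shift sx xy) ,
          to (offset-adj sx xy (toℕ-clamp (offset≤n sx)) (toℕ-clamp (offset≤n sy))) e)
        alt (no nxy) = inj₂ (nxy , e , λ { (t , e') → nxy (shift-Ch sx sy t
          (trans (≡.sym (toℕ-clamp (shift≤n x))) (trans (cong toℕ e') (toℕ-clamp (shift≤n y))))) })
      ⇐ : ∀ {u w} → S u → S w → ∀ {i j} → toℕ i ≡ place u → toℕ j ≡ place w → Copy i j → E G u w ≡ true
      ⇐ {u} {w} su sw {i} {j} p q (x , y , t , t' , r , r' , px , py , alt) = go alt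
        where
        sx = proj₁ px
        sy = proj₁ py
        ux = pos-unique px (subst (λ k → Pos u k (shift u) (offset u)) (≡.sym p) (place-Pos su))
        wy = pos-unique py (subst (λ k → Pos w k (shift w) (offset w)) (≡.sym q) (place-Pos sw))
        xu = proj₁ ux
        yw = proj₁ wy
        t≡ = proj₁ (proj₂ ux)
        t'≡ = proj₁ (proj₂ wy)
        go : (Ch x y × t ≡ t' × R x r r') ⊎ (¬ Ch x y × E G x y ≡ true × ¬ (Tie x y × t ≡ t')) →
            E G u w ≡ true
        go (inj₁ (xy , t≡t' , h)) = from (offset-adj su uw (proj₂ (proj₂ ux)) (proj₂ (proj₂ wy)))
            (tie-R sx su xu h)
          where
          uw : Ch u w
          uw = shift-Ch su sw (tie-trans su sx sw (tie-sym xu) (tie-trans sx sy sw (ch-tie sx xy) yw))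
                        (trans (≡.sym t≡) (trans (cong toℕ t≡t') t'≡))
        -- If all pairs between children have one type, the edge from `x` to `y` reveals it;
        -- otherwise ties are children, and `modular` transfers the edge to `u` and `w`.
        go (inj₂ (nxy , e , h)) = [ (λ { (b , all-b) →
            trans (all-b su sw nuw) (trans (≡.sym (all-b sx sy nxy)) e) })
                                  , (λ tie→Ch → exact (tie→Ch sx su xu) (tie→Ch sy sw yw)) ]′ types
          where
          nuw : ¬ Ch u w
          nuw uw = h (tie-trans sx su sy xu (tie-trans su sw sy (ch-tie su uw) (tie-sym yw)) ,
                      Fin.toℕ-injective (trans t≡ (trans (Ch-shift su uw) (≡.sym t'≡))))
          exact : Ch x u → Ch y w → E G u w ≡ true
          exact xu yw = trans (sym G u w) (trans
              (≡.sym (modular sx sw xu (λ xw → nxy (trn xw (smm yw)))))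
            (trans (sym G w x) (trans (≡.sym (modular sy sx yw (λ yx → nxy (smm yx)))) e)))

-- One node of the decomposition tree

-- Intended as an ordered edge followed by an ordered non-edge, one starting pair for each type. The
-- first entry also names the class.
Par : Arity
Par = el ∷ el ∷ el ∷ el ∷ []

decide-by-tri : ∀ {A : Set₁} {_≈_ _<ˢ_ : A → A → Set} → StrictTotal _≈_ _<ˢ_ → ∀ x y → Dec (x <ˢ y)
decide-by-tri st x y with StrictTotal.tri st x y
... | inj₁ p        = yes p
... | inj₂ (inj₁ e) = no (StrictTotal.irr st e)
... | inj₂ (inj₂ q) = no λ p → StrictTotal.irr st (StrictTotal.≈-refl st) (StrictTotal.<-trans st p q)

module Node {n : ℕ} (G : Graph n) (Eq Ch : Fin n → Fin n → Set) (eqv : Equiv Eq) (chv : Equiv Ch)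
  (Force? : ∀ p q → Dec (Forcing.Force G Eq Ch p q)) (R : RelVal n (el ∷ num ∷ num ∷ [])) where

  open Forcing G Eq Ch
  open Equiv eqv using () renaming (_≟ᴱ_ to Eq?)
  open Equiv chv using () renaming (_≟ᴱ_ to Ch?)
  open Matrix (suc n)

  Cross : Fin n → Bool → Fin n → Fin n → Set
  Cross c b x y = Eq c x × Eq c y × ¬ Ch x y × E G x y ≡ b

  Mixed : Fin n → Set
  Mixed c = (b : Bool) → Σ (Fin n) λ x → Σ (Fin n) λ y → Cross c b x y

  Cross? : ∀ c b → Dec (Σ (Fin n) λ x → Σ (Fin n) λ y → Cross c b x y)
  Cross? c b = Fin.any? λ x → Fin.any? λ y → Eq? c x ×-dec Eq? c y ×-dec ¬? (Ch? x y) ×-dec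
      (E G x y Bool.≟ b)

  Mixed? : ∀ c → Dec (Mixed c)
  Mixed? c = Dec.map′ (λ { (t , f) true → t ; (t , f) false → f }) (λ m → m true , m false)
                      (Cross? c true ×-dec Cross? c false)

  Forced : Tuple n Par → Fin n → Fin n → Set
  Forced (a ∷ b ∷ c ∷ d ∷ []) x y = Force (a , b) (x , y) ⊎ Force (c , d) (x , y)

  Forced? : ∀ p x y → Dec (Forced p x y)
  Forced? (a ∷ b ∷ c ∷ d ∷ []) x y = Force? (a , b) (x , y) ⊎-dec Force? (c , d) (x , y)

  width : Fin n → ℕ
  width x = # (λ w → Ch? x w)

  Rel : Fin n → Fin (suc n) → Fin (suc n) → Set
  Rel x i j = R (x ∷ i ∷ j ∷ []) ≡ true

  key : Fin n → ℕ × DecMat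
  key x = width x , λ i j → Rel x i j , (R (x ∷ i ∷ j ∷ []) Bool.≟ true)

  Less : Fin n → Fin n → Set
  Less x y = SizedLt (key x) (key y)

  base : Tuple n Par → Fin n
  base = All.head

  -- Children are sorted by their copies, unless both types of pairs occur between them.
  Lt : Tuple n Par → Fin n → Fin n → Set
  Lt p x y = (Mixed (base p) × Forced p x y) ⊎ (¬ Mixed (base p) × Less x y)

  Lt? : ∀ p x y → Dec (Lt p x y)
  Lt? p x y = (Mixed? (base p) ×-dec Forced? p x y) ⊎-dec
              (¬? (Mixed? (base p)) ×-dec decide-by-tri sized-order (key x) (key y))

  Orders : Tuple n Par → Set
  Orders p = (∀ x y → Eq (base p) x → Eq (base p) y → Forced p x y → ¬ Ch x y)
           × (∀ x y → Eq (base p) x → Eq (base p) y → Ch x y ⊎ Forced p x y ⊎ Forced p y x)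
           × (∀ x y z → Eq (base p) x → Eq (base p) y → Eq (base p) z →
              Forced p x y → Forced p y z → Forced p x z)

  -- In a mixed class any linear order of the children gives a correct copy, whether or not it comes
  -- from a realizer; in all other classes every quadruple passes, as the order there is `Less`.
  Valid : Tuple n Par → Set
  Valid p = Mixed (base p) → Orders p

  Valid? : ∀ p → Dec (Valid p)
  Valid? p = Mixed? (base p) →-dec (
    (Fin.all? λ x → Fin.all? λ y → Eq? (base p) x →-dec
        (Eq? (base p) y →-dec (Forced? p x y →-dec ¬? (Ch? x y))))
    ×-dec (Fin.all? λ x → Fin.all? λ y → Eq? (base p) x →-dec (Eq? (base p) y →-dec
            (Ch? x y ⊎-dec Forced? p x y ⊎-dec Forced? p y x)))
    ×-dec (Fin.all? λ x → Fin.all? λ y → Fin.all? λ z →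
        Eq? (base p) x →-dec (Eq? (base p) y →-dec (Eq? (base p) z →-dec
            (Forced? p x y →-dec (Forced? p y z →-dec Forced? p x z))))))

  module Bl (p : Tuple n Par) = Blocks G (Eq (base p)) (Eq? (base p)) Ch Ch? (Lt p) (Lt? p) Rel

  CopyOf : Tuple n Par → Fin (suc n) → Fin (suc n) → Set
  CopyOf p = Bl.Copy p

  CopyOf? : ∀ p i j → Dec (CopyOf p i j)
  CopyOf? p i j = Fin.any? λ x → Fin.any? λ y → Fin.any? λ t → Fin.any? λ t' → Fin.any? λ r →
      Fin.any? λ r' →
    Pos? x (toℕ i) (toℕ t) (toℕ r) ×-dec Pos? y (toℕ j) (toℕ t') (toℕ r') ×-dec
    ((Ch? x y ×-dec (t Fin.≟ t') ×-dec (R (x ∷ r ∷ r' ∷ []) Bool.≟ true))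
     ⊎-dec (¬? (Ch? x y) ×-dec (E G x y Bool.≟ true) ×-dec ¬? (Bl.Tie? p x y ×-dec (t Fin.≟ t'))))
    where
    Pos? : ∀ x i t r → Dec (Bl.Pos p x i t r)
    Pos? x i t r = Eq? (base p) x ×-dec (Bl.before p x + t + r ℕ.≟ i) ×-dec (r ℕ.<? Bl.width p x)
      ×-dec (Bl.width p x ∣? t) ×-dec (t + Bl.width p x ℕ.≤? Bl.block p x)

  Cand : Fin n → Tuple n Par → Set
  Cand v p = Eq v (base p) × Valid p

  Smaller : Tuple n Par → Tuple n Par → Set
  Smaller p q = MatLt (CopyOf p) (CopyOf q)

  -- Several quadruples can attain the minimum, but their matrices then agree, so the adjacency may
  -- be read from any of them.
  Canon : Fin n → Fin (suc n) → Fin (suc n) → Set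
  Canon v i j = Σ (Tuple n Par) λ p → Cand v p × CopyOf p i j ×
      ¬ (Σ (Tuple n Par) λ q → Cand v q × Smaller q p)

-- Correctness of the copy at one node

record Facts {n : ℕ} (G : Graph n) (Eq Ch : Fin n → Fin n → Set) : Set₁ where
  field
    ch-Eq   : ∀ {u v} → Ch u v → Eq u v
    modular : ∀ {u v w} → Ch u v → Eq u w → ¬ Ch u w → E G w u ≡ E G w v
    prime   : ∀ {c} → ((b : Bool) → Σ (Fin n) λ x → Σ (Fin n) λ y → Eq c x × Eq c y × ¬ Ch x y ×
        E G x y ≡ b) →
              ∀ {x y} → Eq c x → Eq c y → ¬ Ch x y → (X : Fin n → Set) → X x → X y →
              (∀ {w y z} → Eq c w → ¬ X w → X y → X z → E G w y ≡ E G w z) → ∀ {w} → Eq c w → ¬ ¬ X w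

iscopy-resp : ∀ {n} {G : Graph n} {S S' : Fin n → Set} {k k'} {C C' : Fin (suc n) → Fin (suc n) → Set} →
              (∀ {x} → S' x → S x) → k ≡ k' → (∀ {i j} → C i j ⇔ C' i j) → IsCopy G S k C →
                  IsCopy G S' k' C'
iscopy-resp sub refl h I = record
  { pos = pos ; pos< = λ s → pos< (sub s) ; inj = λ s s' → inj (sub s) (sub s')
  ; adj = λ s s' p q → mk⇔ (λ e → to h (to (adj (sub s) (sub s') p q) e))
                           (λ c → from (adj (sub s) (sub s') p q) (from h c)) }
  where open IsCopy I

module NodeCopy {n : ℕ} (G : Graph n) (Eq Ch : Fin n → Fin n → Set) (eqv : Equiv Eq) (chv : Equiv Ch)
  (Force? : ∀ p q → Dec (Forcing.Force G Eq Ch p q)) (R : RelVal n (el ∷ num ∷ num ∷ []))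
  (facts : Facts G Eq Ch) (realizer : Realizer G)
  where

  open Node G Eq Ch eqv chv Force? R

  module Build
    (R-Ch : ∀ {x y} → Ch x y → ∀ {i j} → Rel x i j → Rel y i j)
    (copies : ∀ x → IsCopy G (Ch x) (width x) (Rel x))
    where

    open Facts facts
    open Matrix (suc n)
    open Forcing G Eq Ch
    open Equiv eqv using (rfl; smm; trn) renaming (_≟ᴱ_ to Eq?)
    open Equiv chv using () renaming (rfl to ch-refl; smm to ch-sym; trn to ch-trans; _≟ᴱ_ to Ch?)
    module SO = StrictTotal sized-order
    module MO = StrictTotal mat-order

    module Pure {p : Tuple n Par} (nm : ¬ Mixed (base p)) where

      lt⇒ : ∀ {x y} → Lt p x y → Less x y
      lt⇒ (inj₁ (m , _)) = ⊥-elim (nm m)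
      lt⇒ (inj₂ (_ , l)) = l

      lt⇐ : ∀ {x y} → Less x y → Lt p x y
      lt⇐ l = inj₂ (nm , l)

      tie⇒ : ∀ {x y} → Bl.Tie p x y → SizedEq (key x) (key y)
      tie⇒ {x} {y} (a , b) = [ (λ l → ⊥-elim (a (lt⇐ l))) , [ id , (λ l → ⊥-elim (b (lt⇐ l))) ]′ ]′
        (SO.tri (key x) (key y))

      tie⇐ : ∀ {x y} → SizedEq (key x) (key y) → Bl.Tie p x y
      tie⇐ {x} {y} e = (λ l → SO.irr {key x} {key y} e (lt⇒ l)) ,
                       (λ l → SO.irr {key y} {key x} (SO.≈-sym {key x} {key y} e) (lt⇒ l))

      ch-key : ∀ {x y} → Ch x y → SizedEq (key x) (key y)
      ch-key {x} {y} xy = #-cong {P? = Ch? x} {Ch? y} (ch-trans (ch-sym xy)) (ch-trans xy) ,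
                          λ i j → R-Ch xy , R-Ch (ch-sym xy)

      types : Σ Bool λ b → ∀ {x y} → Eq (base p) x → Eq (base p) y → ¬ Ch x y → E G x y ≡ b
      types = go (Cross? (base p) true)
        where
        go : Dec (Σ (Fin n) λ x → Σ (Fin n) λ y → Cross (base p) true x y) →
             Σ Bool λ b → ∀ {x y} → Eq (base p) x → Eq (base p) y → ¬ Ch x y → E G x y ≡ b
        go (no none)  = false , λ cx cy nc → Bool.¬-not λ e → none (_ , _ , cx , cy , nc , e)
        go (yes some) = true , λ cx cy nc → Bool.¬-not λ e →
            nm λ { true → some ; false → _ , _ , cx , cy , nc , e }

      copy : IsCopy G (Eq (base p)) (# (Eq? (base p))) (CopyOf p)
      copy = Layout.Assembly.copy G (Eq (base p)) (Eq? (base p)) Ch chv (Lt p) (Lt? p) Rel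
        (λ cx xy → trn cx (ch-Eq xy))
        (λ {x} {y} {z} _ _ _ l m → lt⇐ (SO.<-trans {key x} {key y} {key z} (lt⇒ l) (lt⇒ m)))
        (λ {x} {y} {z} _ _ _ t u → tie⇐ (SO.≈-trans {key x} {key y} {key z} (tie⇒ t) (tie⇒ u)))
        (λ _ xy → tie⇐ (ch-key xy))
        (λ _ _ t → proj₁ (tie⇒ t))
        (λ _ _ t {i} {j} → proj₁ (proj₂ (tie⇒ t) i j))
        (λ cu cw uv nuw → modular uv (trn (smm cu) cw) nuw)
        (inj₁ types) (λ x _ → copies x)

    module Sorted {p : Tuple n Par} (m : Mixed (base p)) (o : Orders p) where

      irr′ = proj₁ o
      tri′ = proj₁ (proj₂ o)
      trans′ = proj₂ (proj₂ o)

      lt⇒ : ∀ {x y} → Lt p x y → Forced p x y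
      lt⇒ (inj₁ (_ , f))  = f
      lt⇒ (inj₂ (nm , _)) = ⊥-elim (nm m)

      lt⇐ : ∀ {x y} → Forced p x y → Lt p x y
      lt⇐ f = inj₁ (m , f)

      tie⇒ : ∀ {x y} → Eq (base p) x → Eq (base p) y → Bl.Tie p x y → Ch x y
      tie⇒ cx cy (a , b) = [ id , [ (λ f → ⊥-elim (a (lt⇐ f))) ,
          (λ f → ⊥-elim (b (lt⇐ f))) ]′ ]′ (tri′ _ _ cx cy)

      tie⇐ : ∀ {x y} → Eq (base p) x → Eq (base p) y → Ch x y → Bl.Tie p x y
      tie⇐ cx cy h = (λ l → irr′ _ _ cx cy (lt⇒ l) h) , (λ l → irr′ _ _ cy cx (lt⇒ l) (ch-sym h))

      copy : IsCopy G (Eq (base p)) (# (Eq? (base p))) (CopyOf p)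
      copy = Layout.Assembly.copy G (Eq (base p)) (Eq? (base p)) Ch chv (Lt p) (Lt? p) Rel
        (λ cx xy → trn cx (ch-Eq xy))
        (λ cx cy cz l k → lt⇐ (trans′ _ _ _ cx cy cz (lt⇒ l) (lt⇒ k)))
        (λ cx cy cz t u → tie⇐ cx cz (ch-trans (tie⇒ cx cy t) (tie⇒ cy cz u)))
        (λ cx xy → tie⇐ cx (trn cx (ch-Eq xy)) xy)
        (λ {x} {y} cx cy t → #-cong {P? = Ch? x} {Ch? y} (ch-trans (ch-sym (tie⇒ cx cy t)))
            (ch-trans (tie⇒ cx cy t)))
        (λ cx cy t → R-Ch (tie⇒ cx cy t))
        (λ cu cw uv nuw → modular uv (trn (smm cu) cw) nuw)
        (inj₂ tie⇒) (λ x _ → copies x)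

    valid-copy : ∀ {p} → Valid p → IsCopy G (Eq (base p)) (# (Eq? (base p))) (CopyOf p)
    valid-copy {p} v = go (Mixed? (base p))
      where
      go : Dec (Mixed (base p)) → IsCopy G (Eq (base p)) (# (Eq? (base p))) (CopyOf p)
      go (yes m) = Sorted.copy {p} m (v m)
      go (no nm) = Pure.copy {p} nm

    -- The place where the realizer is used: one pair of each type between children, oriented along
    -- its first order, forces all other pairs of that type to follow this order.
    module Candidate (v : Fin n) (m : Mixed v) where

      module Re = Realized realizer
      module Pr = Prime G Eq Ch eqv chv ch-Eq modular v (prime m)
      module Or = Pr.Ordered (Realizer._<₁_ realizer) Re.O₁.asym Re.O₁.trans Re.total₁ Re.good
      open Or using (_≺_)
      Oriented : Bool → Fin n × Fin n → Set
      Oriented t p = Pr.Cross p × E G (proj₁ p) (proj₂ p) ≡ t × proj₁ p ≺ proj₂ p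
      pick-oriented : ∀ t → Σ (Fin n × Fin n) (Oriented t)
      pick-oriented t = let (x , y , cx , cy , nc , e) = m t in
        [ (λ l → (x , y) , (cx , cy , nc) , e , l)
        , (λ l → (y , x) , (cy , cx , λ h → nc (ch-sym h)) , trans (sym G y x) e , l) ]′ (Or.≺-total nc)
      a = proj₁ (proj₁ (pick-oriented true))
      b = proj₂ (proj₁ (pick-oriented true))
      c = proj₁ (proj₁ (pick-oriented false))
      d = proj₂ (proj₁ (pick-oriented false))
      oab = proj₂ (pick-oriented true)
      ocd = proj₂ (pick-oriented false)
      params : Tuple n Par
      params = a ∷ b ∷ c ∷ d ∷ []
      ordered : ∀ {x y} → Forced params x y → Pr.Cross (x , y) × x ≺ y
      ordered (inj₁ f) = Or.force-order (proj₁ oab) (proj₂ (proj₂ oab)) f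
      ordered (inj₂ f) = Or.force-order (proj₁ ocd) (proj₂ (proj₂ ocd)) f
      forced : ∀ {x y} → Pr.Cross (x , y) → x ≺ y → Forced params x y
      forced {x} {y} cr l = Dec.decidable-stable (Forced? params x y) λ nf → by-type nf (E G x y) refl
        where
        by-type : ¬ Forced params x y → ∀ t → E G x y ≡ t → ⊥
        by-type nf true  e = Or.forced (proj₁ oab) (proj₂ (proj₂ oab)) cr
            (trans (proj₁ (proj₂ oab)) (≡.sym e)) l (λ f → nf (inj₁ f))
        by-type nf false e = Or.forced (proj₁ ocd) (proj₂ (proj₂ ocd)) cr
            (trans (proj₁ (proj₂ ocd)) (≡.sym e)) l (λ f → nf (inj₂ f))
      va = proj₁ (proj₁ oab)
      irr′ : ∀ x y → Eq a x → Eq a y → Forced params x y → ¬ Ch x y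
      irr′ x y _ _ f = proj₂ (proj₂ (proj₁ (ordered f)))
      tri′ : ∀ x y → Eq a x → Eq a y → Ch x y ⊎ Forced params x y ⊎ Forced params y x
      tri′ x y ax ay = go (Ch? x y)
        where
        go : Dec (Ch x y) → Ch x y ⊎ Forced params x y ⊎ Forced params y x
        go (yes h) = inj₁ h
        go (no nc) = inj₂ ([ (λ l → inj₁ (forced (trn va ax , trn va ay , nc) l))
                           , (λ l → inj₂ (forced (trn va ay , trn va ax , λ h → nc (ch-sym h)) l)) ]′
                               (Or.≺-total nc))
      trans′ : ∀ x y z → Eq a x → Eq a y → Eq a z → Forced params x y → Forced params y z →
          Forced params x z
      trans′ x y z ax ay az f g = forced (trn va ax , trn va az , nc) xz
        where
        xy = proj₂ (ordered f)
        yz = proj₂ (ordered g)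
        xz : x ≺ z
        xz = Re.O₁.trans xy yz
        nc : ¬ Ch x z
        nc h = Re.O₁.irrefl (Rep.rep-≡ chv h) xz

    candidate : ∀ v → Σ (Tuple n Par) (Cand v)
    candidate v = go (Mixed? v)
      where
      go : Dec (Mixed v) → Σ (Tuple n Par) (Cand v)
      go (no nm) = (v ∷ v ∷ v ∷ v ∷ []) , rfl , λ m → ⊥-elim (nm m)
      go (yes m) = params , proj₁ (proj₁ oab) , λ _ → irr′ , tri′ , trans′
        where open Candidate v m

    mat : Tuple n Par → DecMat
    mat p i j = CopyOf p i j , CopyOf? p i j

    opaque
      best : ∀ v → Σ (Tuple n Par) λ p → Cand v p × (∀ {q} → q ∈ tuples n Par → Cand v q → ¬ Smaller q p)
      best v = let (p , c) = candidate v in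
        minimal {P = Cand v} {Smaller} (λ p → Eq? v (base p) ×-dec Valid? p)
          (λ p q → decide-by-tri mat-order (mat p) (mat q))
          (λ {p} → MO.irr {mat p} {mat p} (MO.≈-refl {mat p}))
          (λ {p} {q} {r} → MO.<-trans {mat p} {mat q} {mat r}) (tuples n Par) (∈-tuples p) c

    canon⇔ : ∀ v {i j} → CopyOf (proj₁ (best v)) i j ⇔ Canon v i j
    canon⇔ v {i} {j} = mk⇔
      (λ c → p , cp , c , λ { (q , cq , s) → least (∈-tuples q) cq s })
      (λ { (q , cq , c , h) → same q cq h c })
      where
      p = proj₁ (best v)
      cp = proj₁ (proj₂ (best v))
      least = proj₂ (proj₂ (best v))
      same : ∀ q → Cand v q → ¬ (Σ (Tuple n Par) λ q' → Cand v q' × Smaller q' q) → CopyOf q i j →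
          CopyOf p i j
      same q cq h c = [ (λ s → ⊥-elim (h (p , cp , s)))
                      , [ (λ e → proj₂ (e i j) c) , (λ s → ⊥-elim (least (∈-tuples q) cq s)) ]′ ]′
                          (MO.tri (mat p) (mat q))

    canon-copy : ∀ v → IsCopy G (Eq v) (# (Eq? v)) (Canon v)
    canon-copy v = iscopy-resp (trn (smm va))
        (#-cong {P? = Eq? (base p)} {Eq? v} (trn va) (trn (smm va)))
      (canon⇔ v) (valid-copy {p} (proj₂ (proj₁ (proj₂ (best v)))))
      where
      p = proj₁ (best v)
      va = proj₁ (proj₁ (proj₂ (best v)))

    canon-Eq : ∀ {v w} → Eq v w → ∀ {i j} → Canon v i j → Canon w i j
    canon-Eq vw (p , (vp , valid) , c , h) = p , (trn (smm vw) vp , valid) , c ,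
      λ { (q , (wq , vq) , s) → h (q , (trn vw wq , vq) , s) }

-- Addition and divisibility through reachability

star-clamp : ∀ {n} {A : Set} {T : A → A → Set} (f : ℕ → A) (m : ℕ) →
    (∀ {k} → k < m → T (f k) (f (suc k))) →
             m ≤ n → Star T (f 0) (f m)
star-clamp f zero    h _ = ε
star-clamp {n} f (suc m) h le =
  star-clamp {n} f m (λ k<m → h (ℕ.m<n⇒m<1+n k<m)) (ℕ.≤-trans (ℕ.n≤1+n m) le) ◅◅ (h ℕ.≤-refl ◅ ε)

-- The number sort offers only its order, so addition is a walk from `(0 , x)` to `(y , z)` by
-- simultaneous successors. A sum beyond the largest number is not represented.
addᴰ : ∀ {Δ} → D (num ∷ num ∷ num ∷ []) Δ
addᴰ = ∃ᴰ num (zeroᴰ v0 ∧ᴰ tc₂ num num (succᴰ v0 v2 ∧ᴰ succᴰ v1 v3) v0 v1 v2 v3)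
  as (λ { G (x ∷ y ∷ z ∷ []) σ → toℕ x + toℕ y ≡ toℕ z }) by λ { {n} G (x ∷ y ∷ z ∷ []) σ → mk⇔
    (λ { (o , o≡0 , p) → ≡.sym (star-inv (λ q → toℕ (proj₂ q) ≡ toℕ x + toℕ (proj₁ q))
        (λ { (e , e') h → trans e' (trans (cong suc h)
            (trans (≡.sym (ℕ.+-suc (toℕ x) _)) (cong (toℕ x +_) (≡.sym e)))) })
        (trans (≡.sym (ℕ.+-identityʳ (toℕ x))) (cong (toℕ x +_) (≡.sym o≡0))) p) })
    (λ e → zero , refl , climb n x y z e) }
  where
  climb : ∀ n (x y z : Fin (suc n)) → toℕ x + toℕ y ≡ toℕ z →
          Star {I = Fin (suc n) × Fin (suc n)}
               (λ p q → toℕ (proj₁ q) ≡ suc (toℕ (proj₁ p)) × toℕ (proj₂ q) ≡ suc (toℕ (proj₂ p)))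
               (zero , x) (y , z)
  climb n x y z e = subst₂ (Star _) (cong₂ _,_ refl
      (trans (cong (clamp n) (ℕ.+-identityʳ (toℕ x))) (clamp-toℕ x)))
      (cong₂ _,_ (clamp-toℕ y) (trans (cong (clamp n) e) (clamp-toℕ z)))
      (star-clamp {n} (λ k → clamp n k , clamp n (toℕ x + k)) (toℕ y) rise (Fin.toℕ≤pred[n] y))
    where
    open ≡ using (subst₂)
    rise : ∀ {k} → k < toℕ y → toℕ (clamp n (suc k)) ≡ suc (toℕ (clamp n k)) ×
                               toℕ (clamp n (toℕ x + suc k)) ≡ suc (toℕ (clamp n (toℕ x + k)))
    rise {k} k<y = trans (toℕ-clamp k<n) (cong suc (≡.sym (toℕ-clamp (ℕ.<⇒≤ k<n)))) ,
      trans (toℕ-clamp xk<n) (trans (ℕ.+-suc (toℕ x) k)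
        (cong suc (≡.sym (toℕ-clamp (ℕ.≤-trans (ℕ.+-monoʳ-≤ (toℕ x) (ℕ.n≤1+n k)) xk<n)))))
      where
      k<n : suc k ≤ n
      k<n = ℕ.≤-trans k<y (Fin.toℕ≤pred[n] y)
      xk<n : toℕ x + suc k ≤ n
      xk<n = ℕ.≤-trans (ℕ.+-monoʳ-≤ (toℕ x) k<y) (ℕ.≤-trans (ℕ.≤-reflexive e) (Fin.toℕ≤pred[n] z))

-- The multiples of `s` are what repeated addition of `s` reaches from 0.
dividesᴰ : ∀ {Δ} → D (num ∷ num ∷ []) Δ
dividesᴰ = ∃ᴰ num (zeroᴰ v0 ∧ᴰ tc₁ num (call 5 (v0 ∷ v3 ∷ v1 ∷ []) [] addᴰ) v0 v2)
  as (λ { G (s ∷ t ∷ []) σ → toℕ s ∣ toℕ t }) by λ { {n} G (s ∷ t ∷ []) σ → mk⇔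
    (λ { (o , o≡0 , p) → star-inv (λ a → toℕ s ∣ toℕ a)
        (λ e h → subst (toℕ s ∣_) e (∣m∣n⇒∣m+n h ∣-refl)) (subst (toℕ s ∣_) (≡.sym o≡0) (toℕ s ∣0)) p })
    (λ d → zero , refl , climb n s t d) }
  where
  climb : ∀ n (s t : Fin (suc n)) → toℕ s ∣ toℕ t →
          Star {I = Fin (suc n)} (λ a b → toℕ a + toℕ s ≡ toℕ b) zero t
  climb n s t (divides q e) = subst (Star _ zero) (trans (cong (clamp n) (≡.sym e)) (clamp-toℕ t))
      (star-clamp {q} (λ k → clamp n (k * toℕ s)) q rise ℕ.≤-refl)
    where
    rise : ∀ {k} → k < q → toℕ (clamp n (k * toℕ s)) + toℕ s ≡ toℕ (clamp n (suc k * toℕ s))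
    rise {k} k<q = trans (cong (_+ toℕ s) (toℕ-clamp (ℕ.≤-trans (ℕ.m≤n+m (k * toℕ s) (toℕ s)) le)))
      (trans (ℕ.+-comm (k * toℕ s) (toℕ s)) (≡.sym (toℕ-clamp le)))
      where
      le : suc k * toℕ s ≤ n
      le = ℕ.≤-trans (ℕ.*-monoˡ-≤ (toℕ s) k<q) (ℕ.≤-trans (ℕ.≤-reflexive (≡.sym e)) (Fin.toℕ≤pred[n] t))

-- The levels of the decomposition, as the complements of definable relations

ee : Arity
ee = el ∷ el ∷ []

-- A loop starts from the empty relation, and the decomposition from a single class; hence the loop
-- stores inequivalence.
EqR : ∀ {n} → RelVal n ee → Fin n → Fin n → Set
EqR R u v = ¬ (R (u ∷ v ∷ []) ≡ true)

typeᴰ : ∀ {Γ Δ} → Bool → el ∈ Γ → el ∈ Γ → D Γ Δ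
typeᴰ true  x y = edgeᴰ x y
typeᴰ false x y = (¬ᴰ edgeᴰ x y) as (λ G ρ σ → E G (lookup ρ x) (lookup ρ y) ≡ false) by λ G ρ σ →
  mk⇔ (λ h → Bool.¬-not h) (λ e e' → Bool.not-¬ e e')

type-sem : ∀ {Γ Δ} b (x y : el ∈ Γ) {n} (G : Graph n) ρ (σ : REnv n Δ) →
           sem (typeᴰ {Δ = Δ} b x y) G ρ σ ⇔ (E G (lookup ρ x) (lookup ρ y) ≡ b)
type-sem true  x y G ρ σ = mk⇔ id id
type-sem false x y G ρ σ = mk⇔ id id

same-typeᴰ : ∀ {Δ} → D (el ∷ el ∷ el ∷ el ∷ []) Δ
same-typeᴰ = ((edgeᴰ v0 v1 ∧ᴰ edgeᴰ v2 v3) ∨ᴰ (¬ᴰ edgeᴰ v0 v1 ∧ᴰ ¬ᴰ edgeᴰ v2 v3))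
  as (λ { G (x ∷ y ∷ z ∷ w ∷ []) σ → E G x y ≡ E G z w }) by λ { G (x ∷ y ∷ z ∷ w ∷ []) σ →
    mk⇔ (λ { (inj₁ (p , q)) → trans p (≡.sym q) ; (inj₂ (p , q)) → ≢-≢⇒≡ p q })
        (split (E G x y) (E G z w)) }
  where
  split : ∀ b c → b ≡ c → (b ≡ true × c ≡ true) ⊎ (¬ (b ≡ true) × ¬ (c ≡ true))
  split true  true  refl = inj₁ (refl , refl)
  split false false refl = inj₂ ((λ ()) , (λ ()))

connᴰ : Bool → D (el ∷ el ∷ []) (ee ∷ [])
connᴰ b = tc₁ el (¬ᴰ relᴰ (here refl) (v0 ∷ v1 ∷ []) ∧ᴰ
                  (typeᴰ b v0 v1 as (λ G ρ σ → E G (lookup ρ v0) (lookup ρ v1) ≡ b) by type-sem b v0 v1))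
                      v0 v1
  as (λ { G (u ∷ v ∷ []) (R ∷ []) → Split.Conn G (EqR R) b u v }) by
      λ { G (u ∷ v ∷ []) (R ∷ []) → mk⇔ id id }

discᴰ : Bool → D (el ∷ []) (ee ∷ [])
discᴰ b = ∃ᴰ el (∃ᴰ el (¬ᴰ relᴰ (here refl) (v2 ∷ v1 ∷ []) ∧ᴰ ¬ᴰ relᴰ (here refl) (v2 ∷ v0 ∷ [])
                        ∧ᴰ ¬ᴰ call 3 (v1 ∷ v0 ∷ []) (here refl ∷ []) (connᴰ b)))
  as (λ { G (u ∷ []) (R ∷ []) → Split.Disc G (EqR R) b u }) by λ { G (u ∷ []) (R ∷ []) → mk⇔ id id }

memᴰ : D (el ∷ el ∷ el ∷ []) (ee ∷ [])
memᴰ = (eqᴰ v2 v0 ∨ᴰ tc₁ el (¬ᴰ relᴰ (here refl) (v2 ∷ v1 ∷ [])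
                            ∧ᴰ ¬ᴰ call 5 (v1 ∷ v0 ∷ v1 ∷ v2 ∷ []) [] same-typeᴰ) v1 v2)
  as (λ { G (u ∷ v ∷ x ∷ []) (R ∷ []) → Split.Mem G (EqR R) u v x }) by
      λ { G (u ∷ v ∷ x ∷ []) (R ∷ []) → mk⇔ id id }

fullᴰ : D (el ∷ el ∷ []) (ee ∷ [])
fullᴰ = ∀ᴰ el (¬ᴰ relᴰ (here refl) (v1 ∷ v0 ∷ []) ⇒ᴰ call 3 (v1 ∷ v2 ∷ v0 ∷ []) (here refl ∷ []) memᴰ)
  as (λ { G (u ∷ v ∷ []) (R ∷ []) → Split.Full G (EqR R) u v }) by
      λ { G (u ∷ v ∷ []) (R ∷ []) → mk⇔ id id }

splitᴰ : D (num ∷ num ∷ ee) (ee ∷ [])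
splitᴰ = (¬ᴰ (¬ᴰ relᴰ (here refl) (v2 ∷ v3 ∷ [])
   ∧ᴰ (disc true ⇒ᴰ conn true)
   ∧ᴰ (¬ᴰ disc true ⇒ᴰ disc false ⇒ᴰ conn false)
   ∧ᴰ (¬ᴰ disc true ⇒ᴰ ¬ᴰ disc false ⇒ᴰ eqᴰ v2 v3 ∨ᴰ ¬ᴰ call 4 (v2 ∷ v3 ∷ []) (here refl ∷ []) fullᴰ)))
  as (λ { G (_ ∷ _ ∷ u ∷ v ∷ []) (R ∷ []) → ¬ Split.Child G (EqR R) u v }) by
     λ { G (_ ∷ _ ∷ u ∷ v ∷ []) (R ∷ []) → mk⇔ id id }
  where
  disc conn : Bool → D (num ∷ num ∷ ee) (ee ∷ [])
  disc b = call 4 (v2 ∷ []) (here refl ∷ []) (discᴰ b)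
  conn b = call 4 (v2 ∷ v3 ∷ []) (here refl ∷ []) (connᴰ b)

module Levels = Loop {ee} splitᴰ

module _ {n : ℕ} (G : Graph n) where

  Apart : ℕ → RelVal n ee
  Apart = Levels.stage G

  Level : ℕ → Fin n → Fin n → Set
  Level k = EqR (Apart k)

  Level? : ∀ k u v → Dec (Level k u v)
  Level? k u v = ¬? (Apart k (u ∷ v ∷ []) Bool.≟ true)

  Conn? : ∀ k b u v → Dec (Split.Conn G (Level k) b u v)
  Conn? k b u v = sem? (connᴰ b) G (u ∷ v ∷ []) (Apart k ∷ [])

  Mem? : ∀ k u v x → Dec (Split.Mem G (Level k) u v x)
  Mem? k u v x = sem? memᴰ G (u ∷ v ∷ x ∷ []) (Apart k ∷ [])

  apart-suc : ∀ k {u v} → (Apart (suc k) (u ∷ v ∷ []) ≡ true) ⇔ (¬ Split.Child G (Level k) u v)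
  apart-suc k {u} {v} = ok splitᴰ G (clamp n k ∷ clamp n (suc k) ∷ u ∷ v ∷ []) (Apart k ∷ [])

  module Next (k : ℕ) (e : Equiv (Level k)) where

    module P = Partition G (Level k) e (Conn? k) (Mem? k)
    open Equiv P.child-equiv

    level⇔ : ∀ u v → Level (suc k) u v ⇔ Split.Child G (Level k) u v
    level⇔ u v = mk⇔
      (λ l → Dec.decidable-stable (P.Child? u v) λ nc → l (from (apart-suc k {u} {v}) nc))
      (λ c a → to (apart-suc k {u} {v}) a c)

    next : Equiv (Level (suc k))
    next = record
      { rfl = λ {u} → from (level⇔ u u) rfl
      ; smm = λ {u} {v} l → from (level⇔ v u) (smm (to (level⇔ u v) l))
      ; trn = λ {u} {v} {w} l m → from (level⇔ u w) (trn (to (level⇔ u v) l) (to (level⇔ v w) m))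
      ; _≟ᴱ_ = Level? (suc k) }

  level-equiv : ∀ k → Equiv (Level k)
  level-equiv zero    = record { rfl = λ () ; smm = λ _ () ; trn = λ _ _ () ; _≟ᴱ_ = Level? zero }
  level-equiv (suc k) = Next.next k (level-equiv k)

  level-suc : ∀ k u v → Level (suc k) u v ⇔ Split.Child G (Level k) u v
  level-suc k = Next.level⇔ k (level-equiv k)

  level-facts : ∀ k → Facts G (Level k) (Level (suc k))
  level-facts k = record
    { ch-Eq = λ {u} {v} h → proj₁ (to (level-suc k u v) h)
    ; modular = λ {u} {v} {w} uv uw nuw →
        P.modular {u} {v} {w} (to (level-suc k u v) uv) uw (λ h → nuw (from (level-suc k u w) h))
    ; prime = λ {c} m {x} {y} cx cy nc → P.mixed-prime {c}
        (λ b → let (x , y , cx , cy , nc , e) = m b in x , y , cx , cy , (λ h → nc (from (level-suc k x y) h)) , e)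
        {x} {y} cx cy (λ h → nc (from (level-suc k x y) h)) }
    where module P = Partition G (Level k) (level-equiv k) (Conn? k) (Mem? k)

  -- As long as the class of `u` has a second vertex, the next level removes at least one vertex
  -- from it by `progress`; after `n` levels only `u` can be left.
  shrink : ∀ k u → # (Level? k u) + k ≤ n ⊎ (∀ {v} → Level k u v → u ≡ v)
  shrink zero    u = inj₁ (ℕ.≤-trans (ℕ.≤-reflexive (ℕ.+-identityʳ _)) (#≤n (Level? 0 u)))
  shrink (suc k) u = [ (λ le → decide le (Fin.any? λ v → Level? k u v ×-dec ¬? (u Fin.≟ v)))
                     , (λ single → inj₂ λ l → single (down l)) ]′ (shrink k u)
    where
    module P = Partition G (Level k) (level-equiv k) (Conn? k) (Mem? k)
    down : ∀ {v} → Level (suc k) u v → Level k u v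
    down {v} l = proj₁ (to (level-suc k u v) l)
    decide : # (Level? k u) + k ≤ n → Dec (Σ (Fin n) λ v → Level k u v × u ≢ v) →
             # (Level? (suc k) u) + suc k ≤ n ⊎ (∀ {v} → Level (suc k) u v → u ≡ v)
    decide le (no none) = inj₂ λ {v} l → Dec.decidable-stable (u Fin.≟ v) λ ne → none (v , down l , ne)
    decide le (yes (v , uv , ne)) = inj₁ (ℕ.≤-trans (ℕ.≤-reflexive (ℕ.+-suc _ k))
        (ℕ.≤-trans (ℕ.+-monoˡ-≤ k smaller) le))
      where
      w = proj₁ (P.progress uv ne)
      uw = proj₁ (proj₂ (P.progress uv ne))
      nuw = proj₂ (proj₂ (P.progress uv ne))
      smaller : suc (# (Level? (suc k) u)) ≤ # (Level? k u)
      smaller = ℕ.≤-trans (ℕ.≤-trans (ℕ.≤-reflexive (ℕ.+-comm 1 _))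
          (ℕ.+-monoʳ-≤ (# (Level? (suc k) u)) (#-pos (λ x → x Fin.≟ w) refl)))
        (#-+≤ (Level? k u) (Level? (suc k) u) (λ x → x Fin.≟ w) down (λ { refl → uw })
          (λ { l refl → nuw (to (level-suc k u w) l) }))

  level-last : ∀ {u v} → Level n u v → u ≡ v
  level-last {u} = [ (λ le → ⊥-elim (ℕ.<-irrefl refl (ℕ.<-≤-trans
      (ℕ.+-monoˡ-< n (#-pos (Level? n u) (Equiv.rfl (level-equiv n)))) le))) ,
          (λ single → single) ]′ (shrink n u)

-- The canonical copies are definable

enn : Arity
enn = el ∷ num ∷ num ∷ []

tt′ : Ctx
tt′ = num ∷ num ∷ []

level-≡ : ∀ {n} (G : Graph n) (k l : ℕ) u v → k ≡ l → Level G k u v → Level G l u v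
level-≡ G k .k u v refl h = h

-- Copies are built from the leaves upwards while levels are counted from the root, hence the
-- reversed index. The difference is expressed by addition, with the largest number standing for
-- `n`.
levelᴰ : D (num ∷ el ∷ el ∷ []) []
levelᴰ = ∃ᴰ num (∃ᴰ num (∀ᴰ num (leᴰ v0 v2) ∧ᴰ call 5 (v0 ∷ v2 ∷ v1 ∷ []) [] addᴰ
                         ∧ᴰ ¬ᴰ call 5 (v0 ∷ v3 ∷ v4 ∷ []) [] Levels.loopᴰ))
  as (λ { {n} G (t ∷ u ∷ v ∷ []) σ → Level G (n ∸ toℕ t) u v }) by
      λ { G (t ∷ u ∷ v ∷ []) σ → conv G t u v }
  where
  conv : ∀ {n} (G : Graph n) (t : Fin (suc n)) u v →
    (Σ (Fin (suc n)) λ m → Σ (Fin (suc n)) λ d →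
       ((k : Fin (suc n)) → toℕ k ≤ toℕ m) × toℕ d + toℕ t ≡ toℕ m × Level G (toℕ d) u v)
    ⇔ Level G (n ∸ toℕ t) u v
  conv {n} G t u v = mk⇔
    (λ { (m , d , top , e , l) → level-≡ G (toℕ d) (n ∸ toℕ t) u v
        (trans (≡.sym (ℕ.m+n∸n≡m (toℕ d) (toℕ t)))
      (cong (_∸ toℕ t) (trans e (ℕ.≤-antisym (Fin.toℕ≤pred[n] m)
        (ℕ.≤-trans (ℕ.≤-reflexive (≡.sym top≡)) (top (clamp n n))))))) l })
    (λ l → clamp n n , clamp n (n ∸ toℕ t) ,
      (λ k → ℕ.≤-trans (Fin.toℕ≤pred[n] k) (ℕ.≤-reflexive (≡.sym top≡))) ,
      trans (cong (_+ toℕ t) d≡) (trans (ℕ.m∸n+n≡m (Fin.toℕ≤pred[n] t)) (≡.sym top≡)) ,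
      level-≡ G (n ∸ toℕ t) (toℕ (clamp n (n ∸ toℕ t))) u v (≡.sym d≡) l)
    where
    top≡ : toℕ (clamp n n) ≡ n
    top≡ = toℕ-clamp {n} {n} ℕ.≤-refl
    d≡ : toℕ (clamp n (n ∸ toℕ t)) ≡ n ∸ toℕ t
    d≡ = toℕ-clamp (ℕ.m∸n≤m n (toℕ t))

-- In a context ending in t , t′ the node is a class of level n − t′ and its
-- children are classes of level n − t.
Eqₙ Chₙ : ∀ {n} → Graph n → Fin (suc n) → Fin (suc n) → Fin n → Fin n → Set
Eqₙ {n} G t t' = Level G (n ∸ toℕ t')
Chₙ {n} G t t' = Level G (n ∸ toℕ t)

classᴰ childᴰ : ∀ {Δ} → D (el ∷ el ∷ tt′) Δ
classᴰ = call 4 (v3 ∷ v0 ∷ v1 ∷ []) [] levelᴰ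
  as (λ { G (u ∷ v ∷ t ∷ t' ∷ []) σ → Eqₙ G t t' u v }) by λ { G (u ∷ v ∷ t ∷ t' ∷ []) σ → mk⇔ id id }
childᴰ = call 4 (v2 ∷ v0 ∷ v1 ∷ []) [] levelᴰ
  as (λ { G (u ∷ v ∷ t ∷ t' ∷ []) σ → Chₙ G t t' u v }) by λ { G (u ∷ v ∷ t ∷ t' ∷ []) σ → mk⇔ id id }

flipᴰ : D (el ∷ el ∷ el ∷ tt′) []
flipᴰ = (call 3 (v0 ∷ v2 ∷ []) [] classᴰ ∧ᴰ (call 3 (v1 ∷ v2 ∷ []) [] childᴰ ∨ᴰ
          (call 5 (v0 ∷ v1 ∷ v0 ∷ v2 ∷ []) [] same-typeᴰ ∧ᴰ ¬ᴰ call 5 (v1 ∷ v2 ∷ v0 ∷ v1 ∷ []) []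
              same-typeᴰ)))
  as (λ { G (y ∷ x ∷ z ∷ t ∷ t' ∷ []) σ → Forcing.Flip G (Eqₙ G t t') (Chₙ G t t') y x z }) by
     λ { G (y ∷ x ∷ z ∷ t ∷ t' ∷ []) σ → mk⇔ id id }

fstepᴰ : D (el ∷ el ∷ el ∷ el ∷ tt′) []
fstepᴰ = ((eqᴰ v0 v2 ∧ᴰ call 4 (v0 ∷ v1 ∷ v3 ∷ []) [] flipᴰ) ∨ᴰ
    (eqᴰ v1 v3 ∧ᴰ call 4 (v1 ∷ v0 ∷ v2 ∷ []) [] flipᴰ))
  as (λ { G (a ∷ b ∷ x ∷ y ∷ t ∷ t' ∷ []) σ →
      Forcing.FStep G (Eqₙ G t t') (Chₙ G t t') (a , b) (x , y) }) by
     λ { G (a ∷ b ∷ x ∷ y ∷ t ∷ t' ∷ []) σ → mk⇔ id id }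

forceᴰ : D (el ∷ el ∷ el ∷ el ∷ tt′) []
forceᴰ = tc₂ el el (call 8 (v0 ∷ v1 ∷ v2 ∷ v3 ∷ []) [] fstepᴰ) v0 v1 v2 v3
  as (λ { G (a ∷ b ∷ x ∷ y ∷ t ∷ t' ∷ []) σ →
      Forcing.Force G (Eqₙ G t t') (Chₙ G t t') (a , b) (x , y) }) by
     λ { G (a ∷ b ∷ x ∷ y ∷ t ∷ t' ∷ []) σ → mk⇔ id id }

module Nd {n : ℕ} (G : Graph n) (t t' : Fin (suc n)) (R : RelVal n enn) =
  Node G (Eqₙ G t t') (Chₙ G t t') (level-equiv G (n ∸ toℕ t')) (level-equiv G (n ∸ toℕ t))
       (λ p q → sem? forceᴰ G (proj₁ p ∷ proj₂ p ∷ proj₁ q ∷ proj₂ q ∷ t ∷ t' ∷ []) []) R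

crossᴰ : Bool → D (el ∷ tt′) (enn ∷ [])
crossᴰ b = ∃ᴰ el (∃ᴰ el (call 3 (v2 ∷ v1 ∷ []) [] classᴰ ∧ᴰ call 3 (v2 ∷ v0 ∷ []) [] classᴰ ∧ᴰ
             ¬ᴰ call 3 (v1 ∷ v0 ∷ []) [] childᴰ ∧ᴰ
             (typeᴰ b v1 v0 as (λ G ρ σ → E G (lookup ρ v1) (lookup ρ v0) ≡ b) by type-sem b v1 v0)))
  as (λ { {n} G (c ∷ t ∷ t' ∷ []) (R ∷ []) → Σ (Fin n) λ x → Σ (Fin n) λ y → Nd.Cross G t t' R c b x y })
      by
     λ { G (c ∷ t ∷ t' ∷ []) (R ∷ []) → mk⇔ id id }

mixedᴰ : D (el ∷ tt′) (enn ∷ [])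
mixedᴰ = (crossᴰ true ∧ᴰ crossᴰ false)
  as (λ { G (c ∷ t ∷ t' ∷ []) (R ∷ []) → Nd.Mixed G t t' R c }) by
     λ { G (c ∷ t ∷ t' ∷ []) (R ∷ []) → mk⇔ (λ { (p , q) true → p ; (p , q) false → q })
         (λ m → m true , m false) }

rs : All (_∈ (enn ∷ [])) (enn ∷ [])
rs = here refl ∷ []

forcedᴰ : D (el ∷ el ∷ Par ++ tt′) (enn ∷ [])
forcedᴰ = (call 6 (v2 ∷ v3 ∷ v0 ∷ v1 ∷ []) [] forceᴰ ∨ᴰ call 6 (v4 ∷ v5 ∷ v0 ∷ v1 ∷ []) [] forceᴰ)
  as (λ { G (x ∷ y ∷ a ∷ b ∷ c ∷ d ∷ t ∷ t' ∷ []) (R ∷ []) →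
      Nd.Forced G t t' R (a ∷ b ∷ c ∷ d ∷ []) x y }) by
     λ { G (x ∷ y ∷ a ∷ b ∷ c ∷ d ∷ t ∷ t' ∷ []) (R ∷ []) → mk⇔ id id }

widthᴰ : D (el ∷ num ∷ tt′) (enn ∷ [])
widthᴰ = countᴰ (call 3 (v1 ∷ v0 ∷ []) [] childᴰ) v1
  as (λ { G (x ∷ k ∷ t ∷ t' ∷ []) (R ∷ []) → toℕ k ≡ Nd.width G t t' R x }) by
     λ { {n} G (x ∷ k ∷ t ∷ t' ∷ []) (R ∷ []) →
         #-counts (Equiv._≟ᴱ_ (level-equiv G (n ∸ toℕ t)) x) (toℕ k) }

ltᴰ : ∀ {Γ Δ} → num ∈ Γ → num ∈ Γ → D Γ Δ
ltᴰ x y = (¬ᴰ leᴰ y x) as (λ G ρ σ → toℕ (lookup ρ x) < toℕ (lookup ρ y)) by λ G ρ σ → mk⇔ ℕ.≰⇒> ℕ.<⇒≱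

lexᴰ : ∀ {Γ b} → D (num ∷ num ∷ Γ) (b ∷ []) → D (num ∷ num ∷ Γ) (b ∷ []) → D Γ (b ∷ [])
lexᴰ {Γ} {b} A B = ∃ᴰ num (
    ∃ᴰ num ((¬ᴰ call 2 (v1 ∷ v0 ∷ []) (here refl ∷ []) A ∧ᴰ call 2 (v1 ∷ v0 ∷ []) (here refl ∷ []) B)
      ∧ᴰ ∀ᴰ num (ltᴰ v0 v1 ⇒ᴰ same (call 3 (v2 ∷ v0 ∷ []) (here refl ∷ []) A)
          (call 3 (v2 ∷ v0 ∷ []) (here refl ∷ []) B)))
    ∧ᴰ ∀ᴰ num (ltᴰ v0 v1 ⇒ᴰ ∀ᴰ num (same (call 3 (v1 ∷ v0 ∷ []) (here refl ∷ []) A)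
        (call 3 (v1 ∷ v0 ∷ []) (here refl ∷ []) B))))
  as (λ { {n} G ρ (R ∷ []) → Matrix.MatLt (suc n) (λ i j → sem A G (i ∷ j ∷ ρ) (R ∷ []))
                                                  (λ i j → sem B G (i ∷ j ∷ ρ) (R ∷ [])) }) by
     λ { G ρ (R ∷ []) → mk⇔ id id }
  where
  same : ∀ {Γ} → D Γ (b ∷ []) → D Γ (b ∷ []) → D Γ (b ∷ [])
  same A B = (A ⇒ᴰ B) ∧ᴰ (B ⇒ᴰ A)

lessᴰ : D (el ∷ el ∷ tt′) (enn ∷ [])
lessᴰ = ∃ᴰ num (∃ᴰ num (call 4 (v2 ∷ v1 ∷ []) rs widthᴰ ∧ᴰ call 4 (v3 ∷ v0 ∷ []) rs widthᴰ ∧ᴰ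
          (ltᴰ v1 v0 ∨ᴰ (eqᴰ v1 v0 ∧ᴰ lexᴰ (relᴰ (here refl) (v4 ∷ v0 ∷ v1 ∷ []))
              (relᴰ (here refl) (v5 ∷ v0 ∷ v1 ∷ []))))))
  as (λ { G (x ∷ y ∷ t ∷ t' ∷ []) (R ∷ []) → Nd.Less G t t' R x y }) by
     λ { {n} G (x ∷ y ∷ t ∷ t' ∷ []) (R ∷ []) → conv G t t' R x y }
  where
  conv : ∀ {n} (G : Graph n) t t' R x y →
         (Σ (Fin (suc n)) λ k → Σ (Fin (suc n)) λ l → toℕ k ≡ Nd.width G t t' R x × toℕ l ≡
             Nd.width G t t' R y ×
          (toℕ k < toℕ l ⊎ (k ≡ l × Matrix.MatLt (suc n) (Nd.Rel G t t' R x) (Nd.Rel G t t' R y))))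
         ⇔ Nd.Less G t t' R x y
  conv {n} G t t' R x y = mk⇔
    (λ { (k , l , e , e' , inj₁ lt) → inj₁ (≡.subst₂ _<_ e e' lt)
       ; (k , l , e , e' , inj₂ (k≡l , m)) → inj₂ (trans (≡.sym e) (trans (cong toℕ k≡l) e') , m) })
    (λ { (inj₁ lt) → clamp n (w x) , clamp n (w y) , cl x , cl y ,
        inj₁ (≡.subst₂ _<_ (≡.sym (cl x)) (≡.sym (cl y)) lt)
       ; (inj₂ (e , m)) → clamp n (w x) , clamp n (w y) , cl x , cl y , inj₂ (cong (clamp n) e , m) })
    where
    w = Nd.width G t t' R
    cl : ∀ x → toℕ (clamp n (w x)) ≡ w x
    cl x = toℕ-clamp (#≤n (Equiv._≟ᴱ_ (level-equiv G (n ∸ toℕ t)) x))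

childLtᴰ : D (el ∷ el ∷ Par ++ tt′) (enn ∷ [])
childLtᴰ = ((call 6 (v2 ∷ []) rs mixedᴰ ∧ᴰ forcedᴰ) ∨ᴰ
    (¬ᴰ call 6 (v2 ∷ []) rs mixedᴰ ∧ᴰ call 6 (v0 ∷ v1 ∷ []) rs lessᴰ))
  as (λ { G (x ∷ y ∷ a ∷ b ∷ c ∷ d ∷ t ∷ t' ∷ []) (R ∷ []) → Nd.Lt G t t' R (a ∷ b ∷ c ∷ d ∷ []) x y })
      by
     λ { G (x ∷ y ∷ a ∷ b ∷ c ∷ d ∷ t ∷ t' ∷ []) (R ∷ []) → mk⇔ id id }

validᴰ : D (Par ++ tt′) (enn ∷ [])
validᴰ = (call 4 (v0 ∷ []) rs mixedᴰ ⇒ᴰ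
   (∀ᴰ el (∀ᴰ el (call 6 (v2 ∷ v1 ∷ []) [] classᴰ ⇒ᴰ call 6 (v2 ∷ v0 ∷ []) [] classᴰ ⇒ᴰ
      call 2 (v1 ∷ v0 ∷ []) rs forcedᴰ ⇒ᴰ ¬ᴰ call 6 (v1 ∷ v0 ∷ []) [] childᴰ))
    ∧ᴰ ∀ᴰ el (∀ᴰ el (call 6 (v2 ∷ v1 ∷ []) [] classᴰ ⇒ᴰ call 6 (v2 ∷ v0 ∷ []) [] classᴰ ⇒ᴰ
      call 6 (v1 ∷ v0 ∷ []) [] childᴰ ∨ᴰ call 2 (v1 ∷ v0 ∷ []) rs forcedᴰ ∨ᴰ call 2 (v0 ∷ v1 ∷ []) rs
          forcedᴰ))
    ∧ᴰ ∀ᴰ el (∀ᴰ el (∀ᴰ el (call 7 (v3 ∷ v2 ∷ []) [] classᴰ ⇒ᴰ call 7 (v3 ∷ v1 ∷ []) [] classᴰ ⇒ᴰ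
      call 7 (v3 ∷ v0 ∷ []) [] classᴰ ⇒ᴰ call 3 (v2 ∷ v1 ∷ []) rs forcedᴰ ⇒ᴰ call 3 (v1 ∷ v0 ∷ []) rs
          forcedᴰ ⇒ᴰ
      call 3 (v2 ∷ v0 ∷ []) rs forcedᴰ)))))
  as (λ { G (a ∷ b ∷ c ∷ d ∷ t ∷ t' ∷ []) (R ∷ []) → Nd.Valid G t t' R (a ∷ b ∷ c ∷ d ∷ []) }) by
     λ { G (a ∷ b ∷ c ∷ d ∷ t ∷ t' ∷ []) (R ∷ []) → mk⇔ id id }

-- Opaque, because comparing the decision procedures inside these by unfolding is infeasible.
opaque
  beforeₙ blockₙ : ∀ {n} → Graph n → (t t' : Fin (suc n)) → RelVal n enn → Tuple n Par → Fin n → ℕ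
  beforeₙ G t t' R p x = Nd.Bl.before G t t' R p x
  blockₙ  G t t' R p x = Nd.Bl.block G t t' R p x

  widthₙ : ∀ {n} → Graph n → (t t' : Fin (suc n)) → RelVal n enn → Fin n → ℕ
  widthₙ G t t' R x = Nd.width G t t' R x

  before-counts : ∀ {n} (G : Graph n) t t' R a b c d x k →
    Counts (λ w → Eqₙ G t t' a w × Nd.Lt G t t' R (a ∷ b ∷ c ∷ d ∷ []) w x) k ⇔
        (k ≡ beforeₙ G t t' R (a ∷ b ∷ c ∷ d ∷ []) x)
  before-counts {n} G t t' R a b c d x k = #-counts
    (λ w → Equiv._≟ᴱ_ (level-equiv G (n ∸ toℕ t')) a w ×-dec Nd.Lt? G t t' R (a ∷ b ∷ c ∷ d ∷ []) w x) k

  block-counts : ∀ {n} (G : Graph n) t t' R a b c d x k →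
    Counts (λ w → Eqₙ G t t' a w × Nd.Bl.Tie G t t' R (a ∷ b ∷ c ∷ d ∷ []) w x) k ⇔
        (k ≡ blockₙ G t t' R (a ∷ b ∷ c ∷ d ∷ []) x)
  block-counts {n} G t t' R a b c d x k = #-counts
    (λ w → Equiv._≟ᴱ_ (level-equiv G (n ∸ toℕ t')) a w ×-dec Nd.Bl.Tie? G t t' R (a ∷ b ∷ c ∷ d ∷ []) w
        x) k

  width-counts : ∀ {n} (G : Graph n) t t' R x k → Counts (Chₙ G t t' x) k ⇔ (k ≡ widthₙ G t t' R x)
  width-counts {n} G t t' R x k = #-counts (Equiv._≟ᴱ_ (level-equiv G (n ∸ toℕ t)) x) k

  block≤n : ∀ {n} (G : Graph n) t t' R a b c d x → blockₙ G t t' R (a ∷ b ∷ c ∷ d ∷ []) x ≤ n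
  block≤n {n} G t t' R a b c d x = #≤n
    (λ w → Equiv._≟ᴱ_ (level-equiv G (n ∸ toℕ t')) a w ×-dec Nd.Bl.Tie? G t t' R (a ∷ b ∷ c ∷ d ∷ []) w
        x)

  Posₙ : ∀ {n} → Graph n → (t t' : Fin (suc n)) → RelVal n enn → Tuple n Par → Fin n → ℕ → ℕ → ℕ → Set
  Posₙ G t t' R p x i τ r = Nd.Bl.Pos G t t' R p x i τ r

  pos⇔ : ∀ {n} (G : Graph n) t t' R p x i τ r →
    (Eqₙ G t t' (All.head p) x × beforeₙ G t t' R p x + τ + r ≡ i ×
     r < widthₙ G t t' R x × widthₙ G t t' R x ∣ τ × τ + widthₙ G t t' R x ≤ blockₙ G t t' R p x)
    ⇔ Posₙ G t t' R p x i τ r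
  pos⇔ G t t' R p x i τ r = mk⇔ id id

beforeᴰ blockᴰ : D (el ∷ num ∷ Par ++ tt′) (enn ∷ [])
beforeᴰ = countᴰ (call 7 (v3 ∷ v0 ∷ []) [] classᴰ ∧ᴰ call 3 (v0 ∷ v1 ∷ []) rs childLtᴰ) v1
  as (λ { G (x ∷ k ∷ a ∷ b ∷ c ∷ d ∷ t ∷ t' ∷ []) (R ∷ []) → toℕ k ≡
      beforeₙ G t t' R (a ∷ b ∷ c ∷ d ∷ []) x }) by
     λ { G (x ∷ k ∷ a ∷ b ∷ c ∷ d ∷ t ∷ t' ∷ []) (R ∷ []) → before-counts G t t' R a b c d x (toℕ k) }
blockᴰ = countᴰ (call 7 (v3 ∷ v0 ∷ []) [] classᴰ ∧ᴰ
                 ¬ᴰ call 3 (v0 ∷ v1 ∷ []) rs childLtᴰ ∧ᴰ ¬ᴰ call 3 (v1 ∷ v0 ∷ []) rs childLtᴰ) v1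
  as (λ { G (x ∷ k ∷ a ∷ b ∷ c ∷ d ∷ t ∷ t' ∷ []) (R ∷ []) → toℕ k ≡
      blockₙ G t t' R (a ∷ b ∷ c ∷ d ∷ []) x }) by
     λ { G (x ∷ k ∷ a ∷ b ∷ c ∷ d ∷ t ∷ t' ∷ []) (R ∷ []) → block-counts G t t' R a b c d x (toℕ k) }

childWidthᴰ : D (el ∷ num ∷ tt′) (enn ∷ [])
childWidthᴰ = countᴰ (call 3 (v1 ∷ v0 ∷ []) [] childᴰ) v1
  as (λ { G (x ∷ k ∷ t ∷ t' ∷ []) (R ∷ []) → toℕ k ≡ widthₙ G t t' R x }) by
     λ { G (x ∷ k ∷ t ∷ t' ∷ []) (R ∷ []) → width-counts G t t' R x (toℕ k) }

startᴰ fitᴰ : D (el ∷ num ∷ num ∷ num ∷ Par ++ tt′) (enn ∷ [])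
startᴰ = ∃ᴰ num (call 5 (v1 ∷ v0 ∷ []) rs beforeᴰ ∧ᴰ
           ∃ᴰ num (call 12 (v1 ∷ v4 ∷ v0 ∷ []) [] addᴰ ∧ᴰ call 12 (v0 ∷ v5 ∷ v3 ∷ []) [] addᴰ))
  as (λ { G (x ∷ i ∷ τ ∷ r ∷ a ∷ b ∷ c ∷ d ∷ t ∷ t' ∷ []) (R ∷ []) →
          beforeₙ G t t' R (a ∷ b ∷ c ∷ d ∷ []) x + toℕ τ + toℕ r ≡ toℕ i }) by
     λ { {n} G (x ∷ i ∷ τ ∷ r ∷ a ∷ b ∷ c ∷ d ∷ t ∷ t' ∷ []) (R ∷ []) →
         conv n (beforeₙ G t t' R (a ∷ b ∷ c ∷ d ∷ []) x) i τ r }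
  where
  conv : ∀ n (o : ℕ) (i τ r : Fin (suc n)) →
    (Σ (Fin (suc n)) λ k → toℕ k ≡ o × Σ (Fin (suc n)) λ m → toℕ k + toℕ τ ≡ toℕ m × toℕ m + toℕ r ≡
        toℕ i)
    ⇔ (o + toℕ τ + toℕ r ≡ toℕ i)
  conv n o i τ r = mk⇔
    (λ { (k , k≡ , m , e , e') → trans (cong (λ z → z + toℕ τ + toℕ r) (≡.sym k≡))
        (trans (cong (_+ toℕ r) e) e') })
    -- Every partial sum is at most `i`, hence an element of the number sort.
    λ e → let m≤ : o + toℕ τ ≤ n
              m≤ = ℕ.≤-trans (ℕ.≤-trans (ℕ.m≤m+n (o + toℕ τ) (toℕ r)) (ℕ.≤-reflexive e))
                  (Fin.toℕ≤pred[n] i)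
              o≤ = toℕ-clamp {n} {o} (ℕ.≤-trans (ℕ.m≤m+n o (toℕ τ)) m≤) in
      clamp n o , o≤ , clamp n (o + toℕ τ) , trans (cong (_+ toℕ τ) o≤) (≡.sym (toℕ-clamp m≤)) ,
      trans (cong (_+ toℕ r) (toℕ-clamp m≤)) e
fitᴰ = ∃ᴰ num (call 5 (v1 ∷ v0 ∷ []) rs blockᴰ ∧ᴰ ∃ᴰ num (call 10 (v2 ∷ v0 ∷ []) rs childWidthᴰ ∧ᴰ
         ltᴰ v5 v0 ∧ᴰ call 12 (v0 ∷ v4 ∷ []) [] dividesᴰ ∧ᴰ
         ∃ᴰ num (call 13 (v5 ∷ v1 ∷ v0 ∷ []) [] addᴰ ∧ᴰ leᴰ v0 v2)))
  as (λ { G (x ∷ i ∷ τ ∷ r ∷ a ∷ b ∷ c ∷ d ∷ t ∷ t' ∷ []) (R ∷ []) →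
          toℕ r < widthₙ G t t' R x × widthₙ G t t' R x ∣ toℕ τ ×
          toℕ τ + widthₙ G t t' R x ≤ blockₙ G t t' R (a ∷ b ∷ c ∷ d ∷ []) x }) by
     λ { {n} G (x ∷ i ∷ τ ∷ r ∷ a ∷ b ∷ c ∷ d ∷ t ∷ t' ∷ []) (R ∷ []) →
         conv n (widthₙ G t t' R x) (blockₙ G t t' R (a ∷ b ∷ c ∷ d ∷ []) x)
                (block≤n G t t' R a b c d x)
                τ r }
  where
  conv : ∀ n (s b : ℕ) → b ≤ n → (τ r : Fin (suc n)) →
    (Σ (Fin (suc n)) λ l → toℕ l ≡ b × Σ (Fin (suc n)) λ k → toℕ k ≡ s × toℕ r < toℕ k × toℕ k ∣ toℕ τ ×
            Σ (Fin (suc n)) λ m → toℕ τ + toℕ k ≡ toℕ m × toℕ m ≤ toℕ l)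
    ⇔ (toℕ r < s × s ∣ toℕ τ × toℕ τ + s ≤ b)
  conv n s b b≤ τ r = mk⇔
    (λ { (l , refl , k , refl , r< , d , m , e , le) → r< , d , ℕ.≤-trans (ℕ.≤-reflexive e) le })
    (λ { (r< , d , le) →
         -- The bound by `b` puts the sum and the width into the number sort.
         let m≤ = ℕ.≤-trans le b≤
             cs = toℕ-clamp {n} {s} (ℕ.≤-trans (ℕ.m≤n+m s (toℕ τ)) m≤) in
         clamp n b , toℕ-clamp b≤ , clamp n s , cs , ℕ.≤-trans r< (ℕ.≤-reflexive (≡.sym cs)) ,
         subst (_∣ toℕ τ) (≡.sym cs) d , clamp n (toℕ τ + s) ,
         trans (cong (toℕ τ +_) cs) (≡.sym (toℕ-clamp m≤)) ,
         ℕ.≤-trans (ℕ.≤-reflexive (toℕ-clamp m≤)) (ℕ.≤-trans le (ℕ.≤-reflexive (≡.sym (toℕ-clamp b≤))))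
             })

posᴰ : D (el ∷ num ∷ num ∷ num ∷ Par ++ tt′) (enn ∷ [])
posᴰ = (call 8 (v4 ∷ v0 ∷ []) [] classᴰ ∧ᴰ startᴰ ∧ᴰ fitᴰ)
  as (λ { G (x ∷ i ∷ τ ∷ r ∷ a ∷ b ∷ c ∷ d ∷ t ∷ t' ∷ []) (R ∷ []) →
          Posₙ G t t' R (a ∷ b ∷ c ∷ d ∷ []) x (toℕ i) (toℕ τ) (toℕ r) }) by
     λ { G (x ∷ i ∷ τ ∷ r ∷ a ∷ b ∷ c ∷ d ∷ t ∷ t' ∷ []) (R ∷ []) →
         pos⇔ G t t' R (a ∷ b ∷ c ∷ d ∷ []) x (toℕ i) (toℕ τ) (toℕ r) }

opaque
  unfolding Posₙ

  CopyOfₙ : ∀ {n} → Graph n → (t t' : Fin (suc n)) → RelVal n enn → Tuple n Par → Fin (suc n) →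
      Fin (suc n) → Set
  CopyOfₙ G t t' R p i j = Nd.CopyOf G t t' R p i j

  copy⇔ : ∀ {n} (G : Graph n) t t' R p i j →
    (Σ (Fin n) λ x → Σ (Fin n) λ y →
     Σ (Fin (suc n)) λ τ → Σ (Fin (suc n)) λ τ' → Σ (Fin (suc n)) λ r → Σ (Fin (suc n)) λ r' →
     Posₙ G t t' R p x (toℕ i) (toℕ τ) (toℕ r) × Posₙ G t t' R p y (toℕ j) (toℕ τ') (toℕ r') ×
     ((Chₙ G t t' x y × τ ≡ τ' × R (x ∷ r ∷ r' ∷ []) ≡ true) ⊎
      (¬ Chₙ G t t' x y × E G x y ≡ true ×
       ¬ ((¬ Nd.Lt G t t' R p x y × ¬ Nd.Lt G t t' R p y x) × τ ≡ τ'))))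
    ⇔ CopyOfₙ G t t' R p i j
  copy⇔ G t t' R p i j = mk⇔ id id

copyᴰ : D (num ∷ num ∷ Par ++ tt′) (enn ∷ [])
copyᴰ = ∃ᴰ el (∃ᴰ el (∃ᴰ num (∃ᴰ num (∃ᴰ num (∃ᴰ num (
    call 8 (v5 ∷ there v5 ∷ v3 ∷ v1 ∷ []) rs posᴰ ∧ᴰ
    call 8 (v4 ∷ there (there v5) ∷ v2 ∷ v0 ∷ []) rs posᴰ ∧ᴰ
    ((call 12 (v5 ∷ v4 ∷ []) [] childᴰ ∧ᴰ eqᴰ v3 v2 ∧ᴰ relᴰ (here refl) (v5 ∷ v1 ∷ v0 ∷ [])) ∨ᴰ
     (¬ᴰ call 12 (v5 ∷ v4 ∷ []) [] childᴰ ∧ᴰ edgeᴰ v5 v4 ∧ᴰ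
      ¬ᴰ ((¬ᴰ call 8 (v5 ∷ v4 ∷ []) rs childLtᴰ ∧ᴰ ¬ᴰ call 8 (v4 ∷ v5 ∷ []) rs childLtᴰ) ∧ᴰ eqᴰ v3
          v2)))))))))
  as (λ { G (i ∷ j ∷ a ∷ b ∷ c ∷ d ∷ t ∷ t' ∷ []) (R ∷ []) → CopyOfₙ G t t' R (a ∷ b ∷ c ∷ d ∷ []) i j })
      by
     λ { G (i ∷ j ∷ a ∷ b ∷ c ∷ d ∷ t ∷ t' ∷ []) (R ∷ []) → copy⇔ G t t' R (a ∷ b ∷ c ∷ d ∷ []) i j }

opaque
  Candₙ : ∀ {n} → Graph n → (t t' : Fin (suc n)) → RelVal n enn → Fin n → Tuple n Par → Set
  Candₙ G t t' R v p = Nd.Cand G t t' R v p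

  cand⇔ : ∀ {n} (G : Graph n) t t' R v p → (Eqₙ G t t' v (All.head p) × Nd.Valid G t t' R p) ⇔
      Candₙ G t t' R v p
  cand⇔ G t t' R v p = mk⇔ id id

candᴰ : D (el ∷ Par ++ tt′) (enn ∷ [])
candᴰ = (call 5 (v0 ∷ v1 ∷ []) [] classᴰ ∧ᴰ call 1 [] rs validᴰ)
  as (λ { G (v ∷ a ∷ b ∷ c ∷ d ∷ t ∷ t' ∷ []) (R ∷ []) → Candₙ G t t' R v (a ∷ b ∷ c ∷ d ∷ []) }) by
     λ { G (v ∷ a ∷ b ∷ c ∷ d ∷ t ∷ t' ∷ []) (R ∷ []) → cand⇔ G t t' R v (a ∷ b ∷ c ∷ d ∷ []) }

Smallerₙ : ∀ {n} → Graph n → (t t' : Fin (suc n)) → RelVal n enn → Tuple n Par → Tuple n Par → Set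
Smallerₙ {n} G t t' R p q = Matrix.MatLt (suc n) (CopyOfₙ G t t' R p) (CopyOfₙ G t t' R q)

opaque
  unfolding CopyOfₙ Candₙ

  Canonₙ : ∀ {n} → Graph n → (t t' : Fin (suc n)) → RelVal n enn → Fin n → Fin (suc n) → Fin (suc n) →
      Set
  Canonₙ G t t' R v i j = Nd.Canon G t t' R v i j

  canonₙ⇔ : ∀ {n} (G : Graph n) t t' R v i j →
    (Σ (Fin n) λ a → Σ (Fin n) λ b → Σ (Fin n) λ c → Σ (Fin n) λ d → let p = a ∷ b ∷ c ∷ d ∷ [] in
      Candₙ G t t' R v p × CopyOfₙ G t t' R p i j ×
      ¬ (Σ (Fin n) λ a' → Σ (Fin n) λ b' → Σ (Fin n) λ c' → Σ (Fin n) λ d' → let q = a' ∷ b' ∷ c' ∷ d' ∷ [] in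
          Candₙ G t t' R v q × Smallerₙ G t t' R q p)) ⇔ Canonₙ G t t' R v i j
  canonₙ⇔ G t t' R v i j = mk⇔
    (λ { (a , b , c , d , cd , k , l) → (a ∷ b ∷ c ∷ d ∷ []) , cd , k ,
         λ { (a' ∷ b' ∷ c' ∷ d' ∷ [] , h) → l (a' , b' , c' , d' , h) } })
    (λ { (a ∷ b ∷ c ∷ d ∷ [] , cd , k , l) → a , b , c , d , cd , k ,
         λ { (a' , b' , c' , d' , h) → l ((a' ∷ b' ∷ c' ∷ d' ∷ []) , h) } })

smallerᴰ : D (Par ++ Par ++ tt′) (enn ∷ [])
smallerᴰ = lexᴰ (call 10 (v0 ∷ v1 ∷ v2 ∷ v3 ∷ v4 ∷ v5 ∷ []) rs copyᴰ) (call 6 (v0 ∷ v1 ∷ []) rs copyᴰ)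
  as (λ { G (a ∷ b ∷ c ∷ d ∷ a' ∷ b' ∷ c' ∷ d' ∷ t ∷ t' ∷ []) (R ∷ []) →
          Smallerₙ G t t' R (a ∷ b ∷ c ∷ d ∷ []) (a' ∷ b' ∷ c' ∷ d' ∷ []) }) by
     λ { G (a ∷ b ∷ c ∷ d ∷ a' ∷ b' ∷ c' ∷ d' ∷ t ∷ t' ∷ []) (R ∷ []) → mk⇔ id id }

canonᴰ : D (el ∷ num ∷ num ∷ tt′) (enn ∷ [])
canonᴰ = ∃ᴰ el (∃ᴰ el (∃ᴰ el (∃ᴰ el (call 7 (v4 ∷ v3 ∷ v2 ∷ v1 ∷ v0 ∷ []) rs candᴰ
    ∧ᴰ call 7 (v5 ∷ there v5 ∷ v3 ∷ v2 ∷ v1 ∷ v0 ∷ []) rs copyᴰ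
    ∧ᴰ ¬ᴰ ∃ᴰ el (∃ᴰ el (∃ᴰ el (∃ᴰ el (call 11 (there (there (there v5)) ∷ v3 ∷ v2 ∷ v1 ∷ v0 ∷ []) rs
        candᴰ
         ∧ᴰ call 11 (v3 ∷ v2 ∷ v1 ∷ v0 ∷ there (there v5) ∷ there v5 ∷ v5 ∷ v4 ∷ []) rs smallerᴰ))))))))
  as (λ { G (v ∷ i ∷ j ∷ t ∷ t' ∷ []) (R ∷ []) → Canonₙ G t t' R v i j }) by
     λ { G (v ∷ i ∷ j ∷ t ∷ t' ∷ []) (R ∷ []) → canonₙ⇔ G t t' R v i j }

opaque
  unfolding Canonₙ

  canonₙ-def : ∀ {n} (G : Graph n) t t' R v i j → Nd.Canon G t t' R v i j ⇔ Canonₙ G t t' R v i j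
  canonₙ-def G t t' R v i j = mk⇔ id id

canonStepᴰ : D (num ∷ num ∷ enn) (enn ∷ [])
canonStepᴰ = call 5 (v2 ∷ v3 ∷ v4 ∷ v0 ∷ v1 ∷ []) rs canonᴰ
  as (λ { G (t ∷ t' ∷ v ∷ i ∷ j ∷ []) (R ∷ []) → Canonₙ G t t' R v i j }) by
     λ { G (t ∷ t' ∷ v ∷ i ∷ j ∷ []) (R ∷ []) → mk⇔ id id }

module Canons = Loop {enn} canonStepᴰ

-- Correctness of the stages of copies

module _ {n : ℕ} (G : Graph n) where

  Copies : ℕ → RelVal n enn
  Copies = Canons.stage G

  CopyAt : Fin (suc n) → Fin n → Fin (suc n) → Fin (suc n) → Set
  CopyAt t v i j = Copies (toℕ t) (v ∷ i ∷ j ∷ []) ≡ true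

  Class : Fin (suc n) → Fin n → Fin n → Set
  Class t = Level G (n ∸ toℕ t)

  class-size : Fin (suc n) → Fin n → ℕ
  class-size t v = # (λ w → Equiv._≟ᴱ_ (level-equiv G (n ∸ toℕ t)) v w)

  -- The copy depends on the class and not on the vertex naming it; sorting children by their copies
  -- rests on this.
  Invariant : Fin (suc n) → Set
  Invariant t = ∀ v w → Class t v w → ∀ i j → CopyAt t v i j → CopyAt t w i j

  AllCopies : Fin (suc n) → Set
  AllCopies t = ∀ v → IsCopy G (Class t v) (class-size t v) (CopyAt t v)

  copies-suc : ∀ (t t' : Fin (suc n)) → toℕ t' ≡ suc (toℕ t) → ∀ v i j →
               Nd.Canon G t t' (Copies (toℕ t)) v i j ⇔ CopyAt t' v i j
  copies-suc t t' e v i j = mk⇔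
    (λ c → trans eq′ (from okᶜ (to def c))) (λ s → from def (to okᶜ (trans (≡.sym eq′) s)))
    where
    def = canonₙ-def G t t' (Copies (toℕ t)) v i j
    okᶜ = ok canonStepᴰ G (t ∷ t' ∷ v ∷ i ∷ j ∷ []) (Copies (toℕ t) ∷ [])
    eq′ = Canons.stage-suc G [] {t} {t'} e {v ∷ i ∷ j ∷ []}

  -- Level `n` consists of singletons, and the empty relation of stage 0 is the adjacency of a
  -- single vertex, which has no loop.
  correct-zero : Invariant zero × AllCopies zero
  correct-zero = (λ _ _ _ _ _ ()) , λ v → record
      { pos = λ _ → 0 ; pos< = λ _ → #-pos (Equiv._≟ᴱ_ (level-equiv G n) v)
          (Equiv.rfl (level-equiv G n) {v})
      ; inj = λ {x} {y} p q _ → trans (≡.sym (level-last G {v} {x} p)) (level-last G {v} {y} q)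
      ; adj = λ {x} {y} p q _ _ → mk⇔
          (λ e → ⊥-elim (Bool.not-¬ e (trans (cong (E G x)
              (trans (≡.sym (level-last G {v} {y} q)) (level-last G {v} {x} p))) (irref G x))))
          (λ ()) }

  correct-suc : Realizer G → ∀ t t' → toℕ t' ≡ suc (toℕ t) →
                Invariant t → AllCopies t → Invariant t' × AllCopies t'
  correct-suc real t t' e invariant isCopy =
      (λ v w vw i j s → to (copies-suc t t' e w i j)
        (N.canon-Eq {v} {w} vw {i} {j} (from (copies-suc t t' e v i j) s)))
    , (λ v → iscopy-resp id refl (λ {i} {j} → copies-suc t t' e v i j) (N.canon-copy v))
    where
    suc-level : suc (n ∸ toℕ t') ≡ n ∸ toℕ t
    suc-level = trans (cong (λ m → suc (n ∸ m)) e)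
      (≡.sym (ℕ.+-∸-assoc 1 (subst (_≤ n) e (Fin.toℕ≤pred[n] t'))))
    facts : Facts G (Eqₙ G t t') (Chₙ G t t')
    -- `level-facts` relates consecutive levels, and the children at stage `t` lie one level below
    -- the class at stage `t'`.
    facts = subst (λ m → Facts G (Level G (n ∸ toℕ t')) (Level G m)) suc-level
        (level-facts G (n ∸ toℕ t'))
    rel-child : ∀ {x y} → Chₙ G t t' x y → ∀ {i j} → CopyAt t x i j → CopyAt t y i j
    rel-child {x} {y} xy {i} {j} = invariant x y xy i j
    module N = NodeCopy.Build G (Eqₙ G t t') (Chₙ G t t') (level-equiv G (n ∸ toℕ t')) (level-equiv G (n ∸ toℕ t))
      (λ p q → sem? forceᴰ G (proj₁ p ∷ proj₂ p ∷ proj₁ q ∷ proj₂ q ∷ t ∷ t' ∷ []) []) (Copies (toℕ t))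
          facts real
      rel-child isCopy

  correct : Realizer G → ∀ k (t : Fin (suc n)) → toℕ t ≡ k → Invariant t × AllCopies t
  correct real zero    zero    e = correct-zero
  correct real (suc k) t e = correct-suc real (clamp n k) t (trans e (cong suc (≡.sym k≡)))
      (proj₁ below) (proj₂ below)
    where
    k≡ : toℕ (clamp n k) ≡ k
    k≡ = toℕ-clamp (ℕ.≤-trans (ℕ.n≤1+n k) (subst (_≤ n) e (Fin.toℕ≤pred[n] t)))
    below = correct real k (clamp n k) k≡

  top : Fin (suc n)
  top = clamp n n

  toℕ-top : toℕ top ≡ n
  toℕ-top = toℕ-clamp {n} {n} ℕ.≤-refl

  class-top : ∀ v w → Class top v w
  class-top v w = level-≡ G 0 (n ∸ toℕ top) v w (≡.sym (trans (cong (n ∸_) toℕ-top) (ℕ.n∸n≡0 n))) (λ ())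

-- The canonizing transduction

trueᴰ : D [] []
trueᴰ = ∀ᴰ num (leᴰ v0 v0)

-- The number sort has `n` + 1 members; dropping the largest leaves as many as there are vertices.
universeᴰ : D (num ∷ []) []
universeᴰ = ∃ᴰ num (ltᴰ v1 v0)
  as (λ { {n} G (i ∷ []) σ → toℕ i < n }) by λ { {n} G (i ∷ []) σ → mk⇔
    (λ { (k , lt) → ℕ.<-≤-trans lt (Fin.toℕ≤pred[n] k) })
    (λ lt → clamp n n , ℕ.<-≤-trans lt (ℕ.≤-reflexive (≡.sym (toℕ-clamp {n} {n} ℕ.≤-refl)))) }

-- Parameters are not allowed, so the vertex is quantified; by `Invariant` all vertices of the
-- single top class yield the same copy. The largest number addresses the last stage.
copyEdgeᴰ : D (num ∷ num ∷ []) []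
copyEdgeᴰ = ∃ᴰ num (∃ᴰ el (∀ᴰ num (leᴰ v0 v2) ∧ᴰ call 4 (v1 ∷ v0 ∷ v2 ∷ v3 ∷ []) [] Canons.loopᴰ))
  as (λ { {n} G (i ∷ j ∷ []) σ → Σ (Fin n) λ v → CopyAt G (top G) v i j }) by
      λ { {n} G (i ∷ j ∷ []) σ → mk⇔
    (λ { (m , v , ub , s) → v , subst (λ k → Copies G k (v ∷ i ∷ j ∷ []) ≡ true)
      (ℕ.≤-antisym (ℕ.≤-trans (Fin.toℕ≤pred[n] m) (ℕ.≤-reflexive (≡.sym (toℕ-top G)))) (ub (top G))) s })
    (λ { (v , s) → top G , v ,
      (λ k → ℕ.≤-trans (Fin.toℕ≤pred[n] k) (ℕ.≤-reflexive (≡.sym (toℕ-top G)))) , s }) }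

equalᴰ atMostᴰ : D (num ∷ num ∷ []) []
equalᴰ  = eqᴰ v0 v1
atMostᴰ = leᴰ v0 v1

canonization : Transduction
canonization = record
  { sorts = num ∷ [] ; φdom = fm trueᴰ ; φuni = fm universeᴰ ; φeqv = fm equalᴰ
  ; φedge = fm copyEdgeᴰ ; φleq = fm atMostᴰ }

-- A missed value could be punched out, which would give an injection into a smaller set.
injective⇒onto : ∀ {m} (f : Fin m → Fin m) → (∀ {x y} → f x ≡ f y → x ≡ y) → ∀ y → Σ (Fin m) λ x → f x ≡
    y
injective⇒onto {suc m} f inj y = go (Fin.any? λ x → f x Fin.≟ y)
  where
  go : Dec (Σ (Fin (suc m)) λ x → f x ≡ y) → Σ (Fin (suc m)) λ x → f x ≡ y
  go (yes p) = p
  go (no ¬p) = ⊥-elim (ℕ.<-irrefl refl (Fin.injective⇒≤ {f = λ x → punchOut (missed x)}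
    λ {x} {x'} e → inj (Fin.punchOut-injective (missed x) (missed x') e)))
    where
    missed : ∀ x → y ≢ f x
    missed x e = ¬p (x , ≡.sym e)

module _ {n : ℕ} (G : Graph n) where

  open IsCopy

  -- `C` is kept abstract because a graph without vertices has no vertex whose copy could be taken.
  ordered-copy : (C : Fin (suc n) → Fin (suc n) → Set) →
      (∀ i j → (Σ (Fin n) λ v → CopyAt G (top G) v i j) ⇔ C i j) →
                 (I : IsCopy G (λ _ → ⊤) n C) → MapsToOrderedCopy canonization G
  ordered-copy C edge⇔ I = record
    { dom = from (ok trueᴰ G [] []) (λ k → ℕ.≤-refl)
    ; refl≈ = λ { (x ∷ []) _ → eq⁺ refl }
    ; sym≈ = λ { (x ∷ []) (y ∷ []) _ _ e → eq⁺ (≡.sym (eq⁻ e)) }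
    ; trans≈ = λ { (x ∷ []) (y ∷ []) (z ∷ []) _ _ _ e e' → eq⁺ (trans (eq⁻ e) (eq⁻ e')) }
    ; f = f ; f-U = f-U
    ; f-inj = λ u v e → place-inj (eq⁻ e)
    -- The positions are `n` distinct numbers below `n`, so each such number is taken.
    ; f-sur = λ { (i ∷ []) h → let lt = to (ok universeᴰ G (i ∷ []) []) h
                                   (v , e) = injective⇒onto short short-inj (fromℕ< lt)
                               in v , eq⁺ (Fin.toℕ-injective (trans (≡.sym (Fin.toℕ-fromℕ< lt))
                                    (trans (cong toℕ (≡.sym e)) (trans (Fin.toℕ-fromℕ< _)
                                        (≡.sym (toℕ-place v)))))) }
    ; f-E = λ u v → mk⇔
        (λ e → f u , f v , f-U u , f-U v , eq⁺ refl , eq⁺ refl ,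
          from (ok copyEdgeᴰ G (place u ∷ place v ∷ []) []) (from (edge⇔ (place u) (place v))
            (to (adj I tt tt (toℕ-place u) (toℕ-place v)) e)))
        (λ { (i ∷ [] , j ∷ [] , _ , _ , e , e' , h) →
          from (adj I tt tt (trans (cong toℕ (eq⁻ e)) (toℕ-place u))
              (trans (cong toℕ (eq⁻ e')) (toℕ-place v)))
            (to (edge⇔ i j) (to (ok copyEdgeᴰ G (i ∷ j ∷ []) []) h)) })
    ; f-≤ = record
        { isPartialOrder = record
            { isPreorder = record
                { isEquivalence = ≡.isEquivalence
                ; reflexive = λ { {u} refl → le⁺ u u ℕ.≤-refl }
                ; trans = λ {u} {v} {w} p q → le⁺ u w (ℕ.≤-trans (le⁻ u v p) (le⁻ v w q)) }
            ; antisym = λ {u} {v} p q → inj I tt tt (ℕ.≤-antisym (le⁻ u v p) (le⁻ v u q)) }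
        ; total = λ u v → [ (λ l → inj₁ (le⁺ u v l)) ,
            (λ l → inj₂ (le⁺ v u l)) ]′ (ℕ.≤-total (pos I u) (pos I v)) } }
    where
    place : Fin n → Fin (suc n)
    place u = clamp n (pos I u)
    f : Fin n → Tuple n (num ∷ [])
    f u = place u ∷ []
    toℕ-place : ∀ u → toℕ (place u) ≡ pos I u
    toℕ-place u = toℕ-clamp (ℕ.<⇒≤ (pos< I {u} tt))
    place-inj : ∀ {u v} → place u ≡ place v → u ≡ v
    place-inj {u} {v} e = inj I tt tt (trans (≡.sym (toℕ-place u)) (trans (cong toℕ e) (toℕ-place v)))
    short : Fin n → Fin n
    short u = fromℕ< (pos< I {u} tt)
    short-inj : ∀ {u v} → short u ≡ short v → u ≡ v
    short-inj e = inj I tt tt (trans (≡.sym (Fin.toℕ-fromℕ< _)) (trans (cong toℕ e) (Fin.toℕ-fromℕ< _)))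
    f-U : ∀ u → U canonization G (f u)
    f-U u = from (ok universeᴰ G (f u) []) (subst (_< n) (≡.sym (toℕ-place u)) (pos< I {u} tt))
    eq⁺ : ∀ {x y : Fin (suc n)} → x ≡ y → eval G (x ∷ y ∷ []) [] (fm equalᴰ) ≡ true
    eq⁺ {x} {y} e = from (ok equalᴰ G (x ∷ y ∷ []) []) e
    eq⁻ : ∀ {x y : Fin (suc n)} → eval G (x ∷ y ∷ []) [] (fm equalᴰ) ≡ true → x ≡ y
    eq⁻ {x} {y} e = to (ok equalᴰ G (x ∷ y ∷ []) []) e
    le⁺ : ∀ u v → pos I u ≤ pos I v → Induced canonization G (fm atMostᴰ) (f u) (f v)
    le⁺ u v l = f u , f v , f-U u , f-U v , eq⁺ refl , eq⁺ refl ,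
      from (ok atMostᴰ G (place u ∷ place v ∷ []) [])
          (≡.subst₂ _≤_ (≡.sym (toℕ-place u)) (≡.sym (toℕ-place v)) l)
    le⁻ : ∀ u v → Induced canonization G (fm atMostᴰ) (f u) (f v) → pos I u ≤ pos I v
    le⁻ u v (i ∷ [] , j ∷ [] , _ , _ , e , e' , h) = ≡.subst₂ _≤_
      (trans (cong toℕ (eq⁻ e)) (toℕ-place u)) (trans (cong toℕ (eq⁻ e')) (toℕ-place v))
      (to (ok atMostᴰ G (i ∷ j ∷ []) []) h)

theorem5p9 : AdmitsFPCCanonization IsPermutationGraph
theorem5p9 = canonization , maps
  where
  maps : ∀ n (G : Graph n) → IsPermutationGraph G → MapsToOrderedCopy canonization G
  maps zero G _ = ordered-copy G (λ _ _ → ⊥) (λ i j → mk⇔ (λ { (() , _) }) (λ ()))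
    (record { pos = λ () ; pos< = λ { {()} } ; inj = λ { {()} } ; adj = λ { {()} } })
  maps (suc m) G real = ordered-copy G (CopyAt G (top G) zero)
      (λ i j → mk⇔ (λ { (v , s) → invariant v zero (class-top G v zero) i j s }) (λ s → zero , s))
      (iscopy-resp (λ {x} _ → class-top G zero x)
        (#-full (λ w → Equiv._≟ᴱ_ (level-equiv G (suc m ∸ toℕ (top G))) zero w) (class-top G zero))
        (mk⇔ id id) (isCopy zero))
    where
    invariant = proj₁ (correct G real (suc m) (top G) (toℕ-top G))
    isCopy = proj₂ (correct G real (suc m) (top G) (toℕ-top G))
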